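{- Let $\hat a_n,\hat b_n,\hat c_n,\hat d_n,\hat e_n,\hat f_n,\hat g_n,\hat h_n,\hat k_n,\hat v_n$ denote the sums of the values of the vertices of type $A,B,C,D,E,F,G,H,K,1$, respectively, on level $n$ of the hyperbolic Pascal simplex based on the hypercube mosaic $\{4,3,3,5\}$. Then for all $n\ge1$ $$\begin{aligned} \hat a_{n+1}&=2\hat a_n+2\hat b_n+3\hat v_n,\\ \hat b_{n+1}&=\hat a_n+2\hat b_n,\\ \hat c_{n+1}&=2\hat a_n+3\hat c_n+2\hat d_n,\\ \hat d_{n+1}&=2\hat b_n+3\hat c_n+4\hat d_n+5\hat e_n,\\ \hat e_{n+1}&=3\hat c_n+4\hat d_n+6\hat e_n,\\ \hat f_{n+1}&=\hat c_n+4\hat f_n+2\hat g_n,\\ \hat g_{n+1}&=\hat d_n+6\hat f_n+6\hat g_n+5\hat h_n,\\ \hat h_{n+1}&=\hat e_n+12\hat f_n+12\hat g_n+12\hat h_n+12\hat k_n,\\ \hat k_{n+1}&=94\hat f_n+97\hat g_n+101\hat h_n+107\hat k_n,\\ \hat v_{n+1}&=\hat v_n, \end{aligned}$$ with initial values $\hat v_1=4$ and $\hat a_1=\hat b_1=\hat c_1=\hat d_1=\hat e_1=\hat f_1=\hat g_1=\hat h_1=\hat k_1=0$.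
   Context: The mosaic $\{4,3,3,5\}$ is the regular tessellation of hyperbolic 4-space by 4-dimensional hypercubes $\{4,3,3\}$ with vertex figure the 600-cell $\{3,3,5\}$ (so 600 hypercubes and 120 edges meet at each vertex). Hyperbolic Pascal simplex. Fix a vertex $V_0$ of the mosaic. The value (sign) of a vertex is the number of shortest paths along mosaic edges from $V_0$ to that vertex (the value of $V_0$ is $1$). Define a convex part $\mathcal P$ of the mosaic as follows. Take one hypercube containing $V_0$ and let $V_1$ be its vertex opposite to $V_0$ (the vertex of this hypercube with the largest value, namely $24$). Next take all new hypercubes of the mosaic containing $V_1$, and in each of them the vertex with the largest value. Then take all hypercubes containing these vertices, and in each new one the vertex with the largest value, and so on without end. $\mathcal P$ is the set of all hypercubes obtained. The vertices and edges of $\mathcal P$, with each edge directed from its endpoint nearer to $V_0$ to its endpoint farther from $V_0$, form an infinite digraph called the hyperbolic Pascal simplex. Level $n$ is the set of its vertices whose edge-distance from $V_0$ along edges of $\mathcal P$ is $n$. An incoming edge of a vertex on level $n$ is an edge from a vertex on level $n-1$; the value of a vertex other than $V_0$ is the sum of the values of the starting points of its incoming edges. Vertex types. The boundary of $\mathcal P$ has the combinatorial shape of an infinite simplicial cone with apex $V_0$: four boundary rays, six 2-dimensional faces and four 3-dimensional faces. - Type $1$: vertices on the boundary rays (value $1$). They have degree $5$ in $\mathcal P$, except $V_0$, which has degree $4$. - Types $A$, $B$: vertices in the interior of a 2-dimensional face (degree $7$ in $\mathcal P$), with exactly two (type $A$) or one (type $B$) incoming edges. - Types $C$, $D$, $E$: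 vertices in the interior of a 3-dimensional face (degree $13$ in $\mathcal P$), with exactly three (type $C$), two (type $D$) or one (type $E$) incoming edges. - Types $F$, $G$, $H$, $K$: vertices in the interior of $\mathcal P$ (degree $120$), with exactly four (type $F$), three (type $G$), two (type $H$) or one (type $K$) incoming edges.
   Formalization: The convex part P is taken as the smallest convex family of hypercubes containing the first one and closed under taking all hypercubes around the largest-valued vertex; the procedure read literally misses hypercubes, so P would not be convex and type B vertices would not have degree 7. -}

module Defs where

open import Data.Fin.Base using (Fin)
open import Data.Fin.Patterns using (0F; 1F; 2F; 3F; 4F)
open import Data.Integer.Base as ℤ using (ℤ; 0ℤ; 1ℤ; -1ℤ; +_; -[1+_])
open import Data.List.Base using (List; []; _∷_; _++_; foldr; length)
open import Data.List.Membership.Propositional using (_∈_)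
open import Data.List.Relation.Binary.Pointwise.Base using (Pointwise)
open import Data.List.Relation.Unary.Unique.Propositional using (Unique)
open import Data.Nat.Base using (ℕ; suc; _≤_)
open import Data.Nat.ListAction using (sum)
open import Data.Product.Base using (_×_; ∃-syntax)
open import Data.Product using (∃!)
open import Data.Sum.Base using (_⊎_)
open import Data.Vec.Base using (Vec; []; _∷_; lookup; replicate; zipWith; _[_]≔_)
open import Function.Bundles using (_⇔_)
open import Relation.Binary.PropositionalEquality.Core using (_≡_; _≢_)
open import Relation.Nullary.Negation.Core using (¬_)

Enumerates : {X : Set} → (X → Set) → List X → Set
Enumerates P xs = Unique xs × (∀ x → x ∈ xs ⇔ P x)

Count : {X : Set} → (X → Set) → ℕ → Set
Count P m = ∃[ xs ] Enumerates P xs × length xs ≡ m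

module Graph {X : Set} (_~_ : X → X → Set) where

  -- The list holds the vertices of the path after its starting point, so
  -- its length is the number of edges.
  data Path : X → List X → X → Set where
    []  : ∀ {x} → Path x [] x
    _∷_ : ∀ {x y z ps} → x ~ y → Path y ps z → Path x (y ∷ ps) z

  Shortest : X → X → List X → Set
  Shortest x y ps = Path x ps y × (∀ qs → Path x qs y → length ps ≤ length qs)

  Distance : X → X → ℕ → Set
  Distance x y n = ∃[ ps ] Shortest x y ps × length ps ≡ n

-- a + b φ with φ the golden ratio, φ² = φ + 1.
infix 4 _+_φ

record ℤ[φ] : Set where
  constructor _+_φ
  field
    rational golden : ℤ

0# 1# : ℤ[φ]
0# = 0ℤ + 0ℤ φ
1# = 1ℤ + 0ℤ φ

_⊖_ : ℤ[φ] → ℤ[φ] → ℤ[φ]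
(a + b φ) ⊖ (c + d φ) = (a ℤ.- c) + (b ℤ.- d) φ

_⊗_ : ℤ[φ] → ℤ[φ] → ℤ[φ]
(a + b φ) ⊗ (c + d φ) =
  (a ℤ.* c ℤ.+ b ℤ.* d) + (a ℤ.* d ℤ.+ b ℤ.* c ℤ.+ b ℤ.* d) φ

-- The mosaic {4,3,3,5}.
--
-- Hyperbolic 4-space is used in its linear (Minkowski) model.  A vector x
-- is given by the five coordinates x₀, …, x₄ that vanish on the mirrors of
-- the characteristic simplex of the mosaic, with signs chosen so that the
-- simplex is the cone where all xᵢ ≥ 0.  The symmetry group [4,3,3,5] is
-- generated by the reflections in these mirrors,
--
--   (sᵢ x)ⱼ = xⱼ - aᵢⱼ xᵢ,   aᵢᵢ = 2,   aᵢⱼ aⱼᵢ = 4 cos² (π / mᵢⱼ),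
--
-- where mᵢⱼ = 4, 3, 3, 5 for consecutive mirrors and 2 otherwise.  Scaling
-- the coordinates changes only how the products aᵢⱼ aⱼᵢ split; the choice
-- 1 · 2 for m = 4 and φ · φ for m = 5 (as 2 cos (π / 5) = φ) keeps every
-- entry in ℤ[φ].  The aᵢⱼ are symmetrizable, so the group preserves a
-- quadratic form, here of signature (4,1).

Point : Set
Point = Vec ℤ[φ] 5

cartan : Vec (Vec ℤ[φ] 5) 5
cartan = (2′  ∷ -1′ ∷ 0#  ∷ 0#  ∷ 0#  ∷ [])
       ∷ (-2′ ∷ 2′  ∷ -1′ ∷ 0#  ∷ 0#  ∷ [])
       ∷ (0#  ∷ -1′ ∷ 2′  ∷ -1′ ∷ 0#  ∷ [])
       ∷ (0#  ∷ 0#  ∷ -1′ ∷ 2′  ∷ -φ  ∷ [])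
       ∷ (0#  ∷ 0#  ∷ 0#  ∷ -φ  ∷ 2′  ∷ [])
       ∷ []
  where
  2′ -1′ -2′ -φ : ℤ[φ]
  2′  = (+ 2) + 0ℤ φ
  -1′ = -1ℤ + 0ℤ φ
  -2′ = -[1+ 1 ] + 0ℤ φ
  -φ  = 0ℤ + -1ℤ φ

reflect : Fin 5 → Point → Point
reflect i x = zipWith (λ a xⱼ → xⱼ ⊖ (a ⊗ lookup x i)) (lookup cartan i) x

Word : Set
Word = List (Fin 5)

act : Word → Point → Point
act w x = foldr reflect x w

-- The corner of the characteristic simplex opposite to mirror k.  It is the
-- centre of the k-dimensional face in the base flag of the mosaic (k = 0 a
-- vertex, 1 an edge, 2 a square, 3 a cube, 4 a hypercube).
corner : Fin 5 → Point
corner k = replicate 5 0# [ k ]≔ 1#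

-- Faces of the mosaic are represented by their centres, i.e. the k-faces
-- are the points of the orbit of corner k.  Two faces are incident (one is
-- contained in the other) when they belong to a common flag, and the flags
-- are the images of the base flag.
Incident : (j : Fin 5) → Point → (k : Fin 5) → Point → Set
Incident j x k y = ∃[ w ] act w (corner j) ≡ x × act w (corner k) ≡ y

V₀ : Point
V₀ = corner 0F

_IsEndpointOf_ : Point → Point → Set
x IsEndpointOf e = Incident 0F x 1F e

_IsVertexOf_ : Point → Point → Set
x IsVertexOf c = Incident 0F x 4F c

_~_ : Point → Point → Set
x ~ y = x ≢ y × (∃[ e ] x IsEndpointOf e × y IsEndpointOf e)

Value : Point → ℕ → Set
Value x = Count (Graph.Shortest _~_ V₀ x)

LargestVertex : Point → Point → Set
LargestVertex c x =
  x IsVertexOf c ×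
  (∃[ m ] Value x m × (∀ y m′ → y IsVertexOf c → Value y m′ → m′ ≤ m))

Reduced : Word → Set
Reduced u = ∀ u′ → (∀ x → act u′ x ≡ act u x) → length u ≤ length u′

-- The hypercubes of 𝒫: the smallest convex family that contains the base
-- hypercube and is closed under passing to all hypercubes around the
-- largest vertex of a member.
--
-- The images of the characteristic simplex under w, w·sᵢ, w·sᵢ·sⱼ, … form a
-- gallery, which is minimal exactly when the word sᵢ·sⱼ·⋯ is reduced.  A
-- union of hypercubes is convex in hyperbolic space iff it contains every
-- minimal gallery between any two of its simplices.  Without this closure
-- some hypercubes are never reached: if v has a single incoming edge, a
-- hypercube in which v is the vertex nearest to V₀ need not contain the
-- largest vertex of any other hypercube.
data 𝒫 : Point → Set where
  base   : 𝒫 (corner 4F)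
  around : ∀ {c x c′} → 𝒫 c → LargestVertex c x → x IsVertexOf c′ → 𝒫 c′
  convex : ∀ w u u′ → Reduced (u ++ u′) →
           𝒫 (act w (corner 4F)) → 𝒫 (act (w ++ u ++ u′) (corner 4F)) →
           𝒫 (act (w ++ u) (corner 4F))

_~𝒫_ : Point → Point → Set
x ~𝒫 y = x ≢ y × (∃[ e ] x IsEndpointOf e × y IsEndpointOf e ×
                   (∃[ c ] 𝒫 c × Incident 1F e 4F c))

Level : ℕ → Point → Set
Level n x = Graph.Distance _~𝒫_ V₀ x n

Degree : Point → ℕ → Set
Degree x = Count (λ y → x ~𝒫 y)

Incoming : Point → ℕ → Set
Incoming x = Count (λ y → y ~𝒫 x × (∃[ n ] Level n y × Level (suc n) x))

-- The k-dimensional faces of the boundary of 𝒫 (the rays for k = 1) are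
-- made up of those k-faces of the mosaic that lie in exactly one hypercube
-- of 𝒫: a 3-face of the mosaic in the boundary of 𝒫 is a facet of a single
-- hypercube of 𝒫, a square lies in one hypercube of 𝒫 along the
-- intersection of two 3-dimensional faces but in two inside such a face,
-- and an edge lies in one along a ray but in two inside a 2-dimensional
-- face and in five inside a 3-dimensional one.
OnFace : Fin 5 → Point → Set
OnFace k x = ∃[ f ] Incident 0F x k f × ∃! _≡_ (λ c → 𝒫 c × Incident k f 4F c)

OnRay : Point → Set
OnRay x = OnFace 1F x × (Degree x 5 ⊎ (x ≡ V₀ × Degree x 4))

Inside2Face : Point → Set
Inside2Face x = OnFace 2F x × ¬ OnFace 1F x × Degree x 7

Inside3Face : Point → Set
Inside3Face x = OnFace 3F x × ¬ OnFace 2F x × Degree x 13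

Inside𝒫 : Point → Set
Inside𝒫 x = (∃[ c ] 𝒫 c × x IsVertexOf c) × ¬ OnFace 3F x × Degree x 120

data VertexType : Set where
  𝟏 A B C D E F G H K : VertexType

HasType : VertexType → Point → Set
HasType 𝟏 x = OnRay x
HasType A x = Inside2Face x × Incoming x 2
HasType B x = Inside2Face x × Incoming x 1
HasType C x = Inside3Face x × Incoming x 3
HasType D x = Inside3Face x × Incoming x 2
HasType E x = Inside3Face x × Incoming x 1
HasType F x = Inside𝒫 x × Incoming x 4
HasType G x = Inside𝒫 x × Incoming x 3
HasType H x = Inside𝒫 x × Incoming x 2
HasType K x = Inside𝒫 x × Incoming x 1

ValueSum : VertexType → ℕ → ℕ → Set
ValueSum t n s =
  ∃[ xs ] Enumerates (λ x → Level n x × HasType t x) xs ×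
  (∃[ ms ] Pointwise Value xs ms × sum ms ≡ s)

{-# OPTIONS --safe #-}
module Submission where

-- The mirrors bisecting the edges of the mosaic (the conjugates of s₀) generate a right-angled
-- Coxeter group that is simply transitive on the vertices.  Its 120 generators Γ are the edges at V₀,
-- i.e. the vertices of the 600-cell, and two of them commute iff they span a square.  So a vertex is a
-- reduced word up to commutations, its value is the number of these words, and its incoming edges are
-- the right descents of the word.  A vertex belongs to 𝒫 iff, for each generator t of the base
-- hypercube, the first letter of the word that does not commute with t (if any) is t itself; the
-- generators t without such a letter are the "axes" of the vertex, and their number is the codimension
-- of the boundary face of 𝒫 around it.  That nothing else is in 𝒫 follows since a gallery leaving this
-- set of hypercubes and returning to it can be folded to a shorter one; conversely, all five hypercubes
-- around a square are in 𝒫 as soon as two non-adjacent ones are, which propagates from a hypercube at an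
-- incoming edge to all the required ones at a vertex.  Axes and descents form a clique of the 600-cell
-- graph, and the group [3,3,5] is transitive on ordered cliques of each size; so the type of a vertex
-- determines the numbers of its outgoing edges to vertices of each type, which are counted at V₀.

open import Defs

open import Algebra.Bundles using (CommutativeRing)
import Algebra.Consequences.Propositional as Conseq
open import Data.Bool.Base using (Bool; true; false)
open import Data.Empty using (⊥; ⊥-elim)
open import Data.Fin using (#_)
open import Data.Fin.Base as Fin using (Fin; zero; suc; toℕ)
open import Data.Fin.Patterns using (0F; 1F; 2F; 3F; 4F)
import Data.Fin.Properties as Finₚ
open import Data.Integer.Base as ℤ using (ℤ; 0ℤ; 1ℤ; -1ℤ; +_)
import Data.Integer.Properties as ℤₚ
import Data.Integer.Tactic.RingSolver as ℤ-Solver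
open import Data.Integer.Solver using (module +-*-Solver)
open import Data.List.Base as List
  using (List; []; _∷_; _++_; _∷ʳ_; foldr; length; map; reverse; filter; take; drop; concatMap; deduplicate)
open import Data.List.Membership.DecPropositional (Finₚ._≟_ {120}) using (_∈?_)
open import Data.List.Membership.Propositional using (_∈_; _∉_; find; lose)
import Data.List.Membership.Propositional.Properties as ∈ₚ
import Data.List.Properties as Listₚ
open import Data.List.Relation.Binary.Permutation.Propositional
  using (_↭_; refl; prep; swap; ↭-sym; ↭-trans)
import Data.List.Relation.Binary.Permutation.Propositional.Properties as ↭ₚ
open import Data.List.Relation.Binary.Pointwise.Base using (Pointwise; []; _∷_)
open import Data.List.Relation.Unary.All as All using (All; []; _∷_)
import Data.List.Relation.Unary.All.Properties as Allₚ
open import Data.List.Relation.Unary.AllPairs as AllPairs using (AllPairs; []; _∷_)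
import Data.List.Relation.Unary.AllPairs.Properties as AllPairsₚ
open import Data.List.Relation.Unary.Any as Any using (Any; here; there)
import Data.List.Relation.Unary.Unique.DecPropositional.Properties as DecUniqueₚ
open import Data.List.Relation.Unary.Unique.Propositional using (Unique)
import Data.List.Relation.Unary.Unique.Propositional.Properties as Uniqueₚ
open import Data.Nat using (ℕ; zero; suc; _+_; _*_; _≤_; _<_; _≥_; z≤n; s≤s)
import Data.Nat.Base as ℕ
open import Data.Nat.DivMod using (_mod_; _/_; _%_)
open import Data.Nat.Induction using (<-wellFounded)
open import Data.Nat.ListAction using (sum)
import Data.Nat.Properties as ℕₚ
import Data.Nat.Tactic.RingSolver as ℕ-Solver
open import Data.Product using (_×_; _,_; proj₁; proj₂; ∃-syntax)
open import Data.Sum.Base using (_⊎_; inj₁; inj₂; [_,_]′)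
open import Data.Unit.Base using (tt)
open import Data.Vec.Base as Vec using (Vec; []; _∷_; lookup; zipWith; updateAt)
import Data.Vec.Properties as Vecₚ
open import Function.Base using (_∘_; id; case_of_)
open import Function.Bundles using (_⇔_; mk⇔; Equivalence)
open import Induction.WellFounded using (Acc; acc)
open import Relation.Binary.Definitions using (DecidableEquality; tri<; tri≈; tri>)
open import Relation.Binary.PropositionalEquality
open import Relation.Nullary using (Dec; yes; no; ¬_; contradiction; does)
open import Relation.Nullary.Decidable
  using (toWitness; map′; dec⇒maybe; _×-dec_; _⊎-dec_; _→-dec_; ¬?)
open import Tactic.RingSolver using (solve-∀)
open import Tactic.RingSolver.Core.AlmostCommutativeRing using (AlmostCommutativeRing; fromCommutativeRing)

-- That the mirrors generate a right-angled Coxeter group comes out of one invariant, `Signs`: the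
-- signs of the 120 walls at the image of a point show the descents of a reduced word. Its induction
-- needs a quantitative form of "ultraparallel walls bound disjoint half-spaces". This works because
-- the pairing of two generators is 2, 0 or at most -2φ. Facts about the 600-cell are decided by
-- evaluation in a fixed position and carried elsewhere by [3,3,5]. The obstacle in bounding 𝒫 from
-- above is that `convex` allows every reduced gallery. The boundary 3-faces of 𝒫 are bent along
-- their squares, so a gallery that leaves through a boundary cube is folded at each visited vertex
-- along a translate of the mirror of that cube. The translates fit together because a generator
-- commuting with the axis is either on the mirror, and kept by the fold, or in front of it, where
-- nothing is folded. Since a value is a number of words, a sum of values over the vertices of one
-- type is the number of words of that type, and the recurrences count the ways to append one
-- letter.

open ℤ[φ]

-- The ring ℤ[φ]

infixl 6 _⊕_
_⊕_ : ℤ[φ] → ℤ[φ] → ℤ[φ]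
(a + b φ) ⊕ (c + d φ) = (a ℤ.+ c) + (b ℤ.+ d) φ

infix 8 ⊝_
⊝_ : ℤ[φ] → ℤ[φ]
⊝ (a + b φ) = (ℤ.- a) + (ℤ.- b) φ

private
 module S = +-*-Solver
 open S using (Polynomial; _:=_)
 -- Symbolic elements of ℤ[φ]: each ring law becomes two polynomial identities over ℤ, one per
 -- component.
 Poly : ℕ → Set
 Poly n = Polynomial n × Polynomial n
 _:⊕_ _:⊗_ : ∀ {n} → Poly n → Poly n → Poly n
 (a , b) :⊕ (c , d) = a S.:+ c , b S.:+ d
 (a , b) :⊗ (c , d) = a S.:* c S.:+ b S.:* d , a S.:* d S.:+ b S.:* c S.:+ b S.:* d

⊗-assoc : ∀ x y z → (x ⊗ y) ⊗ z ≡ x ⊗ (y ⊗ z)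
⊗-assoc (a + b φ) (c + d φ) (e + f φ) = cong₂ _+_φ
  (S.solve 6 (λ a b c d e f → proj₁ (((a , b) :⊗ (c , d)) :⊗ (e , f)) := proj₁
      ((a , b) :⊗ ((c , d) :⊗ (e , f)))) refl a b c d e f)
  (S.solve 6 (λ a b c d e f → proj₂ (((a , b) :⊗ (c , d)) :⊗ (e , f)) := proj₂
      ((a , b) :⊗ ((c , d) :⊗ (e , f)))) refl a b c d e f)

⊗-distribˡ : ∀ x y z → x ⊗ (y ⊕ z) ≡ x ⊗ y ⊕ x ⊗ z
⊗-distribˡ (a + b φ) (c + d φ) (e + f φ) = cong₂ _+_φ
  (S.solve 6 (λ a b c d e f → proj₁ ((a , b) :⊗ ((c , d) :⊕ (e , f))) := proj₁
      (((a , b) :⊗ (c , d)) :⊕ ((a , b) :⊗ (e , f)))) refl a b c d e f)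
  (S.solve 6 (λ a b c d e f → proj₂ ((a , b) :⊗ ((c , d) :⊕ (e , f))) := proj₂
      (((a , b) :⊗ (c , d)) :⊕ ((a , b) :⊗ (e , f)))) refl a b c d e f)

⊗-comm : ∀ x y → x ⊗ y ≡ y ⊗ x
⊗-comm (a + b φ) (c + d φ) = cong₂ _+_φ
  (S.solve 4 (λ a b c d → proj₁ ((a , b) :⊗ (c , d)) := proj₁ ((c , d) :⊗ (a , b))) refl a b c d)
  (S.solve 4 (λ a b c d → proj₂ ((a , b) :⊗ (c , d)) := proj₂ ((c , d) :⊗ (a , b))) refl a b c d)

⊗-identityˡ : ∀ x → 1# ⊗ x ≡ x
⊗-identityˡ (a + b φ) = cong₂ _+_φ
  (S.solve 2 (λ a b → proj₁ ((S.con 1ℤ , S.con 0ℤ) :⊗ (a , b)) := a) refl a b)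
  (S.solve 2 (λ a b → proj₂ ((S.con 1ℤ , S.con 0ℤ) :⊗ (a , b)) := b) refl a b)

golden-ring : CommutativeRing _ _
golden-ring = record
  { Carrier = ℤ[φ] ; _≈_ = _≡_ ; _+_ = _⊕_ ; _*_ = _⊗_ ; -_ = ⊝_ ; 0# = 0# ; 1# = 1#
  ; isCommutativeRing = record
    { isRing = record
      { +-isAbelianGroup = record
        { isGroup = record
          { isMonoid = record
            { isSemigroup = record
              { isMagma = record { isEquivalence = isEquivalence ; ∙-cong = cong₂ _⊕_ }
              ; assoc = λ (a + b φ) (c + d φ) (e + f φ) → cong₂ _+_φ (ℤₚ.+-assoc a c e) (ℤₚ.+-assoc b d f) }
            ; identity = (λ (a + b φ) → cong₂ _+_φ (ℤₚ.+-identityˡ a) (ℤₚ.+-identityˡ b))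
                       , (λ (a + b φ) → cong₂ _+_φ (ℤₚ.+-identityʳ a) (ℤₚ.+-identityʳ b)) }
          ; inverse = (λ (a + b φ) → cong₂ _+_φ (ℤₚ.+-inverseˡ a) (ℤₚ.+-inverseˡ b))
                    , (λ (a + b φ) → cong₂ _+_φ (ℤₚ.+-inverseʳ a) (ℤₚ.+-inverseʳ b))
          ; ⁻¹-cong = cong ⊝_ }
        ; comm = λ (a + b φ) (c + d φ) → cong₂ _+_φ (ℤₚ.+-comm a c) (ℤₚ.+-comm b d) }
      ; *-cong = cong₂ _⊗_
      ; *-assoc = ⊗-assoc
      ; *-identity = ⊗-identityˡ , (λ x → trans (⊗-comm x 1#) (⊗-identityˡ x))
      ; distrib = ⊗-distribˡ , Conseq.comm∧distrˡ⇒distrʳ ⊗-comm ⊗-distribˡ }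
    ; *-comm = ⊗-comm } }

_≟φ_ : DecidableEquality ℤ[φ]
(a + b φ) ≟φ (c + d φ) = map′ (λ { (p , q) → cong₂ _+_φ p q }) (λ { refl → refl , refl })
  ((a ℤₚ.≟ c) ×-dec (b ℤₚ.≟ d))

golden-solver : AlmostCommutativeRing _ _
golden-solver = fromCommutativeRing golden-ring (λ x → dec⇒maybe (0# ≟φ x))

_≟P_ : ∀ {n} → DecidableEquality (Vec ℤ[φ] n)
_≟P_ = Vecₚ.≡-dec _≟φ_

-- Linear functionals and shifts of vectors

dot : ∀ {n} → Vec ℤ[φ] n → Vec ℤ[φ] n → ℤ[φ]
dot []       []       = 0#
dot (c ∷ cs) (y ∷ ys) = c ⊗ y ⊕ dot cs ys

-- The common form of all reflections used below: `reflect i` shifts along row i of `cartan`,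
-- `mirror g` along `coroot g`.
shift : ∀ {n} → Vec ℤ[φ] n → ℤ[φ] → Vec ℤ[φ] n → Vec ℤ[φ] n
shift v l y = zipWith (λ a x → x ⊖ (a ⊗ l)) v y

opaque
  dot-shift : ∀ {n} (c v : Vec ℤ[φ] n) l y → dot c (shift v l y) ≡ dot c y ⊕ ⊝ (dot c v ⊗ l)
  dot-shift []       []       l []       = lem l
    where
    lem : ∀ l → 0# ≡ 0# ⊕ ⊝ (0# ⊗ l)
    lem = solve-∀ golden-solver
  dot-shift (c ∷ cs) (v ∷ vs) l (y ∷ ys) =
    trans (cong (c ⊗ (y ⊖ (v ⊗ l)) ⊕_) (dot-shift cs vs l ys)) (lem c y v l (dot cs ys) (dot cs vs))
    where
    lem : ∀ c y v l s t → c ⊗ (y ⊕ ⊝ (v ⊗ l)) ⊕ (s ⊕ ⊝ (t ⊗ l)) ≡ (c ⊗ y ⊕ s) ⊕ ⊝ ((c ⊗ v ⊕ t) ⊗ l)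
    lem = solve-∀ golden-solver

  dot-updateAt : ∀ {n} (c y : Vec ℤ[φ] n) i k →
    dot (updateAt c i (_⊖ k)) y ≡ dot c y ⊕ ⊝ (k ⊗ lookup y i)
  dot-updateAt (c ∷ cs) (y ∷ ys) zero k = lem c k y (dot cs ys)
    where
    lem : ∀ c k y s → (c ⊕ ⊝ k) ⊗ y ⊕ s ≡ (c ⊗ y ⊕ s) ⊕ ⊝ (k ⊗ y)
    lem = solve-∀ golden-solver
  dot-updateAt (c ∷ cs) (y ∷ ys) (suc i) k =
    trans (cong (c ⊗ y ⊕_) (dot-updateAt cs ys i k)) (lem c y (dot cs ys) k (lookup ys i))
    where
    lem : ∀ c y s k z → c ⊗ y ⊕ (s ⊕ ⊝ (k ⊗ z)) ≡ (c ⊗ y ⊕ s) ⊕ ⊝ (k ⊗ z)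
    lem = solve-∀ golden-solver

  lookup-shift : ∀ {n} (v : Vec ℤ[φ] n) l y i → lookup (shift v l y) i ≡ lookup y i ⊖ (lookup v i ⊗ l)
  lookup-shift v l y i = Vecₚ.lookup-zipWith _ i v y

  -- The reason why conjugating a reflection gives a reflection: if l and k are the values of one
  -- functional at y and at v, then l ⊖ (k ⊗ u) is its value at the shifted point.
  shift-shift : ∀ {n} (a v : Vec ℤ[φ] n) l k u y →
    shift a (l ⊖ (k ⊗ u)) (shift v u y) ≡ shift (shift a k v) u (shift a l y)
  shift-shift []       []       l k u []       = refl
  shift-shift (a ∷ as) (v ∷ vs) l k u (y ∷ ys) = cong₂ _∷_ (lem y a l k u v) (shift-shift as vs l k u ys)
    where
    lem : ∀ y a l k u v → (y ⊕ ⊝ (v ⊗ u)) ⊕ ⊝ (a ⊗ (l ⊕ ⊝ (k ⊗ u))) ≡ (y ⊕ ⊝ (a ⊗ l)) ⊕ ⊝ ((v ⊕ ⊝ (a ⊗ k)) ⊗ u)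
    lem = solve-∀ golden-solver

  shift-comm : ∀ {n} (a v : Vec ℤ[φ] n) l u y → shift a l (shift v u y) ≡ shift v u (shift a l y)
  shift-comm []       []       l u []       = refl
  shift-comm (a ∷ as) (v ∷ vs) l u (y ∷ ys) = cong₂ _∷_ (lem y a l u v) (shift-comm as vs l u ys)
    where
    lem : ∀ y a l u v → (y ⊕ ⊝ (v ⊗ u)) ⊕ ⊝ (a ⊗ l) ≡ (y ⊕ ⊝ (a ⊗ l)) ⊕ ⊝ (v ⊗ u)
    lem = solve-∀ golden-solver

  shift-cancel : ∀ {n} (v : Vec ℤ[φ] n) l y → shift v (⊝ l) (shift v l y) ≡ y
  shift-cancel []       l []       = refl
  shift-cancel (v ∷ vs) l (y ∷ ys) = cong₂ _∷_ (lem y v l) (shift-cancel vs l ys)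
    where
    lem : ∀ y v l → (y ⊕ ⊝ (v ⊗ l)) ⊕ ⊝ (v ⊗ (⊝ l)) ≡ y
    lem = solve-∀ golden-solver

  shift-0 : ∀ {n} (v : Vec ℤ[φ] n) y → shift v 0# y ≡ y
  shift-0 []       []       = refl
  shift-0 (v ∷ vs) (y ∷ ys) = cong₂ _∷_ (lem y v) (shift-0 vs ys)
    where
    lem : ∀ y v → y ⊕ ⊝ (v ⊗ 0#) ≡ y
    lem = solve-∀ golden-solver

scale : ∀ {n} → ℤ[φ] → Vec ℤ[φ] n → Vec ℤ[φ] n
scale k = Vec.map (k ⊗_)

opaque
  scale-shift : ∀ {n} k (v : Vec ℤ[φ] n) l y → scale k (shift v l y) ≡ shift v (k ⊗ l) (scale k y)
  scale-shift k []       l []       = refl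
  scale-shift k (v ∷ vs) l (y ∷ ys) = cong₂ _∷_ (lem k y v l) (scale-shift k vs l ys)
    where
    lem : ∀ k y v l → k ⊗ (y ⊕ ⊝ (v ⊗ l)) ≡ (k ⊗ y) ⊕ ⊝ (v ⊗ (k ⊗ l))
    lem = solve-∀ golden-solver

  scale-1 : ∀ {n} (y : Vec ℤ[φ] n) → scale 1# y ≡ y
  scale-1 y = trans (Vecₚ.map-cong ⊗-identityˡ y) (Vecₚ.map-id y)

opaque
  -- Only the coefficient at i changes, so the action on functionals can be checked on coefficients,
  -- as in `covector-perm`.
  dot-reflect : ∀ (c : Vec ℤ[φ] 5) i y →
    dot c (reflect i y) ≡ dot (updateAt c i (_⊖ dot c (lookup cartan i))) y
  dot-reflect c i y = trans (dot-shift c (lookup cartan i) (lookup y i) y)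
    (sym (dot-updateAt c y i (dot c (lookup cartan i))))

opaque
  reflect-scale : ∀ i k y → reflect i (scale k y) ≡ scale k (reflect i y)
  reflect-scale i k y = trans (cong (λ z → shift (lookup cartan i) z (scale k y)) (Vecₚ.lookup-map i _ y))
    (sym (scale-shift k (lookup cartan i) (lookup y i) y))

  reflect-shift : ∀ i (v : Point) u y → reflect i (shift v u y) ≡ shift (reflect i v) u (reflect i y)
  reflect-shift i v u y = trans (cong (λ z → shift (lookup cartan i) z (shift v u y)) (lookup-shift v u y i))
    (shift-shift (lookup cartan i) v (lookup y i) (lookup v i) u y)

-- The orbit of the functional x₀ under s₁, …, s₄, in order of word length.  Row i of images is the
-- action of sᵢ₊₁ on it, and a functional x₀ + 2 (b₁ x₁ + ⋯ + b₄ x₄) is listed by b₁, …, b₄.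
images : Vec (Vec ℕ 120) 4
images =
  ( 1 ∷ 0 ∷ 2 ∷ 3 ∷ 4 ∷ 5 ∷ 8 ∷ 7 ∷ 6 ∷ 10 ∷ 9 ∷ 12 ∷ 11 ∷ 15 ∷ 14 ∷ 13 ∷ 18 ∷ 17 ∷ 16 ∷
    22 ∷ 20 ∷ 25 ∷ 19 ∷ 26 ∷ 24 ∷ 21 ∷ 23 ∷ 29 ∷ 28 ∷ 27 ∷ 32 ∷ 35 ∷ 30 ∷ 38 ∷ 37 ∷ 31 ∷
    40 ∷ 34 ∷ 33 ∷ 42 ∷ 36 ∷ 44 ∷ 39 ∷ 46 ∷ 41 ∷ 48 ∷ 43 ∷ 51 ∷ 45 ∷ 53 ∷ 50 ∷ 47 ∷ 52 ∷
    49 ∷ 57 ∷ 55 ∷ 56 ∷ 54 ∷ 62 ∷ 59 ∷ 60 ∷ 66 ∷ 58 ∷ 63 ∷ 68 ∷ 65 ∷ 61 ∷ 67 ∷ 64 ∷ 72 ∷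
    70 ∷ 75 ∷ 69 ∷ 76 ∷ 79 ∷ 71 ∷ 73 ∷ 82 ∷ 81 ∷ 74 ∷ 84 ∷ 78 ∷ 77 ∷ 86 ∷ 80 ∷ 88 ∷ 83 ∷
    90 ∷ 85 ∷ 91 ∷ 87 ∷ 89 ∷ 95 ∷ 93 ∷ 94 ∷ 92 ∷ 98 ∷ 97 ∷ 96 ∷ 102 ∷ 100 ∷ 105 ∷ 99 ∷ 106 ∷
    104 ∷ 101 ∷ 103 ∷ 108 ∷ 107 ∷ 110 ∷ 109 ∷ 113 ∷ 112 ∷ 111 ∷ 114 ∷ 115 ∷ 116 ∷ 117 ∷
    119 ∷ 118 ∷ []) ∷
  ( 0 ∷ 2 ∷ 1 ∷ 3 ∷ 4 ∷ 6 ∷ 5 ∷ 9 ∷ 8 ∷ 7 ∷ 10 ∷ 11 ∷ 14 ∷ 13 ∷ 12 ∷ 17 ∷ 19 ∷ 15 ∷ 21 ∷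
    16 ∷ 23 ∷ 18 ∷ 25 ∷ 20 ∷ 27 ∷ 22 ∷ 26 ∷ 24 ∷ 31 ∷ 29 ∷ 33 ∷ 28 ∷ 36 ∷ 30 ∷ 39 ∷ 35 ∷
    32 ∷ 41 ∷ 40 ∷ 34 ∷ 38 ∷ 37 ∷ 44 ∷ 43 ∷ 42 ∷ 45 ∷ 50 ∷ 47 ∷ 52 ∷ 49 ∷ 46 ∷ 55 ∷ 48 ∷
    56 ∷ 58 ∷ 51 ∷ 53 ∷ 61 ∷ 54 ∷ 59 ∷ 64 ∷ 57 ∷ 66 ∷ 63 ∷ 60 ∷ 69 ∷ 62 ∷ 71 ∷ 68 ∷ 65 ∷
    74 ∷ 67 ∷ 72 ∷ 77 ∷ 70 ∷ 75 ∷ 80 ∷ 73 ∷ 83 ∷ 79 ∷ 76 ∷ 85 ∷ 84 ∷ 78 ∷ 82 ∷ 81 ∷ 88 ∷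
    87 ∷ 86 ∷ 89 ∷ 93 ∷ 94 ∷ 92 ∷ 90 ∷ 91 ∷ 97 ∷ 99 ∷ 95 ∷ 101 ∷ 96 ∷ 103 ∷ 98 ∷ 105 ∷ 100 ∷
    107 ∷ 102 ∷ 106 ∷ 104 ∷ 108 ∷ 109 ∷ 112 ∷ 111 ∷ 110 ∷ 114 ∷ 113 ∷ 115 ∷ 116 ∷ 118 ∷
    117 ∷ 119 ∷ []) ∷
  ( 0 ∷ 1 ∷ 3 ∷ 2 ∷ 5 ∷ 4 ∷ 6 ∷ 7 ∷ 8 ∷ 11 ∷ 12 ∷ 9 ∷ 10 ∷ 16 ∷ 14 ∷ 18 ∷ 13 ∷ 20 ∷ 15 ∷
    19 ∷ 17 ∷ 23 ∷ 22 ∷ 21 ∷ 28 ∷ 26 ∷ 25 ∷ 30 ∷ 24 ∷ 32 ∷ 27 ∷ 33 ∷ 29 ∷ 31 ∷ 34 ∷ 38 ∷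
    36 ∷ 37 ∷ 35 ∷ 43 ∷ 40 ∷ 45 ∷ 46 ∷ 39 ∷ 48 ∷ 41 ∷ 42 ∷ 47 ∷ 44 ∷ 54 ∷ 52 ∷ 51 ∷ 50 ∷
    57 ∷ 49 ∷ 59 ∷ 60 ∷ 53 ∷ 58 ∷ 55 ∷ 56 ∷ 64 ∷ 62 ∷ 67 ∷ 61 ∷ 70 ∷ 68 ∷ 63 ∷ 66 ∷ 73 ∷
    65 ∷ 71 ∷ 76 ∷ 69 ∷ 77 ∷ 75 ∷ 72 ∷ 74 ∷ 78 ∷ 82 ∷ 80 ∷ 81 ∷ 79 ∷ 87 ∷ 84 ∷ 89 ∷ 90 ∷
    83 ∷ 91 ∷ 85 ∷ 86 ∷ 88 ∷ 96 ∷ 94 ∷ 93 ∷ 98 ∷ 92 ∷ 100 ∷ 95 ∷ 99 ∷ 97 ∷ 103 ∷ 102 ∷ 101 ∷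
    104 ∷ 106 ∷ 105 ∷ 109 ∷ 110 ∷ 107 ∷ 108 ∷ 111 ∷ 112 ∷ 113 ∷ 115 ∷ 114 ∷ 117 ∷ 116 ∷
    118 ∷ 119 ∷ []) ∷
  ( 0 ∷ 1 ∷ 2 ∷ 4 ∷ 3 ∷ 7 ∷ 9 ∷ 5 ∷ 10 ∷ 6 ∷ 8 ∷ 13 ∷ 15 ∷ 11 ∷ 17 ∷ 12 ∷ 16 ∷ 14 ∷ 18 ∷
    19 ∷ 24 ∷ 21 ∷ 22 ∷ 27 ∷ 20 ∷ 25 ∷ 29 ∷ 23 ∷ 28 ∷ 26 ∷ 34 ∷ 31 ∷ 37 ∷ 39 ∷ 30 ∷ 35 ∷
    41 ∷ 32 ∷ 42 ∷ 33 ∷ 44 ∷ 36 ∷ 38 ∷ 47 ∷ 40 ∷ 49 ∷ 51 ∷ 43 ∷ 53 ∷ 45 ∷ 55 ∷ 46 ∷ 56 ∷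
    48 ∷ 54 ∷ 50 ∷ 52 ∷ 57 ∷ 58 ∷ 63 ∷ 65 ∷ 61 ∷ 62 ∷ 59 ∷ 69 ∷ 60 ∷ 66 ∷ 70 ∷ 72 ∷ 64 ∷
    67 ∷ 74 ∷ 68 ∷ 78 ∷ 71 ∷ 79 ∷ 81 ∷ 83 ∷ 73 ∷ 75 ∷ 85 ∷ 76 ∷ 86 ∷ 77 ∷ 88 ∷ 80 ∷ 82 ∷
    87 ∷ 84 ∷ 92 ∷ 90 ∷ 95 ∷ 89 ∷ 93 ∷ 97 ∷ 91 ∷ 96 ∷ 94 ∷ 98 ∷ 99 ∷ 104 ∷ 101 ∷ 102 ∷ 107 ∷
    100 ∷ 105 ∷ 108 ∷ 103 ∷ 106 ∷ 111 ∷ 113 ∷ 109 ∷ 114 ∷ 110 ∷ 112 ∷ 116 ∷ 115 ∷ 117 ∷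
    118 ∷ 119 ∷ []) ∷
  []

coefficients : Vec (Vec ℤ[φ] 4) 120
coefficients =
  e 0 0 0 0 0 0 0 0 ∷ e 1 0 0 0 0 0 0 0 ∷ e 1 0 1 0 0 0 0 0 ∷ e 1 0 1 0 1 0 0 0 ∷
  e 1 0 1 0 1 0 0 1 ∷ e 1 0 1 0 1 1 0 1 ∷ e 1 0 1 1 1 1 0 1 ∷ e 1 0 1 0 1 1 1 1 ∷
  e 1 1 1 1 1 1 0 1 ∷ e 1 0 1 1 1 1 1 1 ∷ e 1 1 1 1 1 1 1 1 ∷ e 1 0 1 1 1 2 1 1 ∷
  e 1 1 1 1 1 2 1 1 ∷ e 1 0 1 1 1 2 1 2 ∷ e 1 1 1 2 1 2 1 1 ∷ e 1 1 1 1 1 2 1 2 ∷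
  e 1 0 1 1 2 2 1 2 ∷ e 1 1 1 2 1 2 1 2 ∷ e 1 1 1 1 2 2 1 2 ∷ e 1 0 2 1 2 2 1 2 ∷
  e 1 1 1 2 2 3 1 2 ∷ e 1 1 2 2 2 2 1 2 ∷ e 2 1 2 1 2 2 1 2 ∷ e 1 1 2 2 2 3 1 2 ∷
  e 1 1 1 2 2 3 2 3 ∷ e 2 1 2 2 2 2 1 2 ∷ e 2 1 2 2 2 3 1 2 ∷ e 1 1 2 2 2 3 2 3 ∷
  e 1 1 1 2 2 4 2 3 ∷ e 2 1 2 2 2 3 2 3 ∷ e 1 1 2 2 3 4 2 3 ∷ e 1 1 2 3 2 4 2 3 ∷
  e 2 1 2 2 3 4 2 3 ∷ e 1 1 2 3 3 4 2 3 ∷ e 1 1 2 2 3 4 2 4 ∷ e 2 2 2 3 2 4 2 3 ∷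
  e 2 1 3 3 3 4 2 3 ∷ e 2 1 2 2 3 4 2 4 ∷ e 2 2 2 3 3 4 2 3 ∷ e 1 1 2 3 3 4 2 4 ∷
  e 2 2 3 3 3 4 2 3 ∷ e 2 1 3 3 3 4 2 4 ∷ e 2 2 2 3 3 4 2 4 ∷ e 1 1 2 3 3 5 2 4 ∷
  e 2 2 3 3 3 4 2 4 ∷ e 2 1 3 3 4 5 2 4 ∷ e 2 2 2 3 3 5 2 4 ∷ e 1 1 2 3 3 5 3 4 ∷
  e 2 2 3 3 4 5 2 4 ∷ e 2 1 3 3 4 5 3 5 ∷ e 2 2 3 4 3 5 2 4 ∷ e 2 2 2 3 3 5 3 4 ∷
  e 2 2 3 4 4 5 2 4 ∷ e 2 2 3 3 4 5 3 5 ∷ e 2 1 3 3 4 6 3 5 ∷ e 2 2 3 4 3 5 3 4 ∷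
  e 2 2 3 4 4 5 3 5 ∷ e 2 2 3 3 4 6 3 5 ∷ e 2 1 3 4 4 6 3 5 ∷ e 2 2 3 4 4 6 3 4 ∷
  e 2 2 3 4 4 7 3 5 ∷ e 2 2 3 5 4 6 3 5 ∷ e 2 3 3 4 4 6 3 5 ∷ e 2 2 3 4 4 6 3 6 ∷
  e 2 2 3 5 4 7 3 5 ∷ e 2 2 3 4 4 7 4 6 ∷ e 2 3 3 5 4 6 3 5 ∷ e 2 2 3 4 5 7 3 6 ∷
  e 2 3 3 5 4 7 3 5 ∷ e 2 2 3 5 4 7 4 6 ∷ e 2 2 3 4 5 7 4 6 ∷ e 2 2 4 5 5 7 3 6 ∷
  e 2 3 3 5 4 7 4 6 ∷ e 2 2 3 5 5 8 4 6 ∷ e 2 2 4 5 5 7 4 6 ∷ e 3 3 4 5 5 7 3 6 ∷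
  e 2 3 3 5 5 8 4 6 ∷ e 2 2 4 5 5 8 4 6 ∷ e 2 2 3 5 5 8 4 7 ∷ e 3 3 4 5 5 7 4 6 ∷
  e 2 3 4 6 5 8 4 6 ∷ e 2 3 3 5 5 8 4 7 ∷ e 3 3 4 5 5 8 4 6 ∷ e 2 2 4 5 5 8 4 7 ∷
  e 3 3 4 6 5 8 4 6 ∷ e 2 3 4 6 5 8 4 7 ∷ e 3 3 4 5 5 8 4 7 ∷ e 2 2 4 5 6 8 4 7 ∷
  e 3 3 4 6 5 8 4 7 ∷ e 2 3 4 6 6 9 4 7 ∷ e 3 3 4 5 6 8 4 7 ∷ e 3 3 4 6 6 9 4 7 ∷
  e 2 3 4 6 6 9 5 8 ∷ e 3 3 5 6 6 8 4 7 ∷ e 3 3 5 6 6 9 4 7 ∷ e 3 3 4 6 6 9 5 8 ∷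
  e 2 3 4 6 6 10 5 8 ∷ e 3 3 5 6 6 9 5 8 ∷ e 3 3 4 6 6 10 5 8 ∷ e 2 3 4 7 6 10 5 8 ∷
  e 3 3 5 6 7 10 5 8 ∷ e 3 3 5 7 6 10 5 8 ∷ e 3 4 4 7 6 10 5 8 ∷ e 3 3 5 7 7 10 5 8 ∷
  e 3 3 5 6 7 10 5 9 ∷ e 3 4 5 7 6 10 5 8 ∷ e 3 4 5 7 7 10 5 8 ∷ e 3 3 5 7 7 10 5 9 ∷
  e 3 4 5 7 7 10 5 9 ∷ e 3 3 5 7 7 11 5 9 ∷ e 3 4 5 7 7 11 5 9 ∷ e 3 3 5 7 7 11 6 9 ∷
  e 3 4 5 8 7 11 5 9 ∷ e 3 4 5 7 7 11 6 9 ∷ e 3 4 5 8 7 11 6 9 ∷ e 3 4 5 8 7 12 6 9 ∷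
  e 3 4 5 8 7 12 6 10 ∷ e 3 4 5 8 8 12 6 10 ∷ e 3 4 6 8 8 12 6 10 ∷ e 4 4 6 8 8 12 6 10 ∷ []
  where
  e : (a a′ b b′ c c′ d d′ : ℕ) → Vec ℤ[φ] 4
  e a a′ b b′ c c′ d d′ = (+ a + + a′ φ) ∷ (+ b + + b′ φ) ∷ (+ c + + c′ φ) ∷ (+ d + + d′ φ) ∷ []

-- The 120 edge generators at V₀

Γ : Set
Γ = Fin 120

-- The edges of the base hypercube at V₀ are t₁, ..., t₄. In its neighbour across the cube spanned
-- by t₁, t₂, t₃ the edge t₄ is replaced by t₄′.
t₁ t₂ t₃ t₄ t₄′ : Γ
t₁ = # 0 ; t₂ = # 1 ; t₃ = # 2 ; t₄ = # 3 ; t₄′ = # 4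

opaque
  perm : Fin 4 → Γ → Γ
  perm i g = lookup (lookup images i) g mod 120

  -- The conjugate of s₀ belonging to g subtracts `covector g`(x) times `coroot g` from x. Both use
  -- the same table of coefficients; the covector has an extra factor 2 because `cartan` splits the
  -- product for m = 4 as 1 · 2.
  covector coroot : Γ → Vec ℤ[φ] 5
  covector g = 1# ∷ scale ((+ 2) + 0ℤ φ) (lookup coefficients g)
  coroot g = combine (lookup coefficients g)
    where
    combine : Vec ℤ[φ] 4 → Vec ℤ[φ] 5
    combine (a ∷ b ∷ c ∷ d ∷ []) = shift (lookup cartan 1F) (⊝ a) (shift (lookup cartan 2F) (⊝ b)
      (shift (lookup cartan 3F) (⊝ c) (shift (lookup cartan 4F) (⊝ d) (lookup cartan 0F))))

  perm-involutive : ∀ i g → perm i (perm i g) ≡ g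
  perm-involutive = toWitness {a? = Finₚ.all? λ i → Finₚ.all? λ g → perm i (perm i g) Finₚ.≟ g} tt

  coroot-perm : ∀ i g → reflect (suc i) (coroot g) ≡ coroot (perm i g)
  coroot-perm = toWitness {a? = Finₚ.all? λ i → Finₚ.all? λ g → reflect (suc i) (coroot g) ≟P coroot (perm i g)} tt

  covector-perm : ∀ i g → let c = covector (perm i g) in
    updateAt c (suc i) (_⊖ dot c (lookup cartan (suc i))) ≡ covector g
  covector-perm = toWitness {a? = Finₚ.all? λ i → Finₚ.all? λ g → let c = covector (perm i g) in
    updateAt c (suc i) (_⊖ dot c (lookup cartan (suc i))) ≟P covector g} tt

  coroot-t₁ : coroot t₁ ≡ lookup cartan 0F
  coroot-t₁ = refl

opaque
  undo : {I X : Set} (op : I → X → X) → (∀ i x → op i (op i x) ≡ x) →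
    ∀ w x → foldr op (foldr op x w) (reverse w) ≡ x
  undo op inv []      x = refl
  undo {X = X} op inv (i ∷ w) x = begin
    foldr op (op i y) (reverse (i ∷ w))   ≡⟨ cong (foldr op (op i y)) (Listₚ.unfold-reverse i w) ⟩
    foldr op (op i y) (reverse w ∷ʳ i)    ≡⟨ Listₚ.foldr-∷ʳ op _ i (reverse w) ⟩
    foldr op (op i (op i y)) (reverse w)  ≡⟨ cong (λ z → foldr op z (reverse w)) (inv i y) ⟩
    foldr op y (reverse w)                ≡⟨ undo op inv w x ⟩
    x                                     ∎
    where
    open ≡-Reasoning
    y : X
    y = foldr op x w

  undo′ : {I X : Set} (op : I → X → X) → (∀ i x → op i (op i x) ≡ x) →
    ∀ w x → foldr op (foldr op x (reverse w)) w ≡ x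
  undo′ op inv w x = trans (cong (foldr op (foldr op x (reverse w))) (sym (Listₚ.reverse-involutive w)))
    (undo op inv (reverse w) x)

-- Positivity in ℤ[φ]

φ# 2# : ℤ[φ]
φ# = 0ℤ + 1ℤ φ
2# = (+ 2) + 0ℤ φ

-- A sufficient condition for z ≥ ε that is decided on coefficients and is stable under adding and
-- multiplying nonnegative terms. It is stronger than real positivity: φ⁻¹ = -1 + φ fails it. The
-- case ε = 1 serves for V₀, ε = 0 for points of the closed cell around it.
Pos : ℕ → ℤ[φ] → Set
Pos ε z = + ε ℤ.≤ rational z × 0ℤ ℤ.≤ golden z

Pos? : ∀ ε z → Dec (Pos ε z)
Pos? ε z = (+ ε ℤₚ.≤? rational z) ×-dec (0ℤ ℤₚ.≤? golden z)

opaque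
  Pos-⊕ : ∀ {ε z u} → Pos ε z → Pos 0 u → Pos ε (z ⊕ u)
  Pos-⊕ {ε} {z} {u} (a , b) (c , d) =
    subst (ℤ._≤ rational z ℤ.+ rational u) (ℤₚ.+-identityʳ (+ ε)) (ℤₚ.+-mono-≤ a c) , ℤₚ.+-mono-≤ b d

  *-nonneg : ∀ {i j} → 0ℤ ℤ.≤ i → 0ℤ ℤ.≤ j → 0ℤ ℤ.≤ i ℤ.* j
  *-nonneg {+ a} {+ b} _ _ = subst (0ℤ ℤ.≤_) (ℤₚ.pos-* a b) (ℤ.+≤+ z≤n)

  Pos-⊗ : ∀ {z u} → Pos 0 z → Pos 0 u → Pos 0 (z ⊗ u)
  Pos-⊗ (a , b) (c , d) =
    ℤₚ.+-mono-≤ (*-nonneg a c) (*-nonneg b d) ,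
    ℤₚ.+-mono-≤ (ℤₚ.+-mono-≤ (*-nonneg a d) (*-nonneg b c)) (*-nonneg b d)

  Pos-weaken : ∀ {ε z} → Pos ε z → Pos 0 z
  Pos-weaken (a , b) = ℤₚ.≤-trans (ℤ.+≤+ z≤n) a , b

  Pos-⊝ : ∀ {z} → Pos 0 z → Pos 0 (⊝ z) → z ≡ 0#
  Pos-⊝ {a + b φ} (p , q) (r , s) = cong₂ _+_φ (lem a p r) (lem b q s)
    where
    lem : ∀ a → 0ℤ ℤ.≤ a → 0ℤ ℤ.≤ ℤ.- a → a ≡ 0ℤ
    lem (+ zero)  _ _ = refl
    lem (+ suc n) _ ()

  Pos-absurd : ∀ {z} → Pos 1 z → Pos 0 (⊝ z) → ⊥
  Pos-absurd {a + b φ} (p , q) r with Pos-⊝ (Pos-weaken (p , q)) r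
  Pos-absurd {_} (ℤ.+≤+ () , q) r | refl

-- Walls, mirrors and their pairings

opaque
  wall : Γ → Point → ℤ[φ]
  wall g y = dot (covector g) y

  mirror : Γ → Point → Point
  mirror g y = shift (coroot g) (wall g y) y

  -- Twice the inner product of unit normals of the two walls; they meet if its absolute value is
  -- less than 2.
  pairing : Γ → Γ → ℤ[φ]
  pairing g k = wall k (coroot g)

  wall-perm : ∀ i g y → wall (perm i g) (reflect (suc i) y) ≡ wall g y
  wall-perm i g y = trans (dot-reflect (covector (perm i g)) (suc i) y) (cong (λ c → dot c y) (covector-perm i g))

  mirror-perm : ∀ i g y → mirror (perm i g) (reflect (suc i) y) ≡ reflect (suc i) (mirror g y)
  mirror-perm i g y = begin
    shift (coroot (perm i g)) (wall (perm i g) (reflect (suc i) y)) (reflect (suc i) y)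
      ≡⟨ cong₂ (λ v u → shift v u (reflect (suc i) y)) (sym (coroot-perm i g)) (wall-perm i g y) ⟩
    shift (reflect (suc i) (coroot g)) (wall g y) (reflect (suc i) y)
      ≡⟨ sym (reflect-shift (suc i) (coroot g) (wall g y) y) ⟩
    reflect (suc i) (mirror g y) ∎
    where open ≡-Reasoning

  wall-mirror : ∀ k g y → wall k (mirror g y) ≡ wall k y ⊕ ⊝ (pairing g k ⊗ wall g y)
  wall-mirror k g y = dot-shift (covector k) (coroot g) (wall g y) y

  pairing-perm : ∀ i g k → pairing (perm i g) (perm i k) ≡ pairing g k
  pairing-perm i g k = trans (cong (wall (perm i k)) (sym (coroot-perm i g))) (wall-perm i k (coroot g))

  mirror-fix : ∀ g y → wall g y ≡ 0# → mirror g y ≡ y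
  mirror-fix g y eq = trans (cong (λ u → shift (coroot g) u y) eq) (shift-0 (coroot g) y)

  mirror-comm : ∀ g k y → pairing g k ≡ 0# → pairing k g ≡ 0# → mirror g (mirror k y) ≡ mirror k (mirror g y)
  mirror-comm g k y gk kg = begin
    shift (coroot g) (wall g (mirror k y)) (mirror k y)
      ≡⟨ cong (λ u → shift (coroot g) u (mirror k y)) (same g k kg) ⟩
    shift (coroot g) (wall g y) (shift (coroot k) (wall k y) y)
      ≡⟨ shift-comm (coroot g) (coroot k) (wall g y) (wall k y) y ⟩
    shift (coroot k) (wall k y) (mirror g y)
      ≡⟨ cong (λ u → shift (coroot k) u (mirror g y)) (sym (same k g gk)) ⟩
    mirror k (mirror g y) ∎
    where
    open ≡-Reasoning
    lem : ∀ x u → x ⊕ ⊝ (0# ⊗ u) ≡ x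
    lem = solve-∀ golden-solver
    same : ∀ g k → pairing k g ≡ 0# → wall g (mirror k y) ≡ wall g y
    same g k eq = trans (wall-mirror g k y) (trans (cong (λ m → wall g y ⊕ ⊝ (m ⊗ wall k y)) eq)
        (lem (wall g y) (wall k y)))

opaque
  unfolding wall perm

  pairing-refl : ∀ g → pairing g g ≡ 2#
  pairing-refl = toWitness {a? = Finₚ.all? λ g → pairing g g ≟φ 2#} tt

  wall-t₁ : ∀ y → wall t₁ y ≡ lookup y 0F
  wall-t₁ (a ∷ b ∷ c ∷ d ∷ e ∷ []) = lem a b c d e
    where
    lem : ∀ a b c d e → 1# ⊗ a ⊕ (0# ⊗ b ⊕ (0# ⊗ c ⊕ (0# ⊗ d ⊕ (0# ⊗ e ⊕ 0#)))) ≡ a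
    lem = solve-∀ golden-solver

  wall-V₀ : ∀ g → wall g V₀ ≡ 1#
  wall-V₀ = toWitness {a? = Finₚ.all? λ g → wall g V₀ ≟φ 1#} tt

  pairing-sym₁ : ∀ k → pairing t₁ k ≡ pairing k t₁
  pairing-sym₁ = toWitness {a? = Finₚ.all? λ k → pairing t₁ k ≟φ pairing k t₁} tt

  -- Distinct walls are perpendicular or ultraparallel. The generators with pairing 0 are at 36° in
  -- the 600-cell, and the next angle, 60°, gives exactly -2φ.
  trichotomy₁ : ∀ k → t₁ ≡ k ⊎ pairing t₁ k ≡ 0# ⊎ Pos 0 (⊝ pairing t₁ k ⊕ ⊝ (φ# ⊕ φ#))
  trichotomy₁ = toWitness {a? = Finₚ.all? λ k →
    (t₁ Finₚ.≟ k) ⊎-dec (pairing t₁ k ≟φ 0#) ⊎-dec Pos? 0 (⊝ pairing t₁ k ⊕ ⊝ (φ# ⊕ φ#))} tt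

opaque
  unfolding wall

  mirror-t₁ : ∀ y → mirror t₁ y ≡ reflect 0F y
  mirror-t₁ y = cong₂ (λ v u → shift v u y) coroot-t₁ (wall-t₁ y)

  mirror-involutive : ∀ g y → mirror g (mirror g y) ≡ y
  mirror-involutive g y = trans
    (cong (λ u → shift (coroot g) u (mirror g y))
      (trans (wall-mirror g g y) (trans (cong (λ m → wall g y ⊕ ⊝ (m ⊗ wall g y)) (pairing-refl g)) (lem (wall g y)))))
    (shift-cancel (coroot g) (wall g y) y)
    where
    lem : ∀ u → u ⊕ ⊝ (2# ⊗ u) ≡ ⊝ u
    lem (a + b φ) = trans (cong (λ z → (a + b φ) ⊕ ⊝ z) (lem₂ (a + b φ))) (lem₁ (a + b φ))
      where
      lem₁ : ∀ u → u ⊕ ⊝ (u ⊕ u) ≡ ⊝ u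
      lem₁ = solve-∀ golden-solver
      lem₂ : ∀ u → (1# ⊕ 1#) ⊗ u ≡ u ⊕ u
      lem₂ = solve-∀ golden-solver

opaque
  reflect-involutive : ∀ i y → reflect i (reflect i y) ≡ y
  reflect-involutive i y = trans
    (cong (λ u → shift (lookup cartan i) u (reflect i y))
      (trans (lookup-shift (lookup cartan i) (lookup y i) y i)
        (trans (cong (λ z → lookup y i ⊖ (z ⊗ lookup y i)) (diagonal i)) (lem (lookup y i)))))
    (shift-cancel (lookup cartan i) (lookup y i) y)
    where
    diagonal : ∀ i → lookup (lookup cartan i) i ≡ 1# ⊕ 1#
    diagonal 0F = refl
    diagonal 1F = refl
    diagonal 2F = refl
    diagonal 3F = refl
    diagonal 4F = refl
    lem : ∀ u → u ⊕ ⊝ ((1# ⊕ 1#) ⊗ u) ≡ ⊝ u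
    lem = solve-∀ golden-solver

-- The stabiliser [3,3,5] of V₀

Rot : Set
Rot = List (Fin 4)

permute : Rot → Γ → Γ
permute h g = foldr perm g h

rotate : Rot → Point → Point
rotate h y = foldr (λ i → reflect (suc i)) y h

opaque
  wall-rotate : ∀ h g y → wall (permute h g) (rotate h y) ≡ wall g y
  wall-rotate []      g y = refl
  wall-rotate (i ∷ h) g y = trans (wall-perm i (permute h g) (rotate h y)) (wall-rotate h g y)

  mirror-rotate : ∀ h g y → mirror (permute h g) (rotate h y) ≡ rotate h (mirror g y)
  mirror-rotate []      g y = refl
  mirror-rotate (i ∷ h) g y = trans (mirror-perm i (permute h g) (rotate h y))
      (cong (reflect (suc i)) (mirror-rotate h g y))

pairing-permute : ∀ h g k → pairing (permute h g) (permute h k) ≡ pairing g k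
pairing-permute []      g k = refl
pairing-permute (i ∷ h) g k = trans (pairing-perm i (permute h g) (permute h k)) (pairing-permute h g k)

permute-undo : ∀ h g → permute (reverse h) (permute h g) ≡ g
permute-undo = undo perm perm-involutive

permute-undo′ : ∀ h g → permute h (permute (reverse h) g) ≡ g
permute-undo′ = undo′ perm perm-involutive

permute-injective : ∀ h {g k} → permute h g ≡ permute h k → g ≡ k
permute-injective h {g} {k} eq = trans (sym (permute-undo h g))
    (trans (cong (permute (reverse h)) eq) (permute-undo h k))

rotate-undo′ : ∀ h y → rotate h (rotate (reverse h) y) ≡ y
rotate-undo′ = undo′ _ (λ i → reflect-involutive (suc i))

rotate-V₀ : ∀ h → rotate h V₀ ≡ V₀
rotate-V₀ []      = refl
rotate-V₀ (i ∷ h) = trans (cong (reflect (suc i)) (rotate-V₀ h)) (fixed i)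
  where
  fixed : ∀ i → reflect (suc i) V₀ ≡ V₀
  fixed 0F = refl
  fixed 1F = refl
  fixed 2F = refl
  fixed 3F = refl

opaque
  unfolding perm

  -- The orbit is listed by word length, so a letter that shortens the word also lowers the index;
  -- descending on indices ends at `t₁`.
  lower₁ : ∀ g → g ≡ t₁ ⊎ ∃[ i ] perm i g Fin.< g
  lower₁ = toWitness {a? = Finₚ.all? λ g → (g Finₚ.≟ t₁) ⊎-dec Finₚ.any? λ i → perm i g Finₚ.<? g} tt

opaque
  transitive₁ : ∀ g → ∃[ h ] permute h t₁ ≡ g
  transitive₁ g = go g (<-wellFounded (toℕ g))
    where
    go : ∀ g → Acc _<_ (toℕ g) → ∃[ h ] permute h t₁ ≡ g
    go g (acc rs) with lower₁ g
    ... | inj₁ refl = [] , refl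
    ... | inj₂ (i , lt) with go (perm i g) (rs lt)
    ... | h , eq = i ∷ h , trans (cong (perm i) eq) (perm-involutive i g)

Adj Far : Γ → Γ → Set
Adj g k = pairing g k ≡ 0#
Far g k = ∃[ c ] Pos 0 c × pairing g k ≡ ⊝ (φ# ⊕ φ# ⊕ c)

opaque
  Adj? : ∀ g k → Dec (Adj g k)
  Adj? g k = pairing g k ≟φ 0#

Adj-permute : ∀ h {g k} → Adj g k → Adj (permute h g) (permute h k)
Adj-permute h {g} {k} = trans (pairing-permute h g k)

Adj-permute⁻ : ∀ h {g k} → Adj (permute h g) (permute h k) → Adj g k
Adj-permute⁻ h {g} {k} = trans (sym (pairing-permute h g k))

opaque
  pairing-sym : ∀ g k → pairing g k ≡ pairing k g
  pairing-sym g k with transitive₁ g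
  ... | h , refl = subst (λ k → pairing (permute h t₁) k ≡ pairing k (permute h t₁)) (permute-undo′ h k)
    (trans (pairing-permute h _ _) (trans (pairing-sym₁ _) (sym (pairing-permute h _ _))))

Adj-sym : ∀ {g k} → Adj g k → Adj k g
Adj-sym {g} {k} = trans (pairing-sym k g)

Far-sym : ∀ {g k} → Far g k → Far k g
Far-sym {g} {k} (c , pos , eq) = c , pos , trans (pairing-sym k g) eq

opaque
  trichotomy : ∀ g k → g ≡ k ⊎ Adj g k ⊎ Far g k
  trichotomy g k with transitive₁ g
  ... | h , refl with trichotomy₁ (permute (reverse h) k)
  ... | inj₁ eq = inj₁ (trans (cong (permute h) eq) (permute-undo′ h k))
  ... | inj₂ (inj₁ a) = inj₂ (inj₁ (subst (Adj (permute h t₁)) (permute-undo′ h k) (Adj-permute h a)))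
  ... | inj₂ (inj₂ pos) = inj₂ (inj₂ (_ , pos , trans (sym (cong (pairing (permute h t₁)) (permute-undo′ h k)))
    (trans (pairing-permute h _ _) (lem (pairing t₁ (permute (reverse h) k)) φ#))))
    where
    lem : ∀ m f → m ≡ ⊝ (f ⊕ f ⊕ (⊝ m ⊕ ⊝ (f ⊕ f)))
    lem = solve-∀ golden-solver

2≢0 : 2# ≢ 0#
2≢0 ()

Adj-irrefl : ∀ {g} → ¬ Adj g g
Adj-irrefl {g} a = 2≢0 (trans (sym (pairing-refl g)) a)

Far⇒¬Adj : ∀ {g k} → Far g k → ¬ Adj g k
Far⇒¬Adj ((a + b φ) , (p , q) , eq) adj with trans (sym eq) adj
Far⇒¬Adj ((a + (+ n) φ) , (p , q) , eq) adj | ()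

Far-irrefl : ∀ {g} → ¬ Far g g
Far-irrefl {g} ((a + b φ) , (p , q) , eq) with trans (sym (pairing-refl g)) eq
Far-irrefl {g} ((a + (+ n) φ) , (p , q) , eq) | ()

opaque
  wall-mirror-self : ∀ g y → wall g (mirror g y) ≡ ⊝ wall g y
  wall-mirror-self g y = trans (wall-mirror g g y)
    (trans (cong (λ m → wall g y ⊕ ⊝ (m ⊗ wall g y)) (pairing-refl g)) (lem (wall g y)))
    where
    lem : ∀ u → u ⊕ ⊝ ((1# ⊕ 1#) ⊗ u) ≡ ⊝ u
    lem = solve-∀ golden-solver

  wall-mirror-adj : ∀ {g k} → Adj g k → ∀ y → wall k (mirror g y) ≡ wall k y
  wall-mirror-adj {g} {k} adj y = trans (wall-mirror k g y)
    (trans (cong (λ m → wall k y ⊕ ⊝ (m ⊗ wall g y)) adj) (lem (wall k y) (wall g y)))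
    where
    lem : ∀ x u → x ⊕ ⊝ (0# ⊗ u) ≡ x
    lem = solve-∀ golden-solver

  mirror-swap : ∀ {g k} → Adj g k → ∀ y → mirror g (mirror k y) ≡ mirror k (mirror g y)
  mirror-swap {g} {k} adj y = mirror-comm g k y adj (Adj-sym adj)

-- Reduced words and the signs of walls

data Desc (g : Γ) : List Γ → Set where
  here  : ∀ {k p} → g ≡ k → Desc g (k ∷ p)
  there : ∀ {k p} → Adj k g → Desc g p → Desc g (k ∷ p)

Desc? : ∀ g p → Dec (Desc g p)
Desc? g []      = no λ ()
Desc? g (k ∷ p) = map′ [ here , (λ { (a , d) → there a d }) ]′
  (λ { (here eq) → inj₁ eq ; (there a d) → inj₂ (a , d) })
  ((g Finₚ.≟ k) ⊎-dec (Adj? k g ×-dec Desc? g p))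

-- The reduced words; g₁ ⋯ gₙ is the list gₙ ∷ … ∷ g₁ ∷ [].
data Geo : List Γ → Set where
  []  : Geo []
  _∷_ : ∀ {g p} → ¬ Desc g p → Geo p → Geo (g ∷ p)

-- The head of the list is the last letter and acts first in `fwd`. So `g ∷ p` leads from the vertex
-- `fwd p V₀` along the edge that has the name g when this vertex is carried back to V₀ by `back p`,
-- the inverse of `fwd p`.
fwd back : List Γ → Point → Point
fwd []      y = y
fwd (g ∷ p) y = fwd p (mirror g y)
back p y = foldr mirror y p

opaque
  fwd-back : ∀ p y → fwd p (back p y) ≡ y
  fwd-back []      y = refl
  fwd-back (g ∷ p) y = trans (cong (fwd p) (mirror-involutive g (back p y))) (fwd-back p y)

  back-fwd : ∀ p y → back p (fwd p y) ≡ y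
  back-fwd []      y = refl
  back-fwd (g ∷ p) y = trans (cong (mirror g) (back-fwd p (mirror g y))) (mirror-involutive g y)

  fwd-injective : ∀ p {y z} → fwd p y ≡ fwd p z → y ≡ z
  fwd-injective p {y} {z} eq = trans (sym (back-fwd p y)) (trans (cong (back p) eq) (back-fwd p z))

private
  φ≥0 : Pos 0 φ#
  φ≥0 = ℤ.+≤+ z≤n , ℤ.+≤+ z≤n

  0≥0 : Pos 0 0#
  0≥0 = ℤ.+≤+ z≤n , ℤ.+≤+ z≤n

module _ {ε : ℕ} where

  -- The invariant for y = `back p m`, with m in the cell around V₀. The field `disjoint` is the
  -- strengthening needed by the induction: it keeps `positive` true when a letter is added whose
  -- wall is ultraparallel to the wall in question.
  record Signs (p : List Γ) (y : Point) : Set where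
    field
      positive : ∀ {g} → ¬ Desc g p → Pos ε (wall g y)
      negative : ∀ {g} → Desc g p → Pos ε (⊝ wall g y)
      -- The half-spaces behind two ultraparallel walls are disjoint.
      disjoint : ∀ {g k} → Far g k → Pos ε (wall k y ⊕ φ# ⊗ wall g y)

  open Signs

  signs-[] : ∀ {y} → (∀ g → Pos ε (wall g y)) → Signs [] y
  signs-[] pos .positive _ = pos _
  signs-[] pos .negative ()
  signs-[] {y} pos .disjoint {g} {k} _ = Pos-⊕ {u = φ# ⊗ wall g y} (pos k)
      (Pos-⊗ {φ#} {wall g y} φ≥0 (Pos-weaken (pos g)))

  signs-∷ : ∀ {g p y} → ¬ Desc g p → Signs p y → Signs (g ∷ p) (mirror g y)
  signs-∷ {g} {p} {y} ¬d s = record { positive = pos ; negative = neg ; disjoint = dis }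
    where
    u = wall g y

    u≥0 : Pos ε u
    u≥0 = positive s ¬d

    u≥0′ : Pos 0 u
    u≥0′ = Pos-weaken u≥0

    far : ∀ {k} → (far : Far g k) → wall k (mirror g y) ≡ wall k y ⊕ (φ# ⊕ φ# ⊕ proj₁ far) ⊗ u
    far {k} (c , _ , eq) = trans (wall-mirror k g y)
      (trans (cong (λ m → wall k y ⊕ ⊝ (m ⊗ u)) eq) (lem (wall k y) (φ# ⊕ φ# ⊕ c) u))
      where
      lem : ∀ x m u → x ⊕ ⊝ ((⊝ m) ⊗ u) ≡ x ⊕ m ⊗ u
      lem = solve-∀ golden-solver

    increase : ∀ {k} → g ≢ k → ∃[ w ] Pos 0 w × wall k (mirror g y) ≡ wall k y ⊕ w ⊗ u
    increase {k} g≢k with trichotomy g k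
    ... | inj₁ eq         = contradiction eq g≢k
    ... | inj₂ (inj₁ adj) = 0# , 0≥0 , trans (wall-mirror-adj adj y) (lem (wall k y) u)
      where
      lem : ∀ x u → x ≡ x ⊕ 0# ⊗ u
      lem = solve-∀ golden-solver
    ... | inj₂ (inj₂ f@(c , c≥0 , _)) = _ , Pos-⊕ (Pos-⊕ {z = φ#} φ≥0 φ≥0) c≥0 , far f

    pos : ∀ {k} → ¬ Desc k (g ∷ p) → Pos ε (wall k (mirror g y))
    pos {k} ¬d with trichotomy g k
    ... | inj₁ refl       = contradiction (here refl) ¬d
    ... | inj₂ (inj₁ adj) = subst (Pos ε) (sym (wall-mirror-adj adj y)) (positive s (¬d ∘ there adj))
    ... | inj₂ (inj₂ f@(c , c≥0 , _)) = subst (Pos ε) (sym (trans (far f) (lem (wall k y) φ# c u)))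
      (Pos-⊕ (disjoint s f) (Pos-⊗ (Pos-⊕ {z = φ#} φ≥0 c≥0) u≥0′))
      where
      lem : ∀ x f c u → x ⊕ (f ⊕ f ⊕ c) ⊗ u ≡ (x ⊕ f ⊗ u) ⊕ (f ⊕ c) ⊗ u
      lem = solve-∀ golden-solver

    neg : ∀ {k} → Desc k (g ∷ p) → Pos ε (⊝ wall k (mirror g y))
    neg (here refl)   = subst (Pos ε) (sym (trans (cong ⊝_ (wall-mirror-self g y)) (lem u))) u≥0
      where
      lem : ∀ u → ⊝ (⊝ u) ≡ u
      lem = solve-∀ golden-solver
    neg (there adj d) = subst (λ z → Pos ε (⊝ z)) (sym (wall-mirror-adj adj y)) (negative s d)

    dis : ∀ {a b} → Far a b → Pos ε (wall b (mirror g y) ⊕ φ# ⊗ wall a (mirror g y))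
    dis {a} {b} ab with g Finₚ.≟ a | g Finₚ.≟ b
    ... | yes refl | yes refl = contradiction ab Far-irrefl
    ... | yes refl | no _     = subst (Pos ε)
      (sym (trans (cong₂ (λ z w → z ⊕ φ# ⊗ w) (far ab) (wall-mirror-self g y)) (lem (wall b y) φ# (proj₁ ab) u)))
      (Pos-⊕ (disjoint s ab) (Pos-⊗ (proj₁ (proj₂ ab)) u≥0′))
      where
      lem : ∀ x f c u → x ⊕ (f ⊕ f ⊕ c) ⊗ u ⊕ f ⊗ (⊝ u) ≡ (x ⊕ f ⊗ u) ⊕ c ⊗ u
      lem = solve-∀ golden-solver
    -- The new coefficient is 2φ · φ - 2 = 2φ. The weight φ in `disjoint` is chosen for this case:
    -- with weight 1 it would be 2φ - 2, which is positive but not coefficientwise.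
    ... | no _     | yes refl = subst (Pos ε)
      (sym (trans (cong₂ (λ z w → z ⊕ φ# ⊗ w) (wall-mirror-self g y) (far (Far-sym ab))) (lem (wall a y) φ# c u)))
      (Pos-⊕ (disjoint s ab) (Pos-⊗ (Pos-⊕ {z = (φ# ⊕ φ#) ⊗ φ# ⊕ ⊝ (1# ⊕ 1#)} (ℤ.+≤+ z≤n , ℤ.+≤+ z≤n)
          (Pos-⊗ φ≥0 c≥0)) u≥0′))
      where
      c = proj₁ (Far-sym ab)
      c≥0 = proj₁ (proj₂ (Far-sym ab))
      lem : ∀ x f c u → ⊝ u ⊕ f ⊗ (x ⊕ (f ⊕ f ⊕ c) ⊗ u) ≡ (u ⊕ f ⊗ x) ⊕ ((f ⊕ f) ⊗ f ⊕ ⊝ (1# ⊕ 1#) ⊕ f ⊗ c) ⊗ u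
      lem = solve-∀ golden-solver
    ... | no g≢a   | no g≢b with increase g≢a | increase g≢b
    ... | w , w≥0 , eq | v , v≥0 , eq′ = subst (Pos ε)
      (sym (trans (cong₂ (λ z w → z ⊕ φ# ⊗ w) eq′ eq) (lem (wall b y) (wall a y) φ# v w u)))
      (Pos-⊕ (disjoint s ab) (Pos-⊗ (Pos-⊕ {z = v} v≥0 (Pos-⊗ φ≥0 w≥0)) u≥0′))
      where
      lem : ∀ x y f v w u → (x ⊕ v ⊗ u) ⊕ f ⊗ (y ⊕ w ⊗ u) ≡ (x ⊕ f ⊗ y) ⊕ (v ⊕ f ⊗ w) ⊗ u
      lem = solve-∀ golden-solver

  opaque
   signs : ∀ {p} → Geo p → ∀ {y} → (∀ g → Pos ε (wall g y)) → Signs p (back p y)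
   signs []         pos = signs-[] pos
   signs (¬d ∷ geo) pos = signs-∷ ¬d (signs geo pos)

opaque
  V₀-inside : ∀ g → Pos 1 (wall g V₀)
  V₀-inside g = subst (Pos 1) (sym (wall-V₀ g)) (ℤ.+≤+ (s≤s z≤n) , ℤ.+≤+ z≤n)

Neg : ℤ[φ] → Set
Neg z = Pos 1 (⊝ z)

opaque
  Desc⇒Neg : ∀ {p g} → Geo p → Desc g p → Neg (wall g (back p V₀))
  Desc⇒Neg geo d = Signs.negative (signs geo V₀-inside) d

  Neg⇒Desc : ∀ {p g} → Geo p → Neg (wall g (back p V₀)) → Desc g p
  Neg⇒Desc {p} {g} geo n with Desc? g p
  ... | yes d = d
  ... | no ¬d = ⊥-elim (Pos-absurd (Signs.positive (signs geo V₀-inside) ¬d) (Pos-weaken n))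

  Desc-Adj : ∀ {g k p} → Geo p → Desc g p → Desc k p → g ≢ k → Adj g k
  Desc-Adj (¬d ∷ geo) (here refl)  (here refl)   g≢k = contradiction refl g≢k
  Desc-Adj (¬d ∷ geo) (here refl)  (there adj d) g≢k = adj
  Desc-Adj (¬d ∷ geo) (there adj d) (here refl)  g≢k = Adj-sym adj
  Desc-Adj (¬d ∷ geo) (there _ d)  (there _ d′)  g≢k = Desc-Adj geo d d′ g≢k

-- Commutation of letters

infix 4 _≈_
-- The congruence of a partially commutative monoid; its classes are Cartier-Foata traces.
data _≈_ : List Γ → List Γ → Set where
  ≈-refl  : ∀ {p} → p ≈ p
  ≈-swap  : ∀ {g k p} → Adj g k → (g ∷ k ∷ p) ≈ (k ∷ g ∷ p)
  ≈-cons  : ∀ {g p q} → p ≈ q → (g ∷ p) ≈ (g ∷ q)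
  ≈-trans : ∀ {p q r} → p ≈ q → q ≈ r → p ≈ r

≈-sym : ∀ {p q} → p ≈ q → q ≈ p
≈-sym ≈-refl        = ≈-refl
≈-sym (≈-swap a)    = ≈-swap (Adj-sym a)
≈-sym (≈-cons e)    = ≈-cons (≈-sym e)
≈-sym (≈-trans e f) = ≈-trans (≈-sym f) (≈-sym e)

opaque
  fwd-≈ : ∀ {p q} → p ≈ q → ∀ y → fwd p y ≡ fwd q y
  fwd-≈ ≈-refl        y = refl
  fwd-≈ (≈-swap {g} {k} {p} a) y = cong (fwd p) (mirror-swap (Adj-sym a) y)
  fwd-≈ (≈-cons {g} e) y = fwd-≈ e (mirror g y)
  fwd-≈ (≈-trans e f) y = trans (fwd-≈ e y) (fwd-≈ f y)

  back-≈ : ∀ {p q} → p ≈ q → ∀ y → back p y ≡ back q y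
  back-≈ ≈-refl        y = refl
  back-≈ (≈-swap {g} {k} {p} a) y = mirror-swap a (back p y)
  back-≈ (≈-cons {g} e) y = cong (mirror g) (back-≈ e y)
  back-≈ (≈-trans e f) y = trans (back-≈ e y) (back-≈ f y)

  length-≈ : ∀ {p q} → p ≈ q → length p ≡ length q
  length-≈ ≈-refl        = refl
  length-≈ (≈-swap a)    = refl
  length-≈ (≈-cons e)    = cong suc (length-≈ e)
  length-≈ (≈-trans e f) = trans (length-≈ e) (length-≈ f)

  Desc-≈ : ∀ {g p q} → p ≈ q → Desc g p → Desc g q
  Desc-≈ ≈-refl     d = d
  Desc-≈ (≈-swap a) (here refl) = there (Adj-sym a) (here refl)
  Desc-≈ (≈-swap a) (there b (here refl)) = here refl
  Desc-≈ (≈-swap a) (there b (there c d)) = there c (there b d)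
  Desc-≈ (≈-cons e) (here eq)   = here eq
  Desc-≈ (≈-cons e) (there a d) = there a (Desc-≈ e d)
  Desc-≈ (≈-trans e f) d = Desc-≈ f (Desc-≈ e d)

  Geo-≈ : ∀ {p q} → p ≈ q → Geo p → Geo q
  Geo-≈ ≈-refl        geo = geo
  Geo-≈ (≈-swap a)    (¬d ∷ ¬e ∷ geo) = (λ { (here refl) → Adj-irrefl a ; (there _ d) → ¬e d }) ∷
      (λ d → ¬d (there (Adj-sym a) d)) ∷ geo
  Geo-≈ (≈-cons e)    (¬d ∷ geo) = (¬d ∘ Desc-≈ (≈-sym e)) ∷ Geo-≈ e geo
  Geo-≈ (≈-trans e f) geo = Geo-≈ f (Geo-≈ e geo)

  exchange : ∀ {g p} → Geo p → Desc g p → ∃[ q ] p ≈ (g ∷ q) × Geo (g ∷ q)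
  exchange {g} {k ∷ p} geo (here refl) = p , ≈-refl , geo
  exchange {g} {k ∷ p} (¬d ∷ geo) (there adj d) with exchange geo d
  ... | q , e , _ = k ∷ q , e′ , Geo-≈ e′ (¬d ∷ geo)
    where
    e′ : (k ∷ p) ≈ (g ∷ k ∷ q)
    e′ = ≈-trans (≈-cons e) (≈-swap adj)

opaque
  All-≈ : ∀ {P : Γ → Set} {p q} → p ≈ q → All P p → All P q
  All-≈ ≈-refl        ps = ps
  All-≈ (≈-swap a)    (x ∷ y ∷ ps) = y ∷ x ∷ ps
  All-≈ (≈-cons e)    (x ∷ ps) = x ∷ All-≈ e ps
  All-≈ (≈-trans e f) ps = All-≈ f (All-≈ e ps)

  -- A letter that is already a descent is cancelled against its copy. Letters are thus only lost,
  -- so any property of all letters survives; `far-wall` depends on this.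
  normalise : ∀ p → ∃[ q ] Geo q × (∀ y → back p y ≡ back q y) × (∀ {P : Γ → Set} → All P p → All P q)
    × length q ≤ length p
  normalise [] = [] , [] , (λ y → refl) , id , z≤n
  normalise (g ∷ p) with normalise p
  ... | q , geo , eq , all , le with Desc? g q
  ... | no ¬d = g ∷ q , ¬d ∷ geo , (λ y → cong (mirror g) (eq y)) , (λ { (x ∷ ps) → x ∷ all ps }) , s≤s le
  ... | yes d with exchange geo d
  ... | r , e , (_ ∷ geo′) = r , geo′
    , (λ y → trans (cong (mirror g) (trans (eq y) (back-≈ e y))) (mirror-involutive g (back r y)))
    , (λ { (_ ∷ ps) → All.tail (All-≈ e (all ps)) })
    , ℕₚ.m≤n⇒m≤1+n (ℕₚ.≤-trans (ℕₚ.n≤1+n _) (ℕₚ.≤-trans (ℕₚ.≤-reflexive (sym (length-≈ e))) le))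

-- The cell around V₀ and the word problem

hypercube : List Γ → Rot → Point
hypercube p h = fwd p (rotate h (corner 4F))

Inside : Point → Set
Inside m = ∀ g → Pos 0 (wall g m)

V₀-Inside : Inside V₀
V₀-Inside g = Pos-weaken (V₀-inside g)

opaque
  back-++ : ∀ p q y → back (p ++ q) y ≡ back p (back q y)
  back-++ p q y = Listₚ.foldr-++ mirror y p q

  fwd-reverse : ∀ p y → fwd p y ≡ back (reverse p) y
  fwd-reverse []      y = refl
  fwd-reverse (g ∷ p) y = trans (fwd-reverse p (mirror g y))
    (sym (trans (cong (λ p → back p y) (Listₚ.unfold-reverse g p)) (back-++ (reverse p) (g ∷ []) y)))

-- The closed cell {wall ≥ 0} is a strict fundamental domain.
opaque
  fundamental : ∀ {n m m′} → Geo n → Inside m → Inside m′ → back n m′ ≡ m → m ≡ m′ × All (λ g → wall g m ≡ 0#) n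
  fundamental [] im im′ eq = sym eq , []
  fundamental {g ∷ n} {m} {m′} geo@(_ ∷ geo′) im im′ eq =
    -- The last letter g of a reduced word puts the image of m′ on the far side of the wall of g,
    -- whereas m is in the cell. So m lies on this wall, and g can be stripped off.
    let zero-wall = Pos-⊝ (im g) (subst (λ z → Pos 0 (⊝ wall g z)) eq (Signs.negative (signs geo im′) (here refl)))
        eq₁ , all = fundamental geo′ im im′ (trans (sym (mirror-involutive g (back n m′)))
            (trans (cong (mirror g) eq) (mirror-fix g m zero-wall)))
    in eq₁ , zero-wall ∷ all

  -- Let n be the reduced form of p⁻¹q. It carries a point of the cell to a point of the cell, hence
  -- fixes it and is a word in the walls through it.
  same-point : ∀ p q {m m′} → Inside m → Inside m′ → fwd p m ≡ fwd q m′ →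
    ∃[ n ] Geo n × m ≡ m′ × All (λ g → wall g m ≡ 0#) n × (∀ y → fwd q y ≡ fwd p (back n y))
  same-point p q {m} {m′} im im′ eq with normalise (p ++ reverse q)
  ... | n , geo , same , _ = n , geo , proj₁ fix , proj₂ fix , λ y → trans (sym (fwd-back p (fwd q y)))
      (cong (fwd p) (op y))
    where
    op : ∀ y → back p (fwd q y) ≡ back n y
    op y = trans (cong (back p) (fwd-reverse q y)) (trans (sym (back-++ p (reverse q) y)) (same y))
    fix : m ≡ m′ × All (λ g → wall g m ≡ 0#) n
    fix = fundamental geo im im′ (trans (sym (op m′)) (trans (cong (back p) (sym eq)) (back-fwd p m)))

1≢0 : 1# ≢ 0#
1≢0 ()

opaque
  -- No wall passes through V₀, so the right-angled group acts freely on its orbit.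
  same-vertex : ∀ p q → fwd p V₀ ≡ fwd q V₀ → ∀ y → fwd p y ≡ fwd q y
  same-vertex p q eq y with same-point p q V₀-Inside V₀-Inside eq
  ... | []    , _ , _ , _      , op = sym (op y)
  ... | g ∷ n , _ , _ , z ∷ _ , _  = contradiction (trans (sym (wall-V₀ g)) z) 1≢0

  same-back : ∀ p q → fwd p V₀ ≡ fwd q V₀ → ∀ y → back p y ≡ back q y
  same-back p q eq y = trans (cong (back p) (sym (trans (same-vertex p q eq (back q y)) (fwd-back q y))))
      (back-fwd p (back q y))

  -- Whether g is a descent is the sign of a wall, which depends on the vertex only. So the last
  -- letter of p is also a descent of q and can be exchanged to its head.
  same-≈ : ∀ {p q} → Geo p → Geo q → fwd p V₀ ≡ fwd q V₀ → p ≈ q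
  same-≈ {[]}    {[]}    _ _ _ = ≈-refl
  same-≈ {[]}    {g ∷ q} _ geo eq = ⊥-elim (Pos-absurd (V₀-inside g)
    (Pos-weaken (subst (λ y → Neg (wall g y)) (sym (same-back [] (g ∷ q) eq V₀)) (Desc⇒Neg geo (here refl)))))
  same-≈ {g ∷ p} {q} geo@(_ ∷ geo′) geoq eq = finish (exchange geoq desc)
    where
    desc : Desc g q
    desc = Neg⇒Desc geoq (subst (λ y → Neg (wall g y)) (same-back (g ∷ p) q eq V₀) (Desc⇒Neg geo (here refl)))
    finish : ∃[ r ] q ≈ (g ∷ r) × Geo (g ∷ r) → (g ∷ p) ≈ q
    finish (r , e , (_ ∷ geor)) = ≈-trans (≈-cons (same-≈ geo′ geor eq′)) (≈-sym e)
      where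
      eq′ : fwd p V₀ ≡ fwd r V₀
      eq′ = trans (cong (fwd p) (sym (mirror-involutive g V₀)))
          (trans (same-vertex (g ∷ p) (g ∷ r) (trans eq (fwd-≈ e V₀)) (mirror g V₀))
        (cong (fwd r) (mirror-involutive g V₀)))

-- Words in the simple reflections

opaque
  act-++ : ∀ w u y → act (w ++ u) y ≡ act w (act u y)
  act-++ w u y = Listₚ.foldr-++ reflect y w u

  rotate-act : ∀ h y → act (map suc h) y ≡ rotate h y
  rotate-act []      y = refl
  rotate-act (i ∷ h) y = cong (reflect (suc i)) (rotate-act h y)

  reflect-back : ∀ i v y → reflect (suc i) (back v y) ≡ back (map (perm i) v) (reflect (suc i) y)
  reflect-back i []      y = refl
  reflect-back i (g ∷ v) y = trans (sym (mirror-perm i g (back v y))) (cong (mirror (perm i g)) (reflect-back i v y))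

  rotate-back : ∀ h v y → rotate h (back v y) ≡ back (map (permute h) v) (rotate h y)
  rotate-back []      v y = cong (λ v → back v y) (sym (Listₚ.map-id v))
  rotate-back (i ∷ h) v y = trans (cong (reflect (suc i)) (rotate-back h v y))
    (trans (reflect-back i (map (permute h) v) (rotate h y))
        (cong (λ v → back v (rotate (i ∷ h) y)) (sym (Listₚ.map-∘ v))))

Chamber : Word → List Γ → Rot → Set
Chamber w p h = ∀ y → act w y ≡ fwd p (rotate h y)

opaque
  -- The group [4,3,3,5] is a semidirect product: s₁, ..., s₄ are moved to the right past the
  -- mirrors, which they permute, and s₀ is the mirror of `t₁`.
  decompose : ∀ w → ∃[ p ] ∃[ h ] Geo p × Chamber w p h
  decompose w with split w
    where
    split : ∀ w → ∃[ v ] ∃[ h ] (∀ y → act w y ≡ back v (rotate h y))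
    split []          = [] , [] , λ y → refl
    split (i ∷ w) with split w
    split (zero ∷ w)  | v , h , eq = t₁ ∷ v , h , λ y → trans (sym (mirror-t₁ (act w y))) (cong (mirror t₁) (eq y))
    split (suc i ∷ w) | v , h , eq = map (perm i) v , i ∷ h , λ y → trans (cong (reflect (suc i)) (eq y))
        (reflect-back i v (rotate h y))
  ... | v , h , eq with normalise (reverse v)
  ... | p , geo , op , _ = p , h , geo , λ y → trans (eq y)
      (sym (trans (cong (fwd p) (sym (undo mirror mirror-involutive v (rotate h y))))
    (trans (cong (fwd p) (op (back v (rotate h y)))) (fwd-back p (back v (rotate h y))))))

  chamber : ∀ p h → ∃[ w ] Chamber w p h
  chamber []      h = map suc h , rotate-act h
  chamber (g ∷ p) h with transitive₁ g | chamber p []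
  ... | k , refl | w , eq = w ++ map suc k ++ 0F ∷ map suc (reverse k) ++ map suc h , λ y → begin
    act (w ++ map suc k ++ 0F ∷ map suc (reverse k) ++ map suc h) y
      ≡⟨ act-++ w _ y ⟩
    act w (act (map suc k ++ 0F ∷ map suc (reverse k) ++ map suc h) y)
      ≡⟨ eq _ ⟩
    fwd p (act (map suc k ++ 0F ∷ map suc (reverse k) ++ map suc h) y)
      ≡⟨ cong (fwd p) (trans (act-++ (map suc k) _ y) (rotate-act k _)) ⟩
    fwd p (rotate k (reflect 0F (act (map suc (reverse k) ++ map suc h) y)))
      ≡⟨ cong (λ z → fwd p (rotate k (reflect 0F z))) (trans (act-++ (map suc (reverse k)) _ y)
           (trans (rotate-act (reverse k) _) (cong (rotate (reverse k)) (rotate-act h y)))) ⟩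
    fwd p (rotate k (reflect 0F (rotate (reverse k) (rotate h y))))
      ≡⟨ cong (λ z → fwd p (rotate k z)) (sym (mirror-t₁ _)) ⟩
    fwd p (rotate k (mirror t₁ (rotate (reverse k) (rotate h y))))
      ≡⟨ cong (fwd p) (sym (mirror-rotate k t₁ _)) ⟩
    fwd p (mirror (permute k t₁) (rotate k (rotate (reverse k) (rotate h y))))
      ≡⟨ cong (λ z → fwd p (mirror (permute k t₁) z)) (rotate-undo′ k (rotate h y)) ⟩
    fwd p (mirror (permute k t₁) (rotate h y)) ∎
    where open ≡-Reasoning

  incident : ∀ p h j k → Incident j (fwd p (rotate h (corner j))) k (fwd p (rotate h (corner k)))
  incident p h j k = let w , eq = chamber p h in w , eq (corner j) , eq (corner k)

  incident⁻ : ∀ j k {x y} → Incident j x k y → ∃[ p ] ∃[ h ] Geo p × x ≡ fwd p (rotate h (corner j)) × y ≡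
      fwd p (rotate h (corner k))
  incident⁻ j k (w , ex , ey) = let p , h , geo , eq = decompose w in
    p , h , geo , trans (sym ex) (eq (corner j)) , trans (sym ey) (eq (corner k))

-- Flags of cliques of the 600-cell graph

tetrahedron : List Γ
tetrahedron = t₁ ∷ t₂ ∷ t₃ ∷ t₄ ∷ []

flag : Fin 5 → List Γ
flag j = take (toℕ j) tetrahedron

frame : Rot → List Γ
frame h = map (permute h) tetrahedron

opaque
  unfolding wall perm Adj?

  corner-Inside : ∀ j g → Pos 0 (wall g (corner j))
  corner-Inside = toWitness {a? = Finₚ.all? λ j → Finₚ.all? λ g → Pos? 0 (wall g (corner j))} tt

  corner-zero : ∀ j g → wall g (corner j) ≡ 0# → g ∈ flag j
  corner-zero = toWitness {a? = Finₚ.all? λ j → Finₚ.all? λ g → (wall g (corner j) ≟φ 0#) →-dec (g ∈? flag j)} tt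

  corner-flag : ∀ j → All (λ g → wall g (corner j) ≡ 0#) (flag j)
  corner-flag = toWitness {a? = Finₚ.all? λ j → All.all? (λ g → wall g (corner j) ≟φ 0#) (flag j)} tt

  tetrahedron-clique : AllPairs Adj tetrahedron
  tetrahedron-clique = toWitness {a? = AllPairs.allPairs? Adj? tetrahedron} tt

  tetrahedron-maximal : ∀ g → ¬ All (λ t → Adj t g) tetrahedron
  tetrahedron-maximal = toWitness {a? = Finₚ.all? λ g → ¬? (All.all? (λ t → Adj? t g) tetrahedron)} tt

opaque
  wall-rotate′ : ∀ h g y → wall g (rotate h y) ≡ wall (permute (reverse h) g) y
  wall-rotate′ h g y = trans (cong (λ g → wall g (rotate h y)) (sym (permute-undo′ h g)))
      (wall-rotate h (permute (reverse h) g) y)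

  rotate-Inside : ∀ h j → Inside (rotate h (corner j))
  rotate-Inside h j g = subst (Pos 0) (sym (wall-rotate′ h g (corner j))) (corner-Inside j _)

  rotate-zero : ∀ h j g → wall g (rotate h (corner j)) ≡ 0# → g ∈ map (permute h) (flag j)
  rotate-zero h j g eq = subst (_∈ map (permute h) (flag j)) (permute-undo′ h g)
    (∈ₚ.∈-map⁺ (permute h) (corner-zero j _ (trans (sym (wall-rotate′ h g (corner j))) eq)))

  rotate-flag : ∀ h j {g} → g ∈ map (permute h) (flag j) → wall g (rotate h (corner j)) ≡ 0#
  rotate-flag h j g∈ with ∈ₚ.∈-map⁻ (permute h) g∈
  ... | k , k∈ , refl = trans (wall-rotate h k (corner j)) (All.lookup (corner-flag j) k∈)

Clique : List Γ → Set
Clique = AllPairs Adj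

Clique-permute : ∀ h {L} → Clique L → Clique (map (permute h) L)
Clique-permute h c = AllPairsₚ.map⁺ (AllPairs.map (Adj-permute h) c)

frame-clique : ∀ h → Clique (frame h)
frame-clique h = Clique-permute h tetrahedron-clique

permute-++ : ∀ h k g → permute (h ++ k) g ≡ permute h (permute k g)
permute-++ h k g = Listₚ.foldr-++ perm g h k

rotate-++ : ∀ h k y → rotate (h ++ k) y ≡ rotate h (rotate k y)
rotate-++ h k y = Listₚ.foldr-++ _ y h k

Fixes : Rot → List Γ → Set
Fixes h L = All (λ t → permute h t ≡ t) L

Fixing : List Γ → Rot → Set
Fixing L = All (λ i → All (λ t → perm i t ≡ t) L)

fixing : ∀ {L h} → Fixing L h → Fixes h L
fixing {L} []   = All.universal (λ _ → refl) L
fixing (f ∷ fs) = All.zipWith (λ { (e , e′) → trans (cong (perm _) e′) e }) (f , fixing fs)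

Transitive : List Γ → Γ → Set
Transitive L t = ∀ g → All (λ t → Adj t g) L → ∃[ h ] Fixing L h × permute h t ≡ g

private
  Stage : List Γ → List Γ → Set
  Stage L todo = ∀ R → Clique R → All (λ r → All (λ t → Adj t r) L) R →
    ∃[ h ] Fixes h L × R ≡ map (permute h) (take (length R) todo)

  stage-step : ∀ L t todo → Transitive L t → Stage (t ∷ L) todo → Stage L (t ∷ todo)
  stage-step L t todo tr st [] [] [] = [] , All.universal (λ _ → refl) L , refl
  stage-step L t todo tr st (r ∷ R) (rR ∷ cR) (Lr ∷ LR) with tr r Lr
  ... | h , fixi , refl with fixing fixi
  ... | fix with st (map (permute (reverse h)) R) (Clique-permute (reverse h) cR)
    (Allₚ.map⁺ (All.zipWith (λ { {x} (a , b) → subst (λ t → Adj t (permute (reverse h) x))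
        (permute-undo h t) (Adj-permute (reverse h) a)
      ∷ All.zipWith (λ { {t} (f , c) → subst (λ t → Adj t (permute (reverse h) x))
          (trans (cong (permute (reverse h)) (sym f)) (permute-undo h t)) (Adj-permute (reverse h) c) })
          (fix , b) }) (rR , LR)))
  ... | k , f ∷ fix′ , eq = h ++ k , All.zipWith
      (λ { {t} (f , f′) → trans (permute-++ h k t) (trans (cong (permute h) f′) f) }) (fix , fix′)
    , cong₂ _∷_ (sym (trans (permute-++ h k t) (cong (permute h) f)))
        (begin
          R                                                           ≡⟨ sym (Listₚ.map-id R) ⟩
          map id R                                                    ≡⟨ Listₚ.map-cong
              (λ r → sym (permute-undo′ h r)) R ⟩
          map (λ r → permute h (permute (reverse h) r)) R             ≡⟨ Listₚ.map-∘ R ⟩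
          map (permute h) (map (permute (reverse h)) R)               ≡⟨ cong (map (permute h)) eq ⟩
          map (permute h) (map (permute k) (take (length (map (permute (reverse h)) R)) todo))
            ≡⟨ cong (λ n → map (permute h) (map (permute k) (take n todo))) (Listₚ.length-map (permute (reverse h)) R) ⟩
          map (permute h) (map (permute k) (take (length R) todo))    ≡⟨ sym (Listₚ.map-∘ (take (length R) todo)) ⟩
          map (permute h ∘ permute k) (take (length R) todo)          ≡⟨ Listₚ.map-cong
              (λ r → sym (permute-++ h k r)) (take (length R) todo) ⟩
          map (permute (h ++ k)) (take (length R) todo)               ∎)
    where open ≡-Reasoning

  -- The descent on indices inside a stabiliser: among the elements of the link of L, only t cannot
  -- be lowered by a simple reflection that fixes L.
  Lower : List Γ → Γ → Set
  Lower L t = ∀ g → All (λ t → Adj t g) L → g ≡ t ⊎ ∃[ i ] All (λ t → perm i t ≡ t) L × perm i g Fin.< g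

  descend : ∀ L t → Lower L t → Transitive L t
  descend L t lower g = go g (<-wellFounded (toℕ g))
    where
    go : ∀ g → Acc _<_ (toℕ g) → All (λ t → Adj t g) L → ∃[ h ] Fixing L h × permute h t ≡ g
    go g (acc rs) adj with lower g adj
    ... | inj₁ refl = [] , [] , refl
    ... | inj₂ (i , fix , lt) with go (perm i g) (rs lt)
      (All.zipWith (λ { {t} (f , a) → subst (λ t → Adj t (perm i g)) f (trans (pairing-perm i t g) a) }) (fix , adj))
    ... | h , fix′ , eq = i ∷ h , fix ∷ fix′ , trans (cong (perm i) eq) (perm-involutive i g)

  Lower? : ∀ L t → Dec (Lower L t)
  Lower? L t = Finₚ.all? λ g → All.all? (λ t → Adj? t g) L →-dec
    ((g Finₚ.≟ t) ⊎-dec Finₚ.any? λ i → All.all? (λ t → perm i t Finₚ.≟ t) L ×-dec perm i g Finₚ.<? g)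

opaque
  unfolding wall perm Adj?

  private
    lower-0 : Lower [] t₁
    lower-0 = toWitness {a? = Lower? [] t₁} tt
    lower-1 : Lower (t₁ ∷ []) t₂
    lower-1 = toWitness {a? = Lower? (t₁ ∷ []) t₂} tt
    lower-2 : Lower (t₂ ∷ t₁ ∷ []) t₃
    lower-2 = toWitness {a? = Lower? (t₂ ∷ t₁ ∷ []) t₃} tt
    lower-3 : Lower (t₃ ∷ t₂ ∷ t₁ ∷ []) t₄
    lower-3 = toWitness {a? = Lower? (t₃ ∷ t₂ ∷ t₁ ∷ []) t₄} tt

opaque
  link-transitive : Transitive (t₁ ∷ []) t₂
  link-transitive = descend (t₁ ∷ []) t₂ lower-1

  -- The stages end after four vertices because no generator commutes with all of t₁, ..., t₄. So
  -- every clique is part of a frame, that is, spans a face of a hypercube.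
  complete-frame : ∀ R → Clique R → ∃[ h ] R ≡ map (permute h) (take (length R) tetrahedron)
  complete-frame R c =
    let h , _ , eq = stage-step [] t₁ _ (descend _ _ lower-0)
                    (stage-step (t₁ ∷ []) t₂ _ (descend _ _ lower-1)
                    (stage-step (t₂ ∷ t₁ ∷ []) t₃ _ (descend _ _ lower-2)
                    (stage-step (t₃ ∷ t₂ ∷ t₁ ∷ []) t₄ _ (descend _ _ lower-3) last))) R c (All.universal (λ _ → []) R)
    in h , eq
    where
    last : Stage (t₄ ∷ t₃ ∷ t₂ ∷ t₁ ∷ []) []
    last []      _ _       = [] , All.universal (λ _ → refl) (t₄ ∷ t₃ ∷ t₂ ∷ t₁ ∷ []) , refl
    last (r ∷ _) _ ((a ∷ b ∷ c ∷ d ∷ []) ∷ _) = contradiction (d ∷ c ∷ b ∷ a ∷ []) (tetrahedron-maximal r)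

-- Centres of faces

φ⁻¹ : ℤ[φ]
φ⁻¹ = -1ℤ + 1ℤ φ

-- Twice the sum of V₀ and half the edge vectors at V₀, as `mirror g V₀` is V₀ minus `coroot g`.
-- Being symmetric in the edges, it shows that a face depends only on the set of edges that spans
-- it.
centre : List Γ → Point
centre L = foldr (λ g → shift (coroot g) 1#) (scale 2# V₀) L

-- centre tetrahedron is φ times corner 4.
cube : List Γ → Point
cube L = scale φ⁻¹ (centre L)

opaque
  centre-↭ : ∀ {L R} → L ↭ R → centre L ≡ centre R
  centre-↭ refl         = refl
  centre-↭ (prep g e)   = cong (shift (coroot g) 1#) (centre-↭ e)
  centre-↭ (swap {L} g k e) = trans (cong (shift (coroot g) 1# ∘ shift (coroot k) 1#) (centre-↭ e))
      (shift-comm (coroot g) (coroot k) 1# 1# _)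
  centre-↭ (_↭_.trans e f)  = trans (centre-↭ e) (centre-↭ f)

  cube-↭ : ∀ {L R} → L ↭ R → cube L ≡ cube R
  cube-↭ e = cong (scale φ⁻¹) (centre-↭ e)

  rotate-scale : ∀ h k y → rotate h (scale k y) ≡ scale k (rotate h y)
  rotate-scale []      k y = refl
  rotate-scale (i ∷ h) k y = trans (cong (reflect (suc i)) (rotate-scale h k y)) (reflect-scale (suc i) k (rotate h y))

  coroot-permute : ∀ h g → rotate h (coroot g) ≡ coroot (permute h g)
  coroot-permute []      g = refl
  coroot-permute (i ∷ h) g = trans (cong (reflect (suc i)) (coroot-permute h g)) (coroot-perm i (permute h g))

  rotate-shift : ∀ h v u y → rotate h (shift v u y) ≡ shift (rotate h v) u (rotate h y)
  rotate-shift []      v u y = refl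
  rotate-shift (i ∷ h) v u y = trans (cong (reflect (suc i)) (rotate-shift h v u y))
      (reflect-shift (suc i) (rotate h v) u (rotate h y))

  rotate-centre : ∀ h L → rotate h (centre L) ≡ centre (map (permute h) L)
  rotate-centre h []      = trans (rotate-scale h 2# V₀) (cong (scale 2#) (rotate-V₀ h))
  rotate-centre h (g ∷ L) = trans (rotate-shift h (coroot g) 1# (centre L))
    (cong₂ (λ v y → shift v 1# y) (coroot-permute h g) (rotate-centre h L))

opaque
  unfolding wall perm Adj?

  cube-tetrahedron : corner 4F ≡ cube tetrahedron
  cube-tetrahedron = refl

opaque
  rotate-cube : ∀ h → rotate h (corner 4F) ≡ cube (frame h)
  rotate-cube h = trans (cong (rotate h) cube-tetrahedron)
      (trans (rotate-scale h φ⁻¹ _) (cong (scale φ⁻¹) (rotate-centre h tetrahedron)))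

-- Comparing enumerations

opaque
  unique-⊆-length : {X : Set} {xs ys : List X} → Unique xs → (∀ {x} → x ∈ xs → x ∈ ys) → length xs ≤ length ys
  unique-⊆-length {xs = []}     _ _ = z≤n
  unique-⊆-length {xs = x ∷ xs} (x∉ ∷ u) sub with ∈ₚ.∈-∃++ (sub (here refl))
  ... | as , bs , refl = begin
    suc (length xs)          ≤⟨ s≤s (unique-⊆-length u sub′) ⟩
    suc (length (as ++ bs))  ≡⟨ cong suc (Listₚ.length-++ as) ⟩
    suc (length as + length bs) ≡⟨ sym (ℕₚ.+-suc (length as) (length bs)) ⟩
    length as + suc (length bs) ≡⟨ sym (Listₚ.length-++ as) ⟩
    length (as ++ x ∷ bs)    ∎
    where
    open ℕₚ.≤-Reasoning
    sub′ : ∀ {y} → y ∈ xs → y ∈ as ++ bs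
    sub′ {y} y∈ with ∈ₚ.∈-++⁻ as (sub (there y∈))
    ... | inj₁ a         = ∈ₚ.∈-++⁺ˡ a
    ... | inj₂ (here eq) = contradiction (sym eq) (All.lookup x∉ y∈)
    ... | inj₂ (there b) = ∈ₚ.∈-++⁺ʳ as b

  enumerates-≤ : {X Y : Set} {P : X → Set} {Q : Y → Set} {xs : List X} {ys : List Y} (f : X → Y) →
    (∀ {x x′} → f x ≡ f x′ → x ≡ x′) → (∀ {x} → P x → Q (f x)) → Enumerates P xs → Enumerates Q ys → length
        xs ≤ length ys
  enumerates-≤ {xs = xs} f inj PQ (ux , ex) (uy , ey) = subst (_≤ _) (Listₚ.length-map f xs)
    (unique-⊆-length (Uniqueₚ.map⁺ inj ux) λ y∈ → case ∈ₚ.∈-map⁻ f y∈ of λ where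
      (x , x∈ , refl) → Equivalence.from (ey _) (PQ (Equivalence.to (ex x) x∈)))

  enumerates-< : {X Y : Set} {P : X → Set} {Q : Y → Set} {xs : List X} {ys : List Y} (f : X → Y) →
    (∀ {x x′} → f x ≡ f x′ → x ≡ x′) → (∀ {x} → P x → Q (f x)) → ∀ y → Q y → (∀ {x} → P x → f x ≢ y) →
    Enumerates P xs → Enumerates Q ys → length xs < length ys
  enumerates-< {xs = xs} f inj PQ y Qy y∉ (ux , ex) (uy , ey) = subst (λ n → suc n ≤ _) (Listₚ.length-map f xs)
    (unique-⊆-length (All.tabulate (λ z∈ eq → case ∈ₚ.∈-map⁻ f z∈ of λ where
        (x , x∈ , refl) → y∉ (Equivalence.to (ex x) x∈) (sym eq)) ∷ Uniqueₚ.map⁺ inj ux)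
      λ where
        (here refl) → Equivalence.from (ey _) Qy
        (there z∈)  → case ∈ₚ.∈-map⁻ f z∈ of λ where
          (x , x∈ , refl) → Equivalence.from (ey _) (PQ (Equivalence.to (ex x) x∈)))

  count-unique : {X : Set} {P : X → Set} {m n : ℕ} → Count P m → Count P n → m ≡ n
  count-unique (xs , ex , refl) (ys , ey , refl) =
    ℕₚ.≤-antisym (enumerates-≤ id id id ex ey) (enumerates-≤ id id id ey ex)

  enumerates-map : {X Y : Set} {P : X → Set} {Q : Y → Set} {xs : List X} (f : X → Y) →
    (∀ {x x′} → f x ≡ f x′ → x ≡ x′) → (∀ {x} → P x → Q (f x)) → (∀ {y} → Q y → ∃[ x ] P x × f x ≡ y) →
    Enumerates P xs → Enumerates Q (map f xs)
  enumerates-map f inj PQ QP (u , e) = Uniqueₚ.map⁺ inj u , λ y → mk⇔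
    (λ y∈ → case ∈ₚ.∈-map⁻ f y∈ of λ where (x , x∈ , refl) → PQ (Equivalence.to (e x) x∈))
    (λ Qy → case QP Qy of λ where (x , Px , refl) → ∈ₚ.∈-map⁺ f (Equivalence.from (e x) Px))

-- Geodesics from V₀

open Graph _~_ using (Path; Shortest)

opaque
  straighten : ∀ p → ∃[ q ] Geo q × (∀ y → fwd p y ≡ fwd q y) × length q ≤ length p
  straighten [] = [] , [] , (λ y → refl) , z≤n
  straighten (g ∷ p) with straighten p
  ... | q , geo , eq , le with Desc? g q
  ... | no ¬d = g ∷ q , ¬d ∷ geo , (λ y → eq (mirror g y)) , s≤s le
  ... | yes d with exchange geo d
  ... | r , e , (_ ∷ geo′) = r , geo′
    , (λ y → trans (eq (mirror g y)) (trans (fwd-≈ e (mirror g y)) (cong (fwd r) (mirror-involutive g y))))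
    , ℕₚ.m≤n⇒m≤1+n (ℕₚ.≤-trans (ℕₚ.n≤1+n _) (ℕₚ.≤-trans (ℕₚ.≤-reflexive (sym (length-≈ e))) le))

Minimal : List Γ → Set
Minimal p = ∀ q → fwd q V₀ ≡ fwd p V₀ → length p ≤ length q

opaque
  Geo⇒Minimal : ∀ {p} → Geo p → Minimal p
  Geo⇒Minimal geo q eq with straighten q
  ... | r , geo′ , op , le = ℕₚ.≤-trans (ℕₚ.≤-reflexive (sym (length-≈ (same-≈ geo′ geo (trans (sym (op V₀)) eq))))) le

  Minimal⇒Geo : ∀ {p} → Minimal p → Geo p
  Minimal⇒Geo {[]}    min = []
  Minimal⇒Geo {g ∷ p} min = ¬desc ∷ geo
    where
    geo : Geo p
    geo = Minimal⇒Geo λ q eq → ℕₚ.≤-pred (min (g ∷ q) (same-vertex q p eq (mirror g V₀)))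
    ¬desc : ¬ Desc g p
    ¬desc d with exchange geo d
    ... | q , e , _ = ℕₚ.<-irrefl refl (ℕₚ.≤-trans
        (ℕₚ.≤-trans (s≤s (ℕₚ.≤-trans (ℕₚ.n≤1+n _) (ℕₚ.≤-reflexive (sym (length-≈ e)))))
      (min q (trans (cong (fwd q) (sym (mirror-involutive g V₀))) (sym (fwd-≈ e (mirror g V₀))))))  ℕₚ.≤-refl)

  mirror-V₀≢ : ∀ g → mirror g V₀ ≢ V₀
  mirror-V₀≢ g eq with trans (sym (wall-V₀ g)) (trans (cong (wall g) (sym eq))
      (trans (wall-mirror-self g V₀) (cong ⊝_ (wall-V₀ g))))
  ... | ()

  mirror-V₀-injective : ∀ {g k} → mirror g V₀ ≡ mirror k V₀ → g ≡ k
  mirror-V₀-injective {g} {k} eq with same-≈ {g ∷ []} {k ∷ []} ((λ ()) ∷ []) ((λ ()) ∷ []) eq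
  ... | e with Desc-≈ e (here refl)
  ... | here eq = eq

  step-≢ : ∀ p g → fwd p V₀ ≢ fwd (g ∷ p) V₀
  step-≢ p g eq = mirror-V₀≢ g (sym (fwd-injective p eq))

  endpoint : ∀ p h → fwd p V₀ IsEndpointOf fwd p (rotate h (corner 1F))
  endpoint p h = subst (_IsEndpointOf fwd p (rotate h (corner 1F))) (cong (fwd p) (rotate-V₀ h)) (incident p h 0F 1F)

  endpoint′ : ∀ p h → fwd (permute h t₁ ∷ p) V₀ IsEndpointOf fwd p (rotate h (corner 1F))
  endpoint′ p h = subst (fwd (permute h t₁ ∷ p) V₀ IsEndpointOf_)
    (cong (fwd p) (mirror-fix _ _ (rotate-flag h 1F (here refl)))) (endpoint (permute h t₁ ∷ p) h)

  ~⁺ : ∀ p g → fwd p V₀ ~ fwd (g ∷ p) V₀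
  ~⁺ p g with transitive₁ g
  ... | h , refl = step-≢ p g , fwd p (rotate h (corner 1F)) , endpoint p h , endpoint′ p h

  incident-swap : ∀ j k {x y} → Incident j x k y → Incident k y j x
  incident-swap j k (w , a , b) = w , b , a

  -- The walls through the centre of a j-face are those of its j edges at the vertex. Any flag
  -- containing the face is reached by reflecting in them, which leads to the other vertices of the
  -- face, and by a rotation.
  faces : ∀ j k {x y} p h → Incident j x k y → x ≡ fwd p (rotate h (corner j)) →
    ∃[ n ] ∃[ h′ ] Geo n × All (_∈ map (permute h) (flag j)) n × rotate h (corner j) ≡ rotate h′ (corner j)
      × y ≡ fwd p (back n (rotate h′ (corner k)))
  faces j k p h inc eq with incident⁻ j k inc
  ... | q , h′ , _ , eqx , eqy with same-point p q (rotate-Inside h j) (rotate-Inside h′ j) (trans (sym eq) eqx)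
  ... | n , geo , eqc , zero-walls , op = n , h′ , geo , All.map (rotate-zero h j _) zero-walls , eqc , trans eqy (op _)

  vertex-faces : ∀ k {y} p → Incident 0F (fwd p V₀) k y → ∃[ h ] y ≡ fwd p (rotate h (corner k))
  vertex-faces k p inc with faces 0F k p [] inc refl
  ... | [] , h , _ , _ , _ , eq = h , eq
  ... | _ ∷ _ , _ , _ , () ∷ _ , _

  geo-singleton : ∀ {n g} → Geo n → All (_∈ g ∷ []) n → n ≡ [] ⊎ n ≡ g ∷ []
  geo-singleton []  _ = inj₁ refl
  geo-singleton (_ ∷ []) (here refl ∷ []) = inj₂ refl
  geo-singleton (¬d ∷ _ ∷ _) (here refl ∷ here refl ∷ _) = contradiction (here refl) ¬d

opaque
  opposite : ∀ {y} p h → y IsEndpointOf fwd p (rotate h (corner 1F)) → y ≢ fwd p V₀ → y ≡ fwd (permute h t₁ ∷ p) V₀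
  opposite p h y-e y≢ with faces 1F 0F p h (incident-swap 0F 1F y-e) refl
  ... | n , h′ , geo , all , _ , eq with geo-singleton geo all
  ... | inj₁ refl = contradiction (trans eq (cong (fwd p) (rotate-V₀ h′))) y≢
  ... | inj₂ refl = trans eq (cong (fwd (permute h t₁ ∷ p)) (rotate-V₀ h′))

  ~⁻ : ∀ {y} p → fwd p V₀ ~ y → ∃[ g ] y ≡ fwd (g ∷ p) V₀
  ~⁻ p (x≢y , e , x-e , y-e) with vertex-faces 1F p x-e
  ... | h , refl = permute h t₁ , opposite p h y-e (x≢y ∘ sym)

trail : List Γ → List Point
trail []      = []
trail (g ∷ p) = trail p ∷ʳ fwd (g ∷ p) V₀

opaque
  trail-length : ∀ p → length (trail p) ≡ length p
  trail-length []      = refl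
  trail-length (g ∷ p) = trans (Listₚ.length-++ (trail p))
      (trans (ℕₚ.+-comm (length (trail p)) 1) (cong suc (trail-length p)))

  trail-injective : ∀ {p q} → trail p ≡ trail q → p ≡ q
  trail-injective {p} {q} eq = go p q eq (trans (sym (trail-length p)) (trans (cong length eq) (trail-length q)))
    where
    go : ∀ p q → trail p ≡ trail q → length p ≡ length q → p ≡ q
    go []      []      _  _ = refl
    go (g ∷ p) (k ∷ q) eq le with Listₚ.∷ʳ-injective (trail p) (trail q) eq
    ... | eq₁ , eq₂ with go p q eq₁ (cong ℕ.pred le)
    ... | refl = cong (_∷ p) (mirror-V₀-injective (fwd-injective p eq₂))

module _ {X : Set} {_R_ : X → X → Set} where
  private module R = Graph _R_

  path-∷ʳ : ∀ {x y z ps} → R.Path x ps y → y R z → R.Path x (ps ∷ʳ z) z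
  path-∷ʳ Graph.[]       r = r Graph.∷ Graph.[]
  path-∷ʳ (s Graph.∷ pa) r = s Graph.∷ path-∷ʳ pa r

opaque
  path⁺ : ∀ p → Path V₀ (trail p) (fwd p V₀)
  path⁺ []      = Graph.[]
  path⁺ (g ∷ p) = path-∷ʳ (path⁺ p) (~⁺ p g)

  path⁻ : ∀ {ps y} p → Path (fwd p V₀) ps y → ∃[ q ] fwd q V₀ ≡ y × trail q ≡ trail p ++ ps
  path⁻ p Graph.[] = p , refl , sym (Listₚ.++-identityʳ (trail p))
  path⁻ p (Graph._∷_ {y = y} {ps = ps} r pa) with ~⁻ p r
  ... | g , refl with path⁻ (g ∷ p) pa
  ... | q , eq , tr = q , eq , trans tr (Listₚ.++-assoc (trail p) (y ∷ []) ps)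

  shortest⁺ : ∀ {p} → Geo p → Shortest V₀ (fwd p V₀) (trail p)
  shortest⁺ {p} geo = path⁺ p , λ qs pa → case path⁻ [] pa of λ where
    (q , eq , refl) → subst₂ _≤_ (sym (trail-length p)) (sym (trail-length q)) (Geo⇒Minimal geo q eq)

  shortest⁻ : ∀ {x ps} → Shortest V₀ x ps → ∃[ p ] Geo p × fwd p V₀ ≡ x × trail p ≡ ps
  shortest⁻ (pa , min) with path⁻ [] pa
  ... | p , refl , refl = p , Minimal⇒Geo (λ q eq → subst₂ _≤_ (trail-length p) (trail-length q)
    (min (trail q) (subst (Path V₀ (trail q)) eq (path⁺ q)))) , refl , refl

  Geo? : ∀ p → Dec (Geo p)
  Geo? []      = yes []
  Geo? (g ∷ p) = map′ (λ (a , b) → a ∷ b) (λ { (a ∷ b) → a , b }) (¬? (Desc? g p) ×-dec Geo? p)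

-- Values of vertices

opaque
  generators : List Γ
  generators = List.allFin 120

  generators-unique : Unique generators
  generators-unique = Uniqueₚ.allFin⁺ 120

  ∈-generators : ∀ g → g ∈ generators
  ∈-generators = ∈ₚ.∈-allFin

opaque
  words : ℕ → List (List Γ)
  words zero    = [] ∷ []
  words (suc n) = List.cartesianProductWith _∷_ generators (words n)

  words-unique : ∀ n → Unique (words n)
  words-unique zero    = [] ∷ []
  words-unique (suc n) = Uniqueₚ.cartesianProductWith⁺ _∷_ (λ { refl → refl , refl }) generators-unique (words-unique n)

  ∈-words : ∀ p → p ∈ words (length p)
  ∈-words []      = here refl
  ∈-words (g ∷ p) = ∈ₚ.∈-cartesianProductWith⁺ _∷_ (∈-generators g) (∈-words p)

To : Point → List Γ → Set
To x q = Geo q × fwd q V₀ ≡ x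

To? : ∀ x q → Dec (To x q)
To? x q = Geo? q ×-dec (fwd q V₀ ≟P x)

-- The search is complete because all reduced words for one vertex have the same length.
geodesics : List Γ → List (List Γ)
geodesics p = filter (To? (fwd p V₀)) (words (length p))

opaque
  geodesics-enumerates : ∀ {p} → Geo p → Enumerates (To (fwd p V₀)) (geodesics p)
  geodesics-enumerates {p} geo = Uniqueₚ.filter⁺ (To? (fwd p V₀)) (words-unique (length p)) , λ q → mk⇔
    (λ q∈ → proj₂ (∈ₚ.∈-filter⁻ (To? (fwd p V₀)) {xs = words (length p)} q∈))
    (λ (geo′ , eq) → ∈ₚ.∈-filter⁺ (To? (fwd p V₀))
        (subst (λ n → q ∈ words n) (length-≈ (same-≈ geo′ geo eq)) (∈-words q)) (geo′ , eq))

value : List Γ → ℕ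
value p = length (geodesics p)

opaque
  value-count : ∀ {p} → Geo p → Value (fwd p V₀) (value p)
  value-count {p} geo = map trail (geodesics p) , enumerates-map trail trail-injective
    (λ {q} (geo′ , eq) → subst (λ x → Shortest V₀ x (trail q)) eq (shortest⁺ geo′))
        (λ s → case shortest⁻ s of λ { (q , geo′ , eq , tr) → q , (geo′ , eq) , tr })
    (geodesics-enumerates geo) , Listₚ.length-map trail (geodesics p)

  value-≤ : ∀ {g p} → Geo p → ¬ Desc g p → value p ≤ value (g ∷ p)
  value-≤ {g} {p} geo ¬d = enumerates-≤ (g ∷_) (λ { refl → refl })
    (λ {q} (geo′ , eq) → (¬d ∘ Desc-≈ (same-≈ geo′ geo eq)) ∷ geo′ , same-vertex q p eq (mirror g V₀))
    (geodesics-enumerates geo) (geodesics-enumerates (¬d ∷ geo))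

  -- Besides the geodesics whose last letter is g there is one whose last letter is k, since k
  -- commutes with g.
  value-< : ∀ {g k p} → Geo p → ¬ Desc g p → Desc k p → Adj g k → value p < value (g ∷ p)
  value-< {g} {k} {p} geo ¬d d adj with exchange (¬d ∷ geo) (there adj d)
  ... | q , e , geo′ = enumerates-< (g ∷_) (λ { refl → refl })
    (λ {q} (geo′ , eq) → (¬d ∘ Desc-≈ (same-≈ geo′ geo eq)) ∷ geo′ , same-vertex q p eq (mirror g V₀))
    (k ∷ q) (geo′ , sym (fwd-≈ e V₀)) (λ { _ refl → Adj-irrefl adj })
    (geodesics-enumerates geo) (geodesics-enumerates (¬d ∷ geo))

-- Axes and the candidate hypercubes

Star : Γ → List Γ → Set
Star g L = All (λ t → g ≡ t ⊎ Adj g t) L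

opaque
  Star? : ∀ g L → Dec (Star g L)
  Star? g = All.all? λ t → (g Finₚ.≟ t) ⊎-dec Adj? g t

-- The generators of the base tetrahedron that commute with all letters of a word: they span the link
-- of the boundary face of 𝒫 containing the vertex.
axes : List Γ → List Γ
axes []      = tetrahedron
axes (g ∷ p) = filter (Adj? g) (axes p)

-- The criterion of the overview in inductive form: a letter can end the axis t only by being t
-- itself.
data Allowed : List Γ → Set where
  []  : Allowed []
  _∷_ : ∀ {g p} → Star g (axes p) → Allowed p → Allowed (g ∷ p)

opaque
  Star-axes : ∀ {g k p} → Adj g k → Star k (axes p) → Star g (axes (k ∷ p)) → Star g (axes p)
  Star-axes {g} {k} {p} adj sk sg = All.tabulate λ {t} t∈ → case All.lookup sk t∈ of λ where
    (inj₁ refl) → inj₂ adj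
    (inj₂ kt)   → All.lookup sg (∈ₚ.∈-filter⁺ (Adj? k) t∈ kt)

  Star-tail : ∀ {g k p} → Star g (axes p) → Star g (axes (k ∷ p))
  Star-tail {k = k} s = Allₚ.filter⁺ (Adj? k) s

  filter-swap : ∀ g k L → filter (Adj? g) (filter (Adj? k) L) ≡ filter (Adj? k) (filter (Adj? g) L)
  filter-swap g k []      = refl
  filter-swap g k (t ∷ L) = go (Adj? g t) (Adj? k t)
    where
    go : Dec (Adj g t) → Dec (Adj k t) → filter (Adj? g) (filter (Adj? k) (t ∷ L)) ≡ filter (Adj? k)
        (filter (Adj? g) (t ∷ L))
    go (yes a) (yes b) = trans (cong (filter (Adj? g)) (Listₚ.filter-accept (Adj? k) b))
        (trans (Listₚ.filter-accept (Adj? g) a)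
      (trans (cong (t ∷_) (filter-swap g k L)) (sym
          (trans (cong (filter (Adj? k)) (Listₚ.filter-accept (Adj? g) a)) (Listₚ.filter-accept (Adj? k) b)))))
    go (yes a) (no b)  = trans (cong (filter (Adj? g)) (Listₚ.filter-reject (Adj? k) b))
      (trans (filter-swap g k L) (sym (trans (cong (filter (Adj? k)) (Listₚ.filter-accept (Adj? g) a))
          (Listₚ.filter-reject (Adj? k) b))))
    go (no a)  (yes b) = trans (cong (filter (Adj? g)) (Listₚ.filter-accept (Adj? k) b))
        (trans (Listₚ.filter-reject (Adj? g) a)
      (trans (filter-swap g k L) (sym (cong (filter (Adj? k)) (Listₚ.filter-reject (Adj? g) a)))))
    go (no a)  (no b)  = trans (cong (filter (Adj? g)) (Listₚ.filter-reject (Adj? k) b))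
      (trans (filter-swap g k L) (sym (cong (filter (Adj? k)) (Listₚ.filter-reject (Adj? g) a))))

  axes-≈ : ∀ {p q} → p ≈ q → axes p ≡ axes q
  axes-≈ ≈-refl = refl
  axes-≈ (≈-swap {g} {k} {p} a) = filter-swap g k (axes p)
  axes-≈ (≈-cons {g} e) = cong (filter (Adj? g)) (axes-≈ e)
  axes-≈ (≈-trans e f) = trans (axes-≈ e) (axes-≈ f)

  Allowed-≈ : ∀ {p q} → p ≈ q → Allowed p → Allowed q
  Allowed-≈ ≈-refl        al = al
  Allowed-≈ (≈-swap {g} {k} {p} a) (s ∷ s′ ∷ al) = Star-tail {p = p} s′ ∷ Star-axes {p = p} a s′ s ∷ al
  Allowed-≈ (≈-cons e)    (s ∷ al) = subst (Star _) (axes-≈ e) s ∷ Allowed-≈ e al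
  Allowed-≈ (≈-trans e f) al = Allowed-≈ f (Allowed-≈ e al)

  axes-⊆ : ∀ {t} p → t ∈ axes p → t ∈ tetrahedron
  axes-⊆ []      t∈ = t∈
  axes-⊆ (g ∷ p) t∈ = axes-⊆ p (proj₁ (∈ₚ.∈-filter⁻ (Adj? g) {xs = axes p} t∈))

  axes-Adj : ∀ {t} p → t ∈ axes p → All (λ g → Adj g t) p
  axes-Adj []      t∈ = []
  axes-Adj (g ∷ p) t∈ = let t∈′ , a = ∈ₚ.∈-filter⁻ (Adj? g) {xs = axes p} t∈ in a ∷ axes-Adj p t∈′

  Desc-All : ∀ {P : Γ → Set} {g p} → All P p → Desc g p → P g
  Desc-All (x ∷ xs) (here refl) = x
  Desc-All (x ∷ xs) (there _ d) = Desc-All xs d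

  axes-¬Desc : ∀ {t} p → t ∈ axes p → ¬ Desc t p
  axes-¬Desc p t∈ d = Adj-irrefl (Desc-All (axes-Adj p t∈) d)

  clique-∈ : ∀ {L a b} → Clique L → a ∈ L → b ∈ L → a ≡ b ⊎ Adj a b
  clique-∈ (x ∷ c) (here refl) (here refl) = inj₁ refl
  clique-∈ (x ∷ c) (here refl) (there b∈)  = inj₂ (All.lookup x b∈)
  clique-∈ (x ∷ c) (there a∈)  (here refl) = inj₂ (Adj-sym (All.lookup x a∈))
  clique-∈ (x ∷ c) (there a∈)  (there b∈)  = clique-∈ c a∈ b∈

-- The criterion for a hypercube to belong to 𝒫, as seen from one of its vertices: the vertex is
-- allowed and its axes are edges of the hypercube.
Good : List Γ → Rot → Set
Good p h = Geo p × Allowed p × All (_∈ frame h) (axes p)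

opaque
  Good-≈ : ∀ {p q h} → p ≈ q → Good p h → Good q h
  Good-≈ e (geo , al , ax) = Geo-≈ e geo , Allowed-≈ e al , subst (All _) (axes-≈ e) ax

  Good-frame : ∀ {p h k} → (∀ {g} → g ∈ frame h → g ∈ frame k) → Good p h → Good p k
  Good-frame sub (geo , al , ax) = geo , al , All.map sub ax

  -- The edge k leads to another vertex of the same hypercube. If k is a descent, it is cancelled
  -- and may become an axis again, but then it is an edge of the hypercube.
  good-step : ∀ {p h k} → Good p h → k ∈ frame h → ∃[ q ] Good q h × (∀ y → fwd q y ≡ fwd (k ∷ p) y)
  good-step {p} {h} {k} (geo , al , ax) k∈ = go (Desc? k p)
    where
    go : Dec (Desc k p) → ∃[ q ] Good q h × (∀ y → fwd q y ≡ fwd (k ∷ p) y)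
    go (no ¬d) = k ∷ p , (¬d ∷ geo , All.map (clique-∈ (frame-clique h) k∈) ax ∷ al , Allₚ.filter⁺ (Adj? k)
        ax) , λ y → refl
    go (yes d) with exchange geo d
    ... | q , e , (_ ∷ geo′) with Allowed-≈ e al
    ... | s ∷ al′ = q , (geo′ , al′ , All.tabulate (λ t∈ → case All.lookup s t∈ of λ where
          (inj₁ refl) → k∈
          (inj₂ kt)   → All.lookup ax (subst (_ ∈_) (sym (axes-≈ e)) (∈ₚ.∈-filter⁺ (Adj? k) t∈ kt))))
      , λ y → sym (trans (fwd-≈ e (mirror k y)) (cong (fwd q) (mirror-involutive k y)))

  good-steps : ∀ {p h n} → Good p h → All (_∈ frame h) n → ∃[ q ] Good q h × (∀ y → fwd q y ≡ fwd p (back n y))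
  good-steps {p} good [] = p , good , λ y → refl
  good-steps {p} {h} {g ∷ n} good (g∈ ∷ all) =
    let q , good′ , eq = good-step {p} {h} {g} good g∈
        r , good″ , eq′ = good-steps {q} {h} {n} good′ all
    in r , good″ , λ y → trans (eq′ y) (eq (back n y))

  frame-⊆ : ∀ {h k g} → rotate h (corner 4F) ≡ rotate k (corner 4F) → g ∈ frame h → g ∈ frame k
  frame-⊆ {h} {k} {g} eq g∈ = rotate-zero k 4F g (trans (cong (wall g) (sym eq)) (rotate-flag h 4F g∈))

  -- Two vertices of a hypercube differ by walls through its centre, so some `good-step`s connect
  -- the two views.
  good-any : ∀ {p h q k} → Good p h → Geo q → hypercube p h ≡ hypercube q k → Good q k
  good-any {p} {h} {q} {k} good geo eq =
    let n , _ , eqc , zero-walls , op = same-point p q (rotate-Inside h 4F) (rotate-Inside k 4F) eq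
        r , good′ , op′ = good-steps {p} {h} {n} good (All.map (rotate-zero h 4F _) zero-walls)
    in Good-frame {q} {h} {k} (frame-⊆ {h} {k} eqc)
        (Good-≈ {r} {q} {h} (same-≈ (proj₁ good′) geo (trans (op′ V₀) (sym (op V₀)))) good′)

Cand : Point → Set
Cand c = ∃[ p ] ∃[ h ] Good p h × c ≡ hypercube p h

opaque
  good-vertex : ∀ {c x} → Cand c → x IsVertexOf c → ∃[ q ] ∃[ h ] Good q h × x ≡ fwd q V₀ × c ≡ hypercube q h
  good-vertex (p , h , good , eq) inc =
    let q , k , geo , eqx , eqc = incident⁻ 0F 4F inc
    in q , k , good-any {p} {h} {q} {k} good geo (trans (sym eq) eqc) , trans eqx (cong (fwd q) (rotate-V₀ k)) , eqc

-- The reverse of a geodesic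

opaque
  Geo-reverse : ∀ {p} → Geo p → Geo (reverse p)
  Geo-reverse {p} geo = Minimal⇒Geo min
    where
    min : Minimal (reverse p)
    min q eq = subst₂ _≤_ (sym (Listₚ.length-reverse p)) (Listₚ.length-reverse q) (Geo⇒Minimal geo (reverse q) (begin
      fwd (reverse q) V₀              ≡⟨ fwd-reverse (reverse q) V₀ ⟩
      back (reverse (reverse q)) V₀   ≡⟨ cong (λ q → back q V₀) (Listₚ.reverse-involutive q) ⟩
      back q V₀                       ≡⟨ same-back q (reverse p) eq V₀ ⟩
      back (reverse p) V₀             ≡⟨ sym (fwd-reverse p V₀) ⟩
      fwd p V₀                        ∎))
      where open ≡-Reasoning

  Desc-++ : ∀ {t a b} → All (λ g → Adj g t) a → Desc t b → Desc t (a ++ b)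
  Desc-++ []        d = d
  Desc-++ (x ∷ all) d = there x (Desc-++ all d)

  Desc-++ˡ : ∀ {t a} b → Desc t a → Desc t (a ++ b)
  Desc-++ˡ b (here eq)   = here eq
  Desc-++ˡ b (there a d) = there a (Desc-++ˡ b d)

  -- The first letter that does not commute with t is t itself. It can therefore be moved to the
  -- beginning of the word, which means that its wall separates the vertex from V₀.
  axis-or-crossed : ∀ {p t} → Allowed p → t ∈ tetrahedron → t ∈ axes p ⊎ Desc t (reverse p)
  axis-or-crossed [] t∈ = inj₁ t∈
  axis-or-crossed {g ∷ p} {t} (s ∷ al) t∈ with axis-or-crossed al t∈
  ... | inj₂ d = inj₂ (subst (Desc t) (sym (Listₚ.unfold-reverse g p)) (Desc-++ˡ (g ∷ []) d))
  ... | inj₁ t∈′ with All.lookup s t∈′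
  ... | inj₁ refl = inj₂ (subst (Desc t) (sym (Listₚ.unfold-reverse g p))
      (Desc-++ (↭ₚ.All-resp-↭ (↭-sym (↭ₚ.↭-reverse p)) (axes-Adj p t∈′)) (here refl)))
  ... | inj₂ a    = inj₁ (∈ₚ.∈-filter⁺ (Adj? g) t∈′ a)

  Neg-reverse : ∀ {p t} → Geo p → Desc t (reverse p) → Neg (wall t (fwd p V₀))
  Neg-reverse {p} {t} geo d = subst (λ y → Neg (wall t y)) (sym (fwd-reverse p V₀)) (Desc⇒Neg (Geo-reverse geo) d)

-- A wall separating two adjacent vertices is the wall between them.

Differ : ℤ[φ] → ℤ[φ] → Set
Differ a b = (Pos 1 a × Neg b) ⊎ (Neg a × Pos 1 b)

opaque
  Differ-⊝ : ∀ {a b} → Differ (⊝ a) (⊝ b) → Differ a b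
  Differ-⊝ {a} {b} (inj₁ (p , n)) = inj₂ (p , subst (Pos 1) (⊝⊝ b) n)
    where
    ⊝⊝ : ∀ u → ⊝ (⊝ u) ≡ u
    ⊝⊝ = solve-∀ golden-solver
  Differ-⊝ {a} {b} (inj₂ (n , p)) = inj₁ (subst (Pos 1) (⊝⊝ a) n , p)
    where
    ⊝⊝ : ∀ u → ⊝ (⊝ u) ≡ u
    ⊝⊝ = solve-∀ golden-solver

  Geo⇒Pos : ∀ {v g} → Geo v → ¬ Desc g v → Pos 1 (wall g (back v V₀))
  Geo⇒Pos geo ¬d = Signs.positive (signs geo V₀-inside) ¬d

  crossing : ∀ {v} g k → Geo v → Differ (wall k (back v V₀)) (wall k (back v (mirror g V₀))) →
    ∀ y → mirror k (back v y) ≡ back v (mirror g y)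
  crossing {[]} g k geo (inj₂ (n , _)) y = ⊥-elim (Pos-absurd (V₀-inside k) (Pos-weaken n))
  crossing {[]} g k geo (inj₁ (_ , n)) y with Neg⇒Desc {g ∷ []} ((λ ()) ∷ []) n
  ... | here refl = refl
  crossing {g₁ ∷ v} g k (¬d ∷ geo) diff with trichotomy g₁ k
  ... | inj₁ refl = λ y → trans (mirror-involutive k (back v y))
      (trans (sym (mirror-involutive k (back v y))) (cong (mirror k)
    (crossing g k geo (Differ-⊝ (subst₂ Differ (wall-mirror-self k (back v V₀))
        (wall-mirror-self k (back v (mirror g V₀))) diff)) y)))
  ... | inj₂ (inj₁ adj) = λ y → trans (mirror-swap (Adj-sym adj) (back v y)) (cong (mirror g₁)
    (crossing g k geo (subst₂ Differ (wall-mirror-adj adj (back v V₀))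
        (wall-mirror-adj adj (back v (mirror g V₀))) diff) y))
  -- A vertex behind the wall of g₁ is never behind the ultraparallel wall of k. So g₁ must be a
  -- descent of u; then it separates the two vertices and, by induction, is the wall between them.
  -- Reflecting in it shows that k separates them as well, so k = g₁ by induction again.
  ... | inj₂ (inj₂ far) = ⊥-elim (impossible diff)
    where
    y₀ y₁ : Point
    y₀ = back v V₀
    y₁ = back v (mirror g V₀)
    far-¬Desc : ∀ {u} → ¬ Desc k (g₁ ∷ u)
    far-¬Desc (here refl) = Far-irrefl far
    far-¬Desc (there a _) = Far⇒¬Adj far a
    normal : ∃[ u ] Geo u × (∀ y → back (v ++ g ∷ []) y ≡ back u y)
    normal = let u , geo , eq , _ = normalise (v ++ g ∷ []) in u , geo , eq
    u : List Γ
    u = proj₁ normal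
    geo-u : Geo u
    geo-u = proj₁ (proj₂ normal)
    y₁≡ : y₁ ≡ back u V₀
    y₁≡ = trans (sym (back-++ v (g ∷ []) V₀)) (proj₂ (proj₂ normal) V₀)
    impossible : Differ (wall k (mirror g₁ y₀)) (wall k (mirror g₁ y₁)) → ⊥
    impossible (inj₂ (n , _)) = Pos-absurd (Geo⇒Pos (¬d ∷ geo) far-¬Desc) (Pos-weaken n)
    impossible (inj₁ (_ , n)) = contr (Desc? g₁ u)
      where
      contr : Dec (Desc g₁ u) → ⊥
      contr (no ¬du) = Pos-absurd (subst (λ y → Pos 1 (wall k (mirror g₁ y))) (sym y₁≡)
          (Geo⇒Pos (¬du ∷ geo-u) far-¬Desc)) (Pos-weaken n)
      contr (yes du) = Far-irrefl (subst (λ k → Far g₁ k) (mirror-V₀-injective (begin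
          mirror k V₀                        ≡⟨ cong (mirror k) (sym (back-fwd v V₀)) ⟩
          mirror k (back v (fwd v V₀))       ≡⟨ crossing g k geo (inj₂ (neg-k , pos-k)) (fwd v V₀) ⟩
          back v (mirror g (fwd v V₀))       ≡⟨ sym (is-g₁ (fwd v V₀)) ⟩
          mirror g₁ (back v (fwd v V₀))      ≡⟨ cong (mirror g₁) (back-fwd v V₀) ⟩
          mirror g₁ V₀                       ∎)) far)
        where
        open ≡-Reasoning
        is-g₁ : ∀ y → mirror g₁ (back v y) ≡ back v (mirror g y)
        is-g₁ = crossing g g₁ geo (inj₁ (Geo⇒Pos geo ¬d , subst (λ y → Neg (wall g₁ y)) (sym y₁≡) (Desc⇒Neg geo-u du)))
        neg-k : Neg (wall k y₀)
        neg-k = subst (λ y → Neg (wall k y)) (trans (cong (mirror g₁) (sym (is-g₁ V₀))) (mirror-involutive g₁ y₀)) n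
        pos-k : Pos 1 (wall k y₁)
        pos-k = subst (λ y → Pos 1 (wall k y)) (sym y₁≡) (Geo⇒Pos geo-u λ dk → case g₁ Finₚ.≟ k of λ where
          (yes refl) → Far-irrefl far
          (no ≢)     → Far⇒¬Adj far (Desc-Adj geo-u du dk ≢))

  rotate-0 : ∀ h y → rotate h (reflect 0F y) ≡ mirror (permute h t₁) (rotate h y)
  rotate-0 h y = trans (cong (rotate h) (sym (mirror-t₁ y))) (sym (mirror-rotate h t₁ y))

  reduced-tail : ∀ {j r} → Reduced (j ∷ r) → Reduced r
  reduced-tail {j} red u eq = ℕₚ.≤-pred (red (j ∷ u) (λ y → cong (reflect j) (eq y)))

  side : ∀ w → Pos 1 (wall t₁ (act w V₀)) ⊎ Neg (wall t₁ (act w V₀))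
  side w = go (decompose w)
    where
    go : ∃[ p ] ∃[ h ] Geo p × Chamber w p h → Pos 1 (wall t₁ (act w V₀)) ⊎ Neg (wall t₁ (act w V₀))
    go (p , h , geo , ch) = subst (λ y → Pos 1 (wall t₁ y) ⊎ Neg (wall t₁ y))
      (sym (trans (ch V₀) (trans (cong (fwd p) (rotate-V₀ h)) (fwd-reverse p V₀)))) (decide (Desc? t₁ (reverse p)))
      where
      decide : Dec (Desc t₁ (reverse p)) → Pos 1 (wall t₁ (back (reverse p) V₀)) ⊎ Neg (wall t₁ (back (reverse p) V₀))
      decide (yes d) = inj₂ (Desc⇒Neg (Geo-reverse geo) d)
      decide (no ¬d) = inj₁ (Geo⇒Pos (Geo-reverse geo) ¬d)

  crossing-word : ∀ w → Pos 1 (wall t₁ (act w V₀)) → Neg (wall t₁ (act (w ∷ʳ 0F) V₀)) →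
    ∀ y → act (w ∷ʳ 0F) y ≡ reflect 0F (act w y)
  crossing-word w pos neg = go (decompose w)
    where
    go : ∃[ p ] ∃[ h ] Geo p × Chamber w p h → ∀ y → act (w ∷ʳ 0F) y ≡ reflect 0F (act w y)
    go (p , h , geo , ch) y = begin
      act (w ∷ʳ 0F) y                                ≡⟨ after y ⟩
      back v (mirror (permute h t₁) (rotate h y))    ≡⟨ sym
          (crossing (permute h t₁) t₁ (Geo-reverse geo) (inj₁ (pos′ , neg′)) (rotate h y)) ⟩
      mirror t₁ (back v (rotate h y))                ≡⟨ mirror-t₁ _ ⟩
      reflect 0F (back v (rotate h y))               ≡⟨ cong (reflect 0F) (sym (before y)) ⟩
      reflect 0F (act w y)                           ∎
      where
      open ≡-Reasoning
      v : List Γ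
      v = reverse p
      before : ∀ y → act w y ≡ back v (rotate h y)
      before y = trans (ch y) (fwd-reverse p (rotate h y))
      after : ∀ y → act (w ∷ʳ 0F) y ≡ back v (mirror (permute h t₁) (rotate h y))
      after y = trans (act-++ w (0F ∷ []) y) (trans (before (reflect 0F y)) (cong (back v) (rotate-0 h y)))
      pos′ : Pos 1 (wall t₁ (back v V₀))
      pos′ = subst (λ y → Pos 1 (wall t₁ y)) (trans (before V₀) (cong (back v) (rotate-V₀ h))) pos
      neg′ : Neg (wall t₁ (back v (mirror (permute h t₁) V₀)))
      neg′ = subst (λ y → Neg (wall t₁ y)) (trans (after V₀)
          (cong (λ y → back v (mirror (permute h t₁) y)) (rotate-V₀ h))) neg

  act-suc-V₀ : ∀ w i → act (w ∷ʳ suc i) V₀ ≡ act w V₀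
  act-suc-V₀ w i = trans (act-++ w (suc i ∷ []) V₀) (cong (act w) (rotate-V₀ (i ∷ [])))

  -- A discrete intermediate value argument: only the letter s₀ moves the image of V₀, so the sign
  -- changes at such a letter, where the wall crossed must be that of `t₁`.
  find-crossing : ∀ a r → Pos 1 (wall t₁ (act a V₀)) → Neg (wall t₁ (act (a ++ r) V₀)) →
    ∃[ b ] ∃[ c ] a ++ r ≡ b ++ 0F ∷ c × (∀ y → act (b ∷ʳ 0F) y ≡ reflect 0F (act b y))
  find-crossing a [] pos neg = ⊥-elim (Pos-absurd pos
      (Pos-weaken (subst (λ w → Neg (wall t₁ (act w V₀))) (Listₚ.++-identityʳ a) neg)))
  find-crossing a (suc i ∷ r) pos neg =
    let b , c , eq , op = find-crossing (a ∷ʳ suc i) r (subst (λ y → Pos 1 (wall t₁ y)) (sym (act-suc-V₀ a i)) pos)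
          (subst (λ w → Neg (wall t₁ (act w V₀))) (sym (Listₚ.++-assoc a (suc i ∷ []) r)) neg)
    in b , c , trans (sym (Listₚ.++-assoc a (suc i ∷ []) r)) eq , op
  find-crossing a (zero ∷ r) pos neg = go (side (a ∷ʳ 0F))
    where
    go : Pos 1 (wall t₁ (act (a ∷ʳ 0F) V₀)) ⊎ Neg (wall t₁ (act (a ∷ʳ 0F) V₀)) → ∃[ b ] ∃[ c ] a ++ 0F ∷ r ≡
        b ++ 0F ∷ c × (∀ y → act (b ∷ʳ 0F) y ≡ reflect 0F (act b y))
    go (inj₂ n) = a , r , refl , crossing-word a pos n
    go (inj₁ p) = let b , c , eq , op = find-crossing (a ∷ʳ 0F) r p
                        (subst (λ w → Neg (wall t₁ (act w V₀))) (sym (Listₚ.++-assoc a (0F ∷ []) r)) neg)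
                  in b , c , trans (sym (Listₚ.++-assoc a (0F ∷ []) r)) eq , op

-- A reduced gallery does not cross a wall twice.
opaque
  reduced-Neg : ∀ r → Reduced (0F ∷ r) → Neg (wall t₁ (act (0F ∷ r) V₀))
  reduced-Neg r red = go (side r)
    where
    flip : wall t₁ (act (0F ∷ r) V₀) ≡ ⊝ wall t₁ (act r V₀)
    flip = trans (cong (wall t₁) (sym (mirror-t₁ (act r V₀)))) (wall-mirror-self t₁ (act r V₀))
    go : Pos 1 (wall t₁ (act r V₀)) ⊎ Neg (wall t₁ (act r V₀)) → Neg (wall t₁ (act (0F ∷ r) V₀))
    go (inj₁ pos) = subst Neg (sym flip) (subst (Pos 1) (sym (⊝⊝ (wall t₁ (act r V₀)))) pos)
      where
      ⊝⊝ : ∀ u → ⊝ (⊝ u) ≡ u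
      ⊝⊝ = solve-∀ golden-solver
    -- Otherwise r itself crosses this wall, at a letter s₀ that cancels the leading one. This is
    -- the deletion condition.
    go (inj₂ neg) with find-crossing [] r (V₀-inside t₁) neg
    ... | b , c , refl , op = ⊥-elim (ℕₚ.<-irrefl refl (ℕₚ.≤-trans (red (b ++ c) shorter) le))
      where
      le : length (b ++ c) ≤ length (b ++ 0F ∷ c)
      le = subst₂ _≤_ (sym (Listₚ.length-++ b)) (sym (Listₚ.length-++ b))
          (ℕₚ.+-monoʳ-≤ (length b) (ℕₚ.n≤1+n (length c)))
      shorter : ∀ y → act (b ++ c) y ≡ act (0F ∷ b ++ 0F ∷ c) y
      shorter y = sym (begin
        reflect 0F (act (b ++ 0F ∷ c) y)              ≡⟨ cong (λ w → reflect 0F (act w y))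
            (sym (Listₚ.++-assoc b (0F ∷ []) c)) ⟩
        reflect 0F (act ((b ∷ʳ 0F) ++ c) y)           ≡⟨ cong (reflect 0F) (act-++ (b ∷ʳ 0F) c y) ⟩
        reflect 0F (act (b ∷ʳ 0F) (act c y))          ≡⟨ cong (reflect 0F) (op (act c y)) ⟩
        reflect 0F (reflect 0F (act b (act c y)))     ≡⟨ reflect-involutive 0F _ ⟩
        act b (act c y)                               ≡⟨ sym (act-++ b c y) ⟩
        act (b ++ c) y                                ∎)
        where open ≡-Reasoning

-- The mirror of s₄ among the generators

s₄ : Γ → Γ
s₄ = perm 3F

opaque
  unfolding wall perm Adj?

  -- Since the orbit is listed by word length, comparing g with its image tells the side of the
  -- mirror on which g lies. The side of `t₄` is the front, and no neighbour of `t₄` is behind.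
  front : ∀ g → g ≡ t₄ ⊎ Adj g t₄ → s₄ g ≡ g ⊎ g Fin.< s₄ g
  front = toWitness {a? = Finₚ.all? λ g → ((g Finₚ.≟ t₄) ⊎-dec Adj? g t₄) →-dec
      ((s₄ g Finₚ.≟ g) ⊎-dec (g Finₚ.<? s₄ g))} tt

  triangle-link : ∀ g → All (λ t → Adj t g) (t₁ ∷ t₂ ∷ t₃ ∷ []) → g ≡ t₄ ⊎ g ≡ t₄′
  triangle-link = toWitness {a? = Finₚ.all? λ g → All.all? (λ t → Adj? t g) (t₁ ∷ t₂ ∷ t₃ ∷ []) →-dec
      ((g Finₚ.≟ t₄) ⊎-dec (g Finₚ.≟ t₄′))} tt

  t₄′-link : All (λ t → Adj t t₄′) (t₁ ∷ t₂ ∷ t₃ ∷ [])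
  t₄′-link = toWitness {a? = All.all? (λ t → Adj? t t₄′) (t₁ ∷ t₂ ∷ t₃ ∷ [])} tt

  wall-t₂ : ∀ a b c d e → wall t₂ (a ∷ b ∷ c ∷ d ∷ e ∷ []) ≡ a ⊕ 2# ⊗ b
  wall-t₂ = lem 2#
    where
    lem : ∀ k a b c d e → 1# ⊗ a ⊕ (k ⊗ b ⊕ (0# ⊗ c ⊕ (0# ⊗ d ⊕ (0# ⊗ e ⊕ 0#)))) ≡ a ⊕ k ⊗ b
    lem = solve-∀ golden-solver

  wall-t₃ : ∀ a b c d e → wall t₃ (a ∷ b ∷ c ∷ d ∷ e ∷ []) ≡ (a ⊕ 2# ⊗ b) ⊕ 2# ⊗ c
  wall-t₃ = lem 2#
    where
    lem : ∀ k a b c d e → 1# ⊗ a ⊕ (k ⊗ b ⊕ (k ⊗ c ⊕ (0# ⊗ d ⊕ (0# ⊗ e ⊕ 0#)))) ≡ (a ⊕ k ⊗ b) ⊕ k ⊗ c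
    lem = solve-∀ golden-solver

  wall-t₄ : ∀ a b c d e → wall t₄ (a ∷ b ∷ c ∷ d ∷ e ∷ []) ≡ ((a ⊕ 2# ⊗ b) ⊕ 2# ⊗ c) ⊕ 2# ⊗ d
  wall-t₄ = lem 2#
    where
    lem : ∀ k a b c d e → 1# ⊗ a ⊕ (k ⊗ b ⊕ (k ⊗ c ⊕ (k ⊗ d ⊕ (0# ⊗ e ⊕ 0#)))) ≡ ((a ⊕ k ⊗ b) ⊕ k ⊗ c) ⊕ k ⊗ d
    lem = solve-∀ golden-solver

  wall-t₄′ : ∀ a b c d e → wall t₄′ (a ∷ b ∷ c ∷ d ∷ e ∷ []) ≡ (((a ⊕ 2# ⊗ b) ⊕ 2# ⊗ c) ⊕ 2# ⊗ d) ⊕ (2# ⊗ φ#) ⊗ e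
  wall-t₄′ = lem 2# (2# ⊗ φ#)
    where
    lem : ∀ k l a b c d e → 1# ⊗ a ⊕ (k ⊗ b ⊕ (k ⊗ c ⊕ (k ⊗ d ⊕ (l ⊗ e ⊕ 0#)))) ≡
        (((a ⊕ k ⊗ b) ⊕ k ⊗ c) ⊕ k ⊗ d) ⊕ l ⊗ e
    lem = solve-∀ golden-solver

-- Nonnegative coefficients, not both zero. Unlike `Pos 1` this includes φ.
Positive : ℤ[φ] → Set
Positive z = Pos 0 z × 1ℤ ℤ.≤ rational z ℤ.+ golden z

Positive? : ∀ z → Dec (Positive z)
Positive? z = Pos? 0 z ×-dec (1ℤ ℤₚ.≤? rational z ℤ.+ golden z)

opaque
  unfolding wall perm

  front-height : ∀ g → g Fin.< s₄ g → Positive (⊝ lookup (coroot g) 4F)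
  front-height = toWitness {a? = Finₚ.all? λ g → (g Finₚ.<? s₄ g) →-dec Positive? (⊝ lookup (coroot g) 4F)} tt

  back-height : ∀ k → s₄ k Fin.< k → Positive (wall k (lookup cartan 4F))
  back-height = toWitness {a? = Finₚ.all? λ k → (s₄ k Finₚ.<? k) →-dec Positive? (wall k (lookup cartan 4F))} tt

opaque
  unfolding wall

  -- Reflecting k changes the pairing by a product of signed heights of k and g over the mirror; it
  -- is positive if k is behind and g in front.
  pairing-s₄ : ∀ g k → pairing g (s₄ k) ≡ pairing g k ⊕ wall k (lookup cartan 4F) ⊗ (⊝ lookup (coroot g) 4F)
  pairing-s₄ g k = begin
    wall (s₄ k) (coroot g)                           ≡⟨ cong (wall (s₄ k)) (sym (reflect-involutive 4F (coroot g))) ⟩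
    wall (s₄ k) (reflect 4F (reflect 4F (coroot g))) ≡⟨ wall-perm 3F k (reflect 4F (coroot g)) ⟩
    wall k (reflect 4F (coroot g))                   ≡⟨ dot-shift (covector k) (lookup cartan 4F)
        (lookup (coroot g) 4F) (coroot g) ⟩
    wall k (coroot g) ⊕ ⊝ (wall k (lookup cartan 4F) ⊗ lookup (coroot g) 4F)
      ≡⟨ lem (wall k (coroot g)) (wall k (lookup cartan 4F)) (lookup (coroot g) 4F) ⟩
    pairing g k ⊕ wall k (lookup cartan 4F) ⊗ (⊝ lookup (coroot g) 4F) ∎
    where
    open ≡-Reasoning
    lem : ∀ a b c → a ⊕ ⊝ (b ⊗ c) ≡ a ⊕ b ⊗ (⊝ c)
    lem = solve-∀ golden-solver

opaque
  Positive-⊗ : ∀ {z u} → Positive z → Positive u → Positive (z ⊗ u)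
  Positive-⊗ {a + b φ} {c + d φ} (z≥0@(_ , b≥0) , p) (u≥0@(_ , d≥0) , q) = Pos-⊗ {a + b φ} {c + d φ} z≥0 u≥0 ,
    subst (1ℤ ℤ.≤_) (lem a b c d) (ℤₚ.+-mono-≤ (product p q) (*-nonneg b≥0 d≥0))
    where
    product : ∀ {i j} → 1ℤ ℤ.≤ i → 1ℤ ℤ.≤ j → 1ℤ ℤ.≤ i ℤ.* j
    product {+ suc i} {+ suc j} (ℤ.+≤+ _) (ℤ.+≤+ _) = ℤ.+≤+ (s≤s z≤n)
    lem : ∀ a b c d → (a ℤ.+ b) ℤ.* (c ℤ.+ d) ℤ.+ b ℤ.* d ≡ (a ℤ.* c ℤ.+ b ℤ.* d) ℤ.+ (a ℤ.* d ℤ.+ b ℤ.* c ℤ.+ b ℤ.* d)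
    lem = ℤ-Solver.solve-∀

  Positive-absurd : ∀ {z} → Positive z → ¬ Pos 0 (⊝ z)
  Positive-absurd (p , q) n with Pos-⊝ p n
  Positive-absurd (p , ℤ.+≤+ ()) n | refl

  -- Reflecting k to the side of g makes the pairing positive.
  opposite-sides : ∀ g → g Fin.< s₄ g → ∀ k → s₄ k Fin.< k → Adj g k → k ≡ s₄ g
  opposite-sides g lt k gt adj = go (trichotomy g (s₄ k))
    where
    positive : Positive (pairing g (s₄ k))
    positive = subst Positive (sym (trans (pairing-s₄ g k)
        (trans (cong (_⊕ wall k (lookup cartan 4F) ⊗ (⊝ lookup (coroot g) 4F)) adj) (lem _))))
      (Positive-⊗ (back-height k gt) (front-height g lt))
      where
      lem : ∀ a → 0# ⊕ a ≡ a
      lem = solve-∀ golden-solver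
    go : g ≡ s₄ k ⊎ Adj g (s₄ k) ⊎ Far g (s₄ k) → k ≡ s₄ g
    go (inj₁ eq) = trans (sym (perm-involutive 3F k)) (cong s₄ (sym eq))
    go (inj₂ (inj₁ a)) = ⊥-elim (Positive-absurd (subst Positive a positive) (ℤ.+≤+ z≤n , ℤ.+≤+ z≤n))
    go (inj₂ (inj₂ (c , c≥0 , eq))) = ⊥-elim (Positive-absurd positive (subst (Pos 0) (sym (trans (cong ⊝_ eq) (⊝⊝ _)))
      (Pos-⊕ {z = φ# ⊕ φ#} (ℤ.+≤+ z≤n , ℤ.+≤+ z≤n) c≥0)))
      where
      ⊝⊝ : ∀ u → ⊝ (⊝ u) ≡ u
      ⊝⊝ = solve-∀ golden-solver

opaque
  ⊕-cancelˡ : ∀ a {b c} → a ⊕ b ≡ a ⊕ c → b ≡ c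
  ⊕-cancelˡ a {b} {c} eq = trans (lem a b) (trans (cong (⊝ a ⊕_) eq) (sym (lem a c)))
    where
    lem : ∀ a b → b ≡ ⊝ a ⊕ (a ⊕ b)
    lem = solve-∀ golden-solver

  2-cancel : ∀ {a b} → 2# ⊗ a ≡ 2# ⊗ b → a ≡ b
  2-cancel {a} {b} eq = go a b (trans (sym (lem a)) (trans eq (lem b)))
    where
    lem : ∀ a → (1# ⊕ 1#) ⊗ a ≡ a ⊕ a
    lem = solve-∀ golden-solver
    half : ∀ i j → i ℤ.+ i ≡ j ℤ.+ j → i ≡ j
    half i j eq = ℤₚ.*-cancelˡ-≡ (+ 2) i j (trans (double i) (trans eq (sym (double j))))
      where
      double : ∀ i → + 2 ℤ.* i ≡ i ℤ.+ i
      double i = trans (ℤₚ.*-distribʳ-+ i 1ℤ 1ℤ) (cong₂ ℤ._+_ (ℤₚ.*-identityˡ i) (ℤₚ.*-identityˡ i))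
    go : ∀ a b → a ⊕ a ≡ b ⊕ b → a ≡ b
    go (a + b φ) (c + d φ) eq = cong₂ _+_φ (half a c (cong rational eq)) (half b d (cong golden eq))

  2φ-cancel : ∀ {a b} → (2# ⊗ φ#) ⊗ a ≡ (2# ⊗ φ#) ⊗ b → a ≡ b
  2φ-cancel {a} {b} eq = 2-cancel (trans (⊗-assoc φ⁻¹ (2# ⊗ φ#) a)
      (trans (cong (φ⁻¹ ⊗_) eq) (sym (⊗-assoc φ⁻¹ (2# ⊗ φ#) b))))

  -- In the coordinates the five walls form a triangular system with diagonal 1, 2, 2, 2, 2φ.
  walls-separate : ∀ y z → All (λ g → wall g y ≡ wall g z) (t₁ ∷ t₂ ∷ t₃ ∷ t₄ ∷ t₄′ ∷ []) → y ≡ z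
  walls-separate (a ∷ b ∷ c ∷ d ∷ e ∷ []) (a′ ∷ b′ ∷ c′ ∷ d′ ∷ e′ ∷ []) (p ∷ q ∷ r ∷ s ∷ t ∷ []) =
    cong₂ _∷_ ea (cong₂ _∷_ eb (cong₂ _∷_ ec (cong₂ _∷_ ed (cong₂ _∷_ ee refl))))
    where
    next : ∀ {x x′ y y′} → x ≡ x′ → x ⊕ 2# ⊗ y ≡ x′ ⊕ 2# ⊗ y′ → y ≡ y′
    next {x} refl eq = 2-cancel (⊕-cancelˡ x eq)
    next′ : ∀ {x x′ y y′} → x ≡ x′ → x ⊕ (2# ⊗ φ#) ⊗ y ≡ x′ ⊕ (2# ⊗ φ#) ⊗ y′ → y ≡ y′
    next′ {x} refl eq = 2φ-cancel (⊕-cancelˡ x eq)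
    ea : a ≡ a′
    ea = trans (sym (wall-t₁ (a ∷ b ∷ c ∷ d ∷ e ∷ []))) (trans p (wall-t₁ (a′ ∷ b′ ∷ c′ ∷ d′ ∷ e′ ∷ [])))
    eb : b ≡ b′
    eb = next ea (trans (sym (wall-t₂ a b c d e)) (trans q (wall-t₂ a′ b′ c′ d′ e′)))
    ec : c ≡ c′
    ec = next (cong₂ (λ a b → a ⊕ 2# ⊗ b) ea eb) (trans (sym (wall-t₃ a b c d e)) (trans r (wall-t₃ a′ b′ c′ d′ e′)))
    ed : d ≡ d′
    ed = next (cong₂ (λ a b → a ⊕ 2# ⊗ b) (cong₂ (λ a b → a ⊕ 2# ⊗ b) ea eb) ec)
        (trans (sym (wall-t₄ a b c d e)) (trans s (wall-t₄ a′ b′ c′ d′ e′)))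
    ee : e ≡ e′
    ee = next′ (cong₂ (λ a b → a ⊕ 2# ⊗ b) (cong₂ (λ a b → a ⊕ 2# ⊗ b) (cong₂ (λ a b → a ⊕ 2# ⊗ b) ea eb) ec) ed)
      (trans (sym (wall-t₄′ a b c d e)) (trans t (wall-t₄′ a′ b′ c′ d′ e′)))

  t₄≢t₄′ : t₄ ≢ t₄′
  t₄≢t₄′ ()

  -- The vertex `t₄′` is fixed too, being the only other one that completes the triangle t₁ t₂ t₃;
  -- so five independent functionals are preserved.
  rotation-trivial : ∀ h → Fixes h tetrahedron → ∀ y → rotate h y ≡ y
  rotation-trivial h (f₁ ∷ f₂ ∷ f₃ ∷ f₄ ∷ []) y = walls-separate (rotate h y) y
    (fixed f₁ ∷ fixed f₂ ∷ fixed f₃ ∷ fixed f₄ ∷ fixed f₄′ ∷ [])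
    where
    fixed : ∀ {g} → permute h g ≡ g → wall g (rotate h y) ≡ wall g y
    fixed {g} f = trans (cong (λ g → wall g (rotate h y)) (sym f)) (wall-rotate h g y)
    moved : ∀ {t} → permute h t ≡ t → Adj t t₄′ → Adj t (permute h t₄′)
    moved f a = subst (λ t → Adj t (permute h t₄′)) f (Adj-permute h a)
    f₄′ : permute h t₄′ ≡ t₄′
    f₄′ = case triangle-link (permute h t₄′) (All.zipWith (λ (f , a) → moved f a)
        ((f₁ ∷ f₂ ∷ f₃ ∷ []) , t₄′-link)) of λ where
      (inj₁ eq) → contradiction (permute-injective h (trans f₄ (sym eq))) t₄≢t₄′
      (inj₂ eq) → eq

  map-≡-All : ∀ {f g : Γ → Γ} L → map f L ≡ map g L → All (λ t → f t ≡ g t) L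
  map-≡-All []      eq = []
  map-≡-All (x ∷ L) eq = Listₚ.∷-injectiveˡ eq ∷ map-≡-All L (Listₚ.∷-injectiveʳ eq)

  frame-determines : ∀ h k → frame h ≡ frame k → ∀ y → rotate h y ≡ rotate k y
  frame-determines h k eq y = begin
    rotate h y                                   ≡⟨ sym (rotate-undo′ k (rotate h y)) ⟩
    rotate k (rotate (reverse k) (rotate h y))   ≡⟨ cong (rotate k) (sym (rotate-++ (reverse k) h y)) ⟩
    rotate k (rotate (reverse k ++ h) y)         ≡⟨ cong (rotate k) (rotation-trivial (reverse k ++ h) fixes y) ⟩
    rotate k y                                   ∎
    where
    open ≡-Reasoning
    fixes : Fixes (reverse k ++ h) tetrahedron
    fixes = All.map (λ {t} e → trans (permute-++ (reverse k) h t)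
        (trans (cong (permute (reverse k)) e) (permute-undo k t))) (map-≡-All tetrahedron eq)

-- Folding along the mirror of s₄: `behind` tells the side of a chamber.

data Side (g : Γ) : Set where
  on     : s₄ g ≡ g → Side g
  before : g Fin.< s₄ g → Side g
  after  : s₄ g Fin.< g → Side g

opaque
  side-of : ∀ g → Side g
  side-of g with ℕₚ.<-cmp (toℕ g) (toℕ (s₄ g))
  ... | tri< lt _ _ = before lt
  ... | tri≈ _ eq _ = on (sym (Finₚ.toℕ-injective eq))
  ... | tri> _ _ gt = after gt

opaque
  -- A common neighbour strictly on one side would span a crossing edge with the end on the other
  -- side. By `opposite-sides` it would then be the end on its own side.
  bisected : ∀ g → g Fin.< s₄ g → Adj g (s₄ g) → ∀ k → Adj k g → Adj k (s₄ g) → s₄ k ≡ k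
  bisected g lt adj k kg ks = go (side-of k)
    where
    go : Side k → s₄ k ≡ k
    go (on eq)     = eq
    go (after gt)  = ⊥-elim (Adj-irrefl (subst (λ z → Adj z (s₄ g)) (opposite-sides g lt k gt (Adj-sym kg)) ks))
    go (before lk) = ⊥-elim (Adj-irrefl (subst (λ z → Adj z g) (permute-injective (3F ∷ []) (sym
      (opposite-sides k lk (s₄ g) (subst (Fin._< s₄ g) (sym (perm-involutive 3F g)) lt) ks))) kg))

-- A chamber at V₀ is an ordered tetrahedron. It lies closest to the early vertices, so the first
-- vertex off the mirror decides its side.
behind : List Γ → Bool
behind []      = false
behind (g ∷ L) with side-of g
... | on _     = behind L
... | before _ = false
... | after _  = true

opaque
  behind-fixed : ∀ {g} L → s₄ g ≡ g → behind (g ∷ L) ≡ behind L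
  behind-fixed {g} L eq with side-of g
  ... | on _      = refl
  ... | before lt = contradiction lt (Finₚ.<-irrefl (sym eq))
  ... | after lt  = contradiction lt (Finₚ.<-irrefl eq)

  behind-moved : ∀ {g} L M → s₄ g ≢ g → behind (g ∷ L) ≡ behind (g ∷ M)
  behind-moved {g} L M ≢ with side-of g
  ... | on eq    = contradiction eq ≢
  ... | before _ = refl
  ... | after _  = refl

  behind-< : ∀ {g} L → s₄ g Fin.< g → behind (g ∷ L) ≡ true
  behind-< {g} L lt with side-of g
  ... | on eq     = contradiction lt (Finₚ.<-irrefl eq)
  ... | before gt = contradiction gt (Finₚ.<-asym lt)
  ... | after _   = refl

  behind-> : ∀ {g} L → g Fin.< s₄ g → behind (g ∷ L) ≡ false
  behind-> {g} L lt with side-of g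
  ... | on eq    = contradiction lt (Finₚ.<-irrefl (sym eq))
  ... | before _ = refl
  ... | after gt = contradiction gt (Finₚ.<-asym lt)

-- Two adjacent chambers are on the same side of the mirror, unless the mirror is the wall between
-- them and swaps them.
Mirrored : List Γ → List Γ → Set
Mirrored L M = behind L ≡ behind M ⊎ map s₄ L ≡ M

opaque
  mirrored-∷ : ∀ {g L M} → Mirrored L M → Mirrored (g ∷ L) (g ∷ M)
  mirrored-∷ {g} {L} {M} m with s₄ g Finₚ.≟ g
  mirrored-∷ {g} {L} {M} (inj₁ eq) | yes f = inj₁ (trans (behind-fixed L f) (trans eq (sym (behind-fixed M f))))
  mirrored-∷ {g} {L} {M} (inj₂ eq) | yes f = inj₂ (cong₂ _∷_ f eq)
  ... | no ≢ = inj₁ (behind-moved L M ≢)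

  -- If a and b are on different sides, they are mirror images of each other and, by `bisected`, all
  -- remaining vertices are on the mirror, so the reflection realises the swap.
  mirrored-swap : ∀ {a b L} → Clique (a ∷ b ∷ L) → Mirrored (a ∷ b ∷ L) (b ∷ a ∷ L)
  mirrored-swap {a} {b} {L} ((ab ∷ aL) ∷ bL ∷ _) = go (side-of a) (side-of b)
    where
    go : Side a → Side b → Mirrored (a ∷ b ∷ L) (b ∷ a ∷ L)
    go (on f)     _          = inj₁ (trans (behind-fixed (b ∷ L) f) (head-only (side-of b)))
      where
      head-only : Side b → behind (b ∷ L) ≡ behind (b ∷ a ∷ L)
      head-only (on f′)    = trans (behind-fixed L f′) (sym (trans (behind-fixed (a ∷ L) f′) (behind-fixed L f)))
      head-only (before l) = trans (behind-> L l) (sym (behind-> (a ∷ L) l))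
      head-only (after l)  = trans (behind-< L l) (sym (behind-< (a ∷ L) l))
    go (before l) (on f)     = inj₁ (trans (behind-> (b ∷ L) l) (sym (trans (behind-fixed (a ∷ L) f) (behind-> L l))))
    go (after l)  (on f)     = inj₁ (trans (behind-< (b ∷ L) l) (sym (trans (behind-fixed (a ∷ L) f) (behind-< L l))))
    go (before l) (before m) = inj₁ (trans (behind-> (b ∷ L) l) (sym (behind-> (a ∷ L) m)))
    go (after l)  (after m)  = inj₁ (trans (behind-< (b ∷ L) l) (sym (behind-< (a ∷ L) m)))
    go (before l) (after m)  = inj₂ (cong₂ _∷_ (sym b≡) (cong₂ _∷_ (trans (cong s₄ b≡) (perm-involutive 3F a))
      (Listₚ.map-id-local (All.zipWith (λ {k} (x , y) → bisected a l (subst (Adj a) b≡ ab) k (Adj-sym x)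
          (subst (Adj k) b≡ (Adj-sym y))) (aL , bL)))))
      where
      b≡ : b ≡ s₄ a
      b≡ = opposite-sides a l b m ab
    go (after l)  (before m) = inj₂ (cong₂ _∷_ (trans (cong s₄ a≡) (perm-involutive 3F b)) (cong₂ _∷_ (sym a≡)
      (Listₚ.map-id-local (All.zipWith (λ {k} (x , y) → bisected b m (subst (Adj b) a≡ (Adj-sym ab)) k
          (Adj-sym y) (subst (Adj k) a≡ (Adj-sym x))) (aL , bL)))))
      where
      a≡ : a ≡ s₄ b
      a≡ = opposite-sides b m a l (Adj-sym ab)

  frame-∷ʳ : ∀ h j → frame (h ∷ʳ j) ≡ map (permute h) (map (perm j) tetrahedron)
  frame-∷ʳ h j = trans (Listₚ.map-cong (permute-++ h (j ∷ [])) tetrahedron)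
      (Listₚ.map-∘ {g = permute h} {f = perm j} tetrahedron)

adjacent-flag : Fin 4 → List Γ
adjacent-flag 0F = t₂ ∷ t₁ ∷ t₃ ∷ t₄ ∷ []
adjacent-flag 1F = t₁ ∷ t₃ ∷ t₂ ∷ t₄ ∷ []
adjacent-flag 2F = t₁ ∷ t₂ ∷ t₄ ∷ t₃ ∷ []
adjacent-flag 3F = t₁ ∷ t₂ ∷ t₃ ∷ t₄′ ∷ []

opaque
  unfolding perm

  perm-tetrahedron : ∀ j → map (perm j) tetrahedron ≡ adjacent-flag j
  perm-tetrahedron 0F = refl
  perm-tetrahedron 1F = refl
  perm-tetrahedron 2F = refl
  perm-tetrahedron 3F = refl

opaque
  frame-mirrored : ∀ h j → Mirrored (frame h) (frame (h ∷ʳ j))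
  frame-mirrored h j = subst (Mirrored (frame h))
      (sym (trans (frame-∷ʳ h j) (cong (map (permute h)) (perm-tetrahedron j)))) (go j)
    where
    a b c d d′ : Γ
    a = permute h t₁
    b = permute h t₂
    c = permute h t₃
    d = permute h t₄
    d′ = permute h t₄′
    -- When the fourth vertex is exchanged, the side can change only if the common triangle lies on
    -- the mirror. The reflection then swaps or fixes the two vertices that complete this triangle.
    last : Mirrored (a ∷ b ∷ c ∷ d ∷ []) (a ∷ b ∷ c ∷ d′ ∷ [])
    last with s₄ a Finₚ.≟ a | s₄ b Finₚ.≟ b | s₄ c Finₚ.≟ c
    ... | no ≢ | _ | _ = inj₁ (behind-moved _ _ ≢)
    ... | yes p | no ≢ | _ = mirrored-∷ (inj₁ (behind-moved _ _ ≢))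
    ... | yes p | yes q | no ≢ = mirrored-∷ (mirrored-∷ (inj₁ (behind-moved _ _ ≢)))
    ... | yes p | yes q | yes r = mirrored-∷ (mirrored-∷ (mirrored-∷ end))
      where
      pull : ∀ {t} g → s₄ (permute h t) ≡ permute h t → Adj t g → Adj t (permute (reverse h) (s₄ (permute h g)))
      pull {t} g f adj = Adj-permute⁻ h (subst (Adj (permute h t)) (sym (permute-undo′ h _))
          (subst (λ z → Adj z (s₄ (permute h g))) f (trans (pairing-perm 3F _ _) (Adj-permute h adj))))
      image : ∀ g → All (λ t → Adj t g) (t₁ ∷ t₂ ∷ t₃ ∷ []) → s₄ (permute h g) ≡ d ⊎ s₄ (permute h g) ≡ d′
      image g (x ∷ y ∷ z ∷ []) = case triangle-link _ (pull g p x ∷ pull g q y ∷ pull g r z ∷ []) of λ where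
        (inj₁ eq) → inj₁ (trans (sym (permute-undo′ h _)) (cong (permute h) eq))
        (inj₂ eq) → inj₂ (trans (sym (permute-undo′ h _)) (cong (permute h) eq))
      t₄-link : All (λ t → Adj t t₄) (t₁ ∷ t₂ ∷ t₃ ∷ [])
      t₄-link = case tetrahedron-clique of λ where ((_ ∷ _ ∷ x ∷ []) ∷ (_ ∷ y ∷ []) ∷ (z ∷ []) ∷ _) → x ∷ y ∷ z ∷ []
      end : Mirrored (d ∷ []) (d′ ∷ [])
      end = case image t₄ t₄-link of λ where
        (inj₂ eq) → inj₂ (cong (_∷ []) eq)
        (inj₁ fd) → case image t₄′ t₄′-link of λ where
          (inj₂ fd′) → inj₁ (trans (behind-fixed [] fd) (sym (behind-fixed [] fd′)))
          (inj₁ eq)  → contradiction (permute-injective h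
              (trans (sym fd) (trans (cong s₄ (sym eq)) (perm-involutive 3F d′)))) t₄≢t₄′
    go : ∀ j → Mirrored (frame h) (map (permute h) (adjacent-flag j))
    go 0F = mirrored-swap (frame-clique h)
    go 1F = mirrored-∷ (mirrored-swap (AllPairs.tail (frame-clique h)))
    go 2F = mirrored-∷ (mirrored-∷ (mirrored-swap (AllPairs.tail (AllPairs.tail (frame-clique h)))))
    go 3F = last

tilt : Bool → Rot → Rot
tilt false h = h
tilt true  h = 3F ∷ h

fold : Rot → Rot
fold h = tilt (behind (frame h)) h

opaque
  frame-perm : ∀ h → frame (3F ∷ h) ≡ map s₄ (frame h)
  frame-perm h = Listₚ.map-∘ {g = s₄} {f = permute h} tetrahedron

  -- The folded gallery stays in place where the original one crosses the mirror, and makes the same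
  -- step elsewhere.
  fold-step : ∀ h j → (∀ y → rotate (fold (h ∷ʳ j)) y ≡ rotate (fold h) y)
    ⊎ (∀ y → rotate (fold (h ∷ʳ j)) y ≡ rotate (fold h) (reflect (suc j) y))
  fold-step h j = go (behind (frame h)) refl (behind (frame (h ∷ʳ j))) refl (frame-mirrored h j)
    where
    go : ∀ b → behind (frame h) ≡ b → ∀ b′ → behind (frame (h ∷ʳ j)) ≡ b′ → Mirrored (frame h) (frame (h ∷ʳ j)) →
      (∀ y → rotate (tilt b′ (h ∷ʳ j)) y ≡ rotate (tilt b h) y) ⊎
          (∀ y → rotate (tilt b′ (h ∷ʳ j)) y ≡ rotate (tilt b h) (reflect (suc j) y))
    go false _  false _   _        = inj₂ (rotate-++ h (j ∷ []))
    go true  _  true  _   _        = inj₂ λ y → cong (reflect 4F) (rotate-++ h (j ∷ []) y)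
    go false eq true  eq′ (inj₁ e) = contradiction (trans (sym eq) (trans e eq′)) λ ()
    go true  eq false eq′ (inj₁ e) = contradiction (trans (sym eq) (trans e eq′)) λ ()
    go false _  true  _   (inj₂ e) = inj₁ λ y → trans
      (cong (reflect 4F) (sym (frame-determines (3F ∷ h) (h ∷ʳ j) (trans (frame-perm h) e) y)))
          (reflect-involutive 4F (rotate h y))
    go true  _  false _   (inj₂ e) = inj₁ λ y → sym (frame-determines (3F ∷ h) (h ∷ʳ j) (trans (frame-perm h) e) y)

  behind-near : ∀ {L} → All (λ g → g ≡ t₄ ⊎ Adj g t₄) L → behind L ≡ false
  behind-near [] = refl
  behind-near {g ∷ L} (x ∷ xs) with front g x
  ... | inj₁ f  = trans (behind-fixed L f) (behind-near xs)
  ... | inj₂ lt = behind-> L lt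

  fold-near : ∀ h → t₄ ∈ frame h → fold h ≡ h
  fold-near h t∈ = cong (λ b → tilt b h) (behind-near (All.tabulate λ g∈ → clique-∈ (frame-clique h) g∈ t∈))

  -- Makes folding compatible with walking along an edge. The generator of the edge is not behind
  -- the mirror, being a neighbour of `t₄`. If it is in front, the chamber is not folded; if it is
  -- on the mirror, the fold keeps it.
  fold-t₁ : ∀ h → Adj (permute h t₁) t₄ → permute (fold h) t₁ ≡ permute h t₁
  fold-t₁ h adj = go (behind (frame h)) refl
    where
    go : ∀ b → behind (frame h) ≡ b → permute (tilt b h) t₁ ≡ permute h t₁
    go false _  = refl
    go true  eq with front (permute h t₁) (inj₂ adj)
    ... | inj₁ f  = f
    ... | inj₂ lt = contradiction (trans (sym eq) (behind-> _ lt)) λ ()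

opaque
  unfolding perm side-of

  behind-exit : behind (frame (3F ∷ [])) ≡ true
  behind-exit = refl

opaque
  fold-exit : ∀ y → rotate (fold (3F ∷ [])) y ≡ y
  fold-exit y = trans (cong (λ b → rotate (tilt b (3F ∷ [])) y) behind-exit) (reflect-involutive 4F y)

  letters-wall : ∀ {t q} → All (λ g → Adj g t) q → ∀ y → wall t (back q y) ≡ wall t y
  letters-wall []        y = refl
  letters-wall (a ∷ all) y = trans (wall-mirror-adj a _) (letters-wall all y)

  letters-wall′ : ∀ {t q} → All (λ g → Adj g t) q → ∀ y → wall t (fwd q y) ≡ wall t y
  letters-wall′ {q = q} all y = trans (sym (letters-wall all (fwd q y))) (cong (wall _) (back-fwd q y))

  -- No wall ultraparallel to an axis wall at a boundary vertex cuts off a vertex of 𝒫.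
  far-wall : ∀ {t g q p} → t ∈ tetrahedron → Geo p → Allowed p → All (λ k → Adj k t) q → Far g t →
    ¬ Neg (wall g (back q (fwd p V₀)))
  far-wall {t} {g} {q} {p} t∈ geo al all far neg = go (normalise (q ++ reverse p)) (axis-or-crossed al t∈)
    where
    go : ∃[ n ] Geo n × (∀ y → back (q ++ reverse p) y ≡ back n y) ×
        (∀ {P : Γ → Set} → All P (q ++ reverse p) → All P n) × length n ≤ length (q ++ reverse p) →
      t ∈ axes p ⊎ Desc t (reverse p) → ⊥
    go (n , geo-n , op , keep , _) = finish
      where
      at : back q (fwd p V₀) ≡ back n V₀
      at = trans (cong (back q) (fwd-reverse p V₀)) (trans (sym (back-++ q (reverse p) V₀)) (op V₀))
      dg : Desc g n
      dg = Neg⇒Desc geo-n (subst (λ y → Neg (wall g y)) at neg)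
      finish : t ∈ axes p ⊎ Desc t (reverse p) → ⊥
      -- If t is an axis at p, then all letters of n commute with t, but g does not. If the wall of
      -- t has been crossed, then g and t are distinct descents of n, so they would commute.
      finish (inj₁ t∈) = Far⇒¬Adj far (Desc-All (keep
          (Allₚ.++⁺ all (↭ₚ.All-resp-↭ (↭-sym (↭ₚ.↭-reverse p)) (axes-Adj p t∈)))) dg)
      finish (inj₂ d)  = Far⇒¬Adj far (Desc-Adj geo-n dg
        (Neg⇒Desc geo-n (subst Neg (trans (sym (letters-wall all (fwd p V₀))) (cong (wall t) at)) (Neg-reverse geo d)))
        λ { refl → Far-irrefl far })

  -- A gallery from (q , h ++ k) to a chamber of 𝒫 can be folded onto one from (q , h ++ fold k).
  shortcut : ∀ {h t} → t ≡ permute h t₄ → t ∈ tetrahedron → ∀ {pe he} → Good pe he →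
    ∀ rest q k → All (λ g → Adj g t) q → Reduced rest →
        (∀ y → fwd q (rotate h (rotate k (act rest y))) ≡ fwd pe (rotate he y)) →
    ∃[ u ] length u ≤ length rest × (∀ y → rotate (fold k) (act u y) ≡ rotate k (act rest y))
  shortcut {h} {t} t≡ t∈ {pe} {he} (geo , al , ax) [] q k all red end = [] , z≤n , λ y → cong
      (λ k → rotate k y) (fold-near k t₄∈)
    where
    end-V₀ : fwd q V₀ ≡ fwd pe V₀
    end-V₀ = trans (cong (fwd q) (sym (trans (cong (rotate h) (rotate-V₀ k)) (rotate-V₀ h))))
        (trans (end V₀) (cong (fwd pe) (rotate-V₀ he)))
    rot : ∀ y → rotate (h ++ k) y ≡ rotate he y
    rot y = trans (rotate-++ h k y) (fwd-injective q (trans (end y) (sym (same-vertex q pe end-V₀ (rotate he y)))))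
    -- Only walls perpendicular to that of t have been crossed, so the end of the gallery is on the
    -- same side of the wall of t as V₀. Hence t is an axis there, and the final chamber, which
    -- contains it, is not moved by the fold.
    axis : t ∈ axes pe
    axis with axis-or-crossed al t∈
    ... | inj₁ t∈ = t∈
    ... | inj₂ d  = ⊥-elim (Pos-absurd (V₀-inside t) (Pos-weaken (subst Neg
      (trans (cong (wall t) (sym end-V₀)) (letters-wall′ all V₀)) (Neg-reverse geo d))))
    t∈frame : permute h t₄ ∈ frame (h ++ k)
    t∈frame = frame-⊆ {he} {h ++ k} (sym (rot (corner 4F))) (subst (_∈ frame he) t≡ (All.lookup ax axis))
    t₄∈ : t₄ ∈ frame k
    t₄∈ with ∈ₚ.∈-map⁻ (permute (h ++ k)) t∈frame
    ... | s , s∈ , eq = subst (_∈ frame k) (sym (permute-injective h (trans eq (permute-++ h k s))))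
        (∈ₚ.∈-map⁺ (permute k) s∈)
  shortcut {h} t≡ t∈ {pe} {he} good (suc j ∷ rest) q k all red end =
    let u , le , op = shortcut {h} t≡ t∈ {pe} {he} good rest q (k ∷ʳ j) all (reduced-tail {suc j} {rest} red)
          (λ y → trans (cong (λ z → fwd q (rotate h z)) (rotate-++ k (j ∷ []) (act rest y))) (end y))
    in case fold-step k j of λ where
      (inj₁ same) → u , ℕₚ.m≤n⇒m≤1+n le , λ y → trans (sym (same (act u y)))
          (trans (op y) (rotate-++ k (j ∷ []) (act rest y)))
      (inj₂ step) → suc j ∷ u , s≤s le , λ y → trans (sym (step (act u y)))
          (trans (op y) (rotate-++ k (j ∷ []) (act rest y)))
  shortcut {h} {t} t≡ t∈ {pe} {he} good@(geo , al , ax) (zero ∷ rest) q k all red end = go (trichotomy g t)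
    where
    k₁ g : Γ
    k₁ = permute k t₁
    g = permute h k₁
    go : g ≡ t ⊎ Adj g t ⊎ Far g t → ∃[ u ] length u ≤ suc (length rest) ×
        (∀ y → rotate (fold k) (act u y) ≡ rotate k (reflect 0F (act rest y)))
    -- The gallery walks along t itself. A chamber with the vertex t is not folded, so the rest of
    -- the gallery can be kept.
    go (inj₁ eq) = 0F ∷ rest , ℕₚ.≤-refl , λ y → cong (λ k → rotate k (reflect 0F (act rest y)))
      (fold-near k (here (sym (permute-injective h (trans eq t≡)))))
    go (inj₂ (inj₁ adj)) =
      let u , le , op = shortcut {h} t≡ t∈ {pe} {he} good rest (g ∷ q) k (adj ∷ all)
              (reduced-tail {0F} {rest} red) (λ y → trans (cong (fwd q) (sym (move y))) (end y))
      in 0F ∷ u , s≤s le , λ y → begin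
        rotate (fold k) (reflect 0F (act u y))           ≡⟨ rotate-0 (fold k) (act u y) ⟩
        mirror (permute (fold k) t₁) (rotate (fold k) (act u y))
          ≡⟨ cong₂ mirror (fold-t₁ k (Adj-permute⁻ h (subst (Adj g) t≡ adj))) (op y) ⟩
        mirror k₁ (rotate k (act rest y))                ≡⟨ sym (rotate-0 k (act rest y)) ⟩
        rotate k (reflect 0F (act rest y))               ∎
      where
      open ≡-Reasoning
      move : ∀ y → rotate h (rotate k (reflect 0F (act rest y))) ≡ mirror g (rotate h (rotate k (act rest y)))
      move y = trans (cong (rotate h) (rotate-0 k (act rest y))) (sym (mirror-rotate h k₁ _))
    -- By `reduced-Neg` the gallery would end behind the wall of g, which `far-wall` excludes.
    go (inj₂ (inj₂ far)) = ⊥-elim (far-wall {q = q} t∈ geo al all far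
      (subst Neg (begin
        wall t₁ (act (0F ∷ rest) V₀)                                  ≡⟨ sym (wall-rotate k t₁ _) ⟩
        wall k₁ (rotate k (act (0F ∷ rest) V₀))                       ≡⟨ sym (wall-rotate h k₁ _) ⟩
        wall g (rotate h (rotate k (act (0F ∷ rest) V₀)))             ≡⟨ cong (wall g) (sym (back-fwd q _)) ⟩
        wall g (back q (fwd q (rotate h (rotate k (act (0F ∷ rest) V₀))))) ≡⟨ cong (λ y → wall g (back q y))
            (trans (end V₀) (cong (fwd pe) (rotate-V₀ he))) ⟩
        wall g (back q (fwd pe V₀))                                   ∎) (reduced-Neg rest red)))
      where open ≡-Reasoning

  -- 𝒫 is exited only across a facet opposite to an axis, and folding there shortens the gallery.
  no-exit : ∀ {p h pe he r} → Good p h → Good pe he → (∀ y → fwd p (rotate h (act (4F ∷ r) y)) ≡ fwd pe (rotate he y)) →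
    Reduced (4F ∷ r) → Good p (h ∷ʳ 3F)
  no-exit {p} {h} {pe} {he} {r} good@(geo , al , ax) end-good end red = geo , al , All.tabulate stay
    where
    frame≡ : frame (h ∷ʳ 3F) ≡ map (permute h) (t₁ ∷ t₂ ∷ t₃ ∷ t₄′ ∷ [])
    frame≡ = trans (frame-∷ʳ h 3F) (cong (map (permute h)) (perm-tetrahedron 3F))
    impossible : ∀ {t} → t ∈ axes p → t ≢ permute h t₄
    impossible {t} t∈ refl =
      let u , le , op = shortcut {h} refl (axes-⊆ p t∈) {pe} {he} end-good r p (3F ∷ []) (axes-Adj p t∈)
              (reduced-tail {4F} {r} red) end
      in ℕₚ.<-irrefl refl (ℕₚ.≤-trans (red u (λ y → trans (sym (fold-exit (act u y))) (op y))) le)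
    stay : ∀ {t} → t ∈ axes p → t ∈ frame (h ∷ʳ 3F)
    stay {t} t∈ = subst (t ∈_) (sym frame≡) (case All.lookup ax t∈ of λ where
      (here eq)                          → here eq
      (there (here eq))                  → there (here eq)
      (there (there (here eq)))          → there (there (here eq))
      (there (there (there (here eq))))  → contradiction eq (impossible t∈))

  -- Every hypercube of 𝒫 is a candidate

  frame-swap : ∀ h j {g} → j ≢ 3F → g ∈ frame h → g ∈ frame (h ∷ʳ j)
  frame-swap h j {g} j≢ g∈ = subst (g ∈_) (sym (frame-∷ʳ h j))
      (↭ₚ.∈-resp-↭ (↭ₚ.map⁺ (permute h) (subst (tetrahedron ↭_) (sym (perm-tetrahedron j)) (go j j≢))) g∈)
    where
    go : ∀ j → j ≢ 3F → tetrahedron ↭ adjacent-flag j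
    go 0F _ = swap t₁ t₂ refl
    go 1F _ = prep t₁ (swap t₂ t₃ refl)
    go 2F _ = prep t₁ (prep t₂ (swap t₃ t₄ refl))
    go 3F ≢ = contradiction refl ≢

  -- Along the gallery, s₀ passes to another vertex of the current hypercube and s₁, s₂, s₃ only
  -- reorder its frame. The hypercube changes only at s₄, where `no-exit` applies.
  sound-convex : ∀ u u′ p h {pe he} → Good p h → Good pe he →
      (∀ y → fwd p (rotate h (act (u ++ u′) y)) ≡ fwd pe (rotate he y)) →
    Reduced (u ++ u′) → ∃[ q ] ∃[ k ] Good q k × (∀ y → fwd p (rotate h (act u y)) ≡ fwd q (rotate k y))
  sound-convex [] u′ p h good _ _ _ = p , h , good , λ y → refl
  sound-convex (zero ∷ u) u′ p h {pe} {he} good end-good end red =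
    let q , good′ , op = good-step {p} {h} {permute h t₁} good (here refl)
        op′ = λ y → trans (op (rotate h y)) (cong (fwd p) (sym (rotate-0 h y)))
        r , k , good″ , eq = sound-convex u u′ q h {pe} {he} good′ end-good
            (λ y → trans (op′ (act (u ++ u′) y)) (end y)) (reduced-tail {0F} {u ++ u′} red)
    in r , k , good″ , λ y → trans (sym (op′ (act u y))) (eq y)
  sound-convex (suc j ∷ u) u′ p h {pe} {he} good end-good end red =
    let op′ = λ y → rotate-++ h (j ∷ []) y
        r , k , good″ , eq = sound-convex u u′ p (h ∷ʳ j) {pe} {he} (stay j good end red) end-good
          (λ y → trans (cong (fwd p) (op′ (act (u ++ u′) y))) (end y)) (reduced-tail {suc j} {u ++ u′} red)
    in r , k , good″ , λ y → trans (cong (fwd p) (sym (op′ (act u y)))) (eq y)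
    where
    stay : ∀ j → Good p h → (∀ y → fwd p (rotate h (act (suc j ∷ u ++ u′) y)) ≡ fwd pe (rotate he y)) →
        Reduced (suc j ∷ u ++ u′) → Good p (h ∷ʳ j)
    stay j good end red with j Finₚ.≟ 3F
    ... | no j≢    = Good-frame {p} {h} {h ∷ʳ j} (frame-swap h j j≢) good
    ... | yes refl = no-exit {p} {h} {pe} {he} {u ++ u′} good end-good end red

  other-vertex : ∀ h {k} → k ∈ frame h → ∃[ l ] l ∈ frame h × Adj k l
  other-vertex h k∈ with frame-clique h
  other-vertex h (here refl) | (x ∷ _) ∷ _ = _ , there (here refl) , x
  other-vertex h (there k∈)  | xs ∷ _      = _ , here refl , Adj-sym (All.lookup xs k∈)

  -- If the edge k is not incoming, a step along k, followed if necessary by one along a second edge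
  -- l, reaches a vertex of larger value. The growth is strict as soon as a descent commutes with
  -- the letter added.
  largest-frame : ∀ {q h} → Good q h → LargestVertex (hypercube q h) (fwd q V₀) → ∀ {k} → k ∈ frame h → Desc k q
  largest-frame {q} {h} (geo , _) (_ , m , vm , largest) {k} k∈ with Desc? k q
  ... | yes d = d
  ... | no ¬d = ⊥-elim (go (other-vertex h k∈))
    where
    vertex : ∀ {g} p → hypercube p h ≡ hypercube q h → g ∈ frame h →
      hypercube (g ∷ p) h ≡ hypercube q h
    vertex {g} p eq g∈ = trans (cong (fwd p) (mirror-fix g _ (rotate-flag h 4F g∈))) eq
    bound : ∀ {p} → Geo p → hypercube p h ≡ hypercube q h → value p ≤ value q
    bound {p} geo-p eq = subst (value p ≤_) (count-unique vm (value-count geo)) (largest _ (value p)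
      (subst₂ _IsVertexOf_ (cong (fwd p) (rotate-V₀ h)) eq (incident p h 0F 4F)) (value-count geo-p))
    go : ∃[ l ] l ∈ frame h × Adj k l → ⊥
    go (l , l∈ , kl) with Desc? l q
    ... | yes dl = ℕₚ.<-irrefl refl (ℕₚ.≤-trans (value-< geo ¬d dl kl) (bound (¬d ∷ geo) (vertex q refl k∈)))
    ... | no ¬dl = ℕₚ.<-irrefl refl (ℕₚ.≤-trans (s≤s (value-≤ geo ¬d)) (ℕₚ.≤-trans
        (value-< (¬d ∷ geo) ¬dk (here refl) (Adj-sym kl))
            (bound (¬dk ∷ ¬d ∷ geo) (vertex (k ∷ q) (vertex q refl k∈) l∈))))
      where
      ¬dk : ¬ Desc l (k ∷ q)
      ¬dk (here refl) = Adj-irrefl kl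
      ¬dk (there _ d) = ¬dl d

  -- At the largest vertex all edges of the hypercube are descents. An axis would be one of these
  -- edges, yet no axis is a descent; so there are no axes, and every hypercube at this vertex is a
  -- candidate.
  sound-around : ∀ {c x c′} → Cand c → LargestVertex c x → x IsVertexOf c′ → Cand c′
  sound-around {c} {x} cand lv@(x-c , _) x-c′ with good-vertex cand x-c
  ... | q , h , good@(geo , al , ax) , refl , refl with vertex-faces 4F q x-c′
  ... | h′ , refl = q , h′ , (geo , al , All.tabulate
      (λ t∈ → contradiction (largest-frame {q} {h} good lv (All.lookup ax t∈)) (axes-¬Desc q t∈))) , refl

  sound : ∀ {c} → 𝒫 c → Cand c
  sound base = [] , [] , ([] , [] , All.tabulate λ t∈ → t∈) , refl
  sound (around Pc lv x-c′) = sound-around (sound Pc) lv x-c′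
  sound (convex w u u′ red P₁ P₂) with decompose w | decompose (w ++ u ++ u′) | sound P₁ | sound P₂
  ... | p , h , geo , ch | pe , he , geo-e , ch-e | p₁ , h₁ , good₁ , eq₁ | p₂ , h₂ , good₂ , eq₂ =
    let good = good-any {p₁} {h₁} {p} {h} good₁ geo (trans (sym eq₁) (ch (corner 4F)))
        good-e = good-any {p₂} {h₂} {pe} {he} good₂ geo-e (trans (sym eq₂) (ch-e (corner 4F)))
        q , k , good′ , op = sound-convex u u′ p h {pe} {he} good good-e
            (λ y → trans (sym (ch (act (u ++ u′) y))) (trans (sym (act-++ w (u ++ u′) y)) (ch-e y))) red
    in q , k , good′ , trans (act-++ w u (corner 4F)) (trans (ch (act u (corner 4F))) (op (corner 4F)))

-- The five hypercubes around a square

Apart : ℕ → Point → Set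
Apart zero    x = Vec.replicate 5 1# ≢ x
Apart (suc n) x = ∀ i → Apart n (reflect i x)

Apart? : ∀ n x → Dec (Apart n x)
Apart? zero    x = ¬? (Vec.replicate 5 1# ≟P x)
Apart? (suc n) x = Finₚ.all? λ i → Apart? n (reflect i x)

opaque
  apart : ∀ u x → Apart (length u) x → act u (Vec.replicate 5 1#) ≢ x
  apart []      x ap eq = ap eq
  apart (i ∷ u) x ap eq = apart u (reflect i x) (ap i) (trans (sym (reflect-involutive i _)) (cong (reflect i) eq))

  -- Brute force over all words with fewer than five letters, acting on an interior point of the
  -- characteristic simplex.
  short-apart : ∀ (n : Fin 5) → Apart (toℕ n) (act (4F ∷ 3F ∷ 4F ∷ 3F ∷ 4F ∷ []) (Vec.replicate 5 1#))
  short-apart = toWitness {a? = Finₚ.all? λ n → Apart? (toℕ n)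
      (act (4F ∷ 3F ∷ 4F ∷ 3F ∷ 4F ∷ []) (Vec.replicate 5 1#))} tt

  pentagon-reduced : Reduced (4F ∷ 3F ∷ 4F ∷ 3F ∷ 4F ∷ [])
  pentagon-reduced u eq = ℕₚ.≮⇒≥ λ lt → apart u (act (4F ∷ 3F ∷ 4F ∷ 3F ∷ 4F ∷ []) (Vec.replicate 5 1#))
    (subst (λ n → Apart n (act (4F ∷ 3F ∷ 4F ∷ 3F ∷ 4F ∷ []) (Vec.replicate 5 1#))) (Finₚ.toℕ-fromℕ< lt)
        (short-apart (Fin.fromℕ< lt))) (eq (Vec.replicate 5 1#))

  pentagon-relations :
    act (4F ∷ 3F ∷ 4F ∷ 3F ∷ 4F ∷ 3F ∷ 4F ∷ []) (corner 4F) ≡ act (3F ∷ 4F ∷ []) (corner 4F) ×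
    act (4F ∷ 3F ∷ []) (corner 4F) ≡ act (4F ∷ []) (corner 4F) ×
    act (4F ∷ 3F ∷ 4F ∷ 3F ∷ 4F ∷ []) (corner 4F) ≡ act (3F ∷ 4F ∷ 3F ∷ 4F ∷ []) (corner 4F)
  pentagon-relations = refl , refl , refl

  -- If two non-adjacent hypercubes around a square are in 𝒫, so are all five.
  pentagon : ∀ {p h} → 𝒫 (fwd p (rotate h (act (4F ∷ []) (corner 4F)))) → 𝒫
      (fwd p (rotate h (act (3F ∷ 4F ∷ []) (corner 4F)))) →
    𝒫 (fwd p (rotate h (act (4F ∷ 3F ∷ 4F ∷ []) (corner 4F)))) × 𝒫
        (fwd p (rotate h (act (3F ∷ 4F ∷ 3F ∷ 4F ∷ []) (corner 4F))))
  pentagon {p} {h} P₁ P₂ = convert (4F ∷ []) (3F ∷ 4F ∷ 3F ∷ 4F ∷ []) pentagon-reduced refl refl ,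
    convert (4F ∷ 3F ∷ 4F ∷ []) (3F ∷ 4F ∷ []) pentagon-reduced refl (proj₂ (proj₂ pentagon-relations))
    where
    w : Word
    w = proj₁ (chamber p h)
    ch : ∀ u y → act (w ++ u) y ≡ fwd p (rotate h (act u y))
    ch u y = trans (act-++ w u y) (proj₂ (chamber p h) (act u y))
    -- The final s₃ stays in the hypercube but selects the chamber opposite to a chamber of the
    -- second one. As s₄ s₃ s₄ s₃ s₄ is the longest element of a dihedral group of order 10, the
    -- long way round the square is then a minimal gallery too.
    v : Word
    v = w ++ 4F ∷ 3F ∷ []
    chv : ∀ u → act (v ++ u) (corner 4F) ≡ fwd p (rotate h (act (4F ∷ 3F ∷ u) (corner 4F)))
    chv u = trans (cong (λ w → act w (corner 4F)) (Listₚ.++-assoc w (4F ∷ 3F ∷ []) u)) (ch (4F ∷ 3F ∷ u) (corner 4F))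
    start : 𝒫 (act v (corner 4F))
    start = subst 𝒫 (sym (trans (ch (4F ∷ 3F ∷ []) (corner 4F))
        (cong (λ y → fwd p (rotate h y)) (proj₁ (proj₂ pentagon-relations))))) P₁
    end : 𝒫 (act (v ++ 4F ∷ 3F ∷ 4F ∷ 3F ∷ 4F ∷ []) (corner 4F))
    end = subst 𝒫 (sym (trans (chv (4F ∷ 3F ∷ 4F ∷ 3F ∷ 4F ∷ []))
        (cong (λ y → fwd p (rotate h y)) (proj₁ pentagon-relations)))) P₂
    convert : ∀ u u′ {y} → Reduced (u ++ u′) → u ++ u′ ≡ 4F ∷ 3F ∷ 4F ∷ 3F ∷ 4F ∷ [] → act (4F ∷ 3F ∷ u)
        (corner 4F) ≡ y → 𝒫 (fwd p (rotate h y))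
    convert u u′ red eq e = subst 𝒫 (trans (chv u) (cong (λ y → fwd p (rotate h y)) e))
      (convex v u u′ red start (subst (λ u → 𝒫 (act (v ++ u) (corner 4F))) (sym eq) end))

-- Every candidate belongs to 𝒫

Full : List Γ → List Γ → Set
Full p L = ∀ h → All (_∈ frame h) L → 𝒫 (hypercube p h)

opaque
  unfolding wall perm Adj?

  square-cubes : ∀ c → Adj t₁ c × Adj t₂ c → ∀ d → Adj c d × Adj t₁ d × Adj t₂ d →
    Any (λ u → cube (t₁ ∷ t₂ ∷ c ∷ d ∷ []) ≡ act u (corner 4F))
      ([] ∷ (4F ∷ []) ∷ (3F ∷ 4F ∷ []) ∷ (4F ∷ 3F ∷ 4F ∷ []) ∷ (3F ∷ 4F ∷ 3F ∷ 4F ∷ []) ∷ [])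
  square-cubes = toWitness {a? = Finₚ.all? λ c → (Adj? t₁ c ×-dec Adj? t₂ c) →-dec Finₚ.all? λ d →
      (Adj? c d ×-dec Adj? t₁ d ×-dec Adj? t₂ d) →-dec
    Any.any? (λ u → cube (t₁ ∷ t₂ ∷ c ∷ d ∷ []) ≟P act u (corner 4F)) _} tt

opaque
  unique-⊆-↭ : {X : Set} {xs ys : List X} → Unique xs → All (_∈ ys) xs → ∃[ zs ] ys ↭ xs ++ zs
  unique-⊆-↭ {ys = ys} [] [] = ys , refl
  unique-⊆-↭ {xs = x ∷ xs} (x∉ ∷ u) (x∈ ∷ sub) with ∈ₚ.∈-∃++ x∈
  ... | as , bs , refl with unique-⊆-↭ u (All.zipWith rest (sub , x∉))
    where
    rest : ∀ {y} → y ∈ as ++ x ∷ bs × x ≢ y → y ∈ as ++ bs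
    rest (y∈ , x≢y) with ↭ₚ.∈-resp-↭ (↭ₚ.shift x as bs) y∈
    ... | here eq   = contradiction (sym eq) x≢y
    ... | there y∈′ = y∈′
  ... | zs , e = zs , ↭-trans (↭ₚ.shift x as bs) (prep x e)

  clique-↭ : ∀ {L M} → L ↭ M → Clique L → Clique M
  clique-↭ refl         c = c
  clique-↭ (prep x e)   (a ∷ c) = ↭ₚ.All-resp-↭ e a ∷ clique-↭ e c
  clique-↭ (swap x y e) ((xy ∷ xs) ∷ ys ∷ c) = (Adj-sym xy ∷ ↭ₚ.All-resp-↭ e ys) ∷ ↭ₚ.All-resp-↭ e xs ∷ clique-↭ e c
  clique-↭ (_↭_.trans e f) c = clique-↭ f (clique-↭ e c)

  clique-unique : ∀ {L} → Clique L → Unique L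
  clique-unique = AllPairs.map λ { a refl → Adj-irrefl a }

  clique-⊆-↭ : ∀ {L} h → Clique L → All (_∈ frame h) L → length L ≡ 4 → frame h ↭ L
  clique-⊆-↭ {L} h c sub le with unique-⊆-↭ (clique-unique c) sub
  ... | [] , e = subst (frame h ↭_) (Listₚ.++-identityʳ L) e
  ... | z ∷ zs , e = contradiction (trans (↭ₚ.↭-length e)
      (trans (Listₚ.length-++ L) (cong (ℕ._+ suc (length zs)) le))) λ ()

  frame-cube : ∀ {L} h → Clique L → All (_∈ frame h) L → length L ≡ 4 → rotate h (corner 4F) ≡ cube L
  frame-cube h c sub le = trans (rotate-cube h) (cube-↭ (clique-⊆-↭ h c sub le))

  frame-of : ∀ M → Clique M → length M ≡ 4 → ∃[ h ] frame h ≡ M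
  frame-of M c le = let h , eq = complete-frame M c in h , sym (trans eq (cong (λ n → map (permute h) (take n tetrahedron)) le))

  clique-length : ∀ {L} → Clique L → length L ≤ 4
  clique-length {L} c = let h , eq = complete-frame L c in
    subst (_≤ 4) (sym (trans (cong length eq) (trans
        (Listₚ.length-map (permute h) (take (length L) tetrahedron))
        (Listₚ.length-take (length L) tetrahedron)))) (ℕₚ.m⊓n≤n (length L) 4)

  in-frame : ∀ {h M} → frame h ≡ M → ∀ {L} → All (_∈ M) L → All (_∈ frame h) L
  in-frame refl all = all

  rotate-relative : ∀ h k y → rotate h y ≡ rotate k (rotate (reverse k ++ h) y)
  rotate-relative h k y = trans (sym (rotate-undo′ k (rotate h y))) (cong (rotate k) (sym (rotate-++ (reverse k) h y)))

  frame-relative : ∀ h k {g} → permute k g ∈ frame h → g ∈ frame (reverse k ++ h)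
  frame-relative h k {g} g∈ with ∈ₚ.∈-map⁻ (permute h) g∈
  ... | t , t∈ , eq = subst (_∈ frame (reverse k ++ h))
      (trans (permute-++ (reverse k) h t) (trans (cong (permute (reverse k)) (sym eq)) (permute-undo k g)))
    (∈ₚ.∈-map⁺ (permute (reverse k ++ h)) t∈)

  frame-last : ∀ h → frame (h ∷ʳ 3F) ≡ permute h t₁ ∷ permute h t₂ ∷ permute h t₃ ∷ permute h t₄′ ∷ []
  frame-last h = trans (frame-∷ʳ h 3F) (cong (map (permute h)) (perm-tetrahedron 3F))

  -- Each hypothesis gives two of the five hypercubes around the square s s′, with one in common.
  -- The other two are not adjacent, so `pentagon` supplies the rest.
  spread₂ : ∀ {p s s′ a b} → Clique (s ∷ s′ ∷ a ∷ b ∷ []) → Full p (a ∷ s ∷ s′ ∷ []) → Full p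
      (b ∷ s ∷ s′ ∷ []) → Full p (s ∷ s′ ∷ [])
  spread₂ {p} {s} {s′} {a} {b} c Fa Fb h (s∈ ∷ s′∈ ∷ []) with frame-of (s ∷ s′ ∷ a ∷ b ∷ []) c refl
  ... | k , refl with unique-⊆-↭ {xs = t₁ ∷ t₂ ∷ []} {ys = frame (reverse k ++ h)} (((λ ()) ∷ []) ∷ [] ∷ [])
      (frame-relative h k s∈ ∷ frame-relative h k s′∈ ∷ [])
  ... | zs , e = go zs e (↭ₚ.↭-length e)
    where
    P₁ : 𝒫 (fwd p (rotate k (act (4F ∷ []) (corner 4F))))
    P₁ = subst (𝒫 ∘ fwd p) (rotate-++ k (3F ∷ []) (corner 4F))
      (Fa (k ∷ʳ 3F) (in-frame {k ∷ʳ 3F} (frame-last k)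
          (there (there (here refl)) ∷ here refl ∷ there (here refl) ∷ [])))
    frame-34 : frame (k ++ 2F ∷ 3F ∷ []) ≡ permute (k ∷ʳ 2F) t₁ ∷ permute (k ∷ʳ 2F) t₂ ∷ permute (k ∷ʳ 2F)
        t₃ ∷ permute (k ∷ʳ 2F) t₄′ ∷ []
    frame-34 = trans (cong frame (sym (Listₚ.++-assoc k (2F ∷ []) (3F ∷ [])))) (frame-last (k ∷ʳ 2F))
    frame-3 : frame (k ∷ʳ 2F) ≡ permute k t₁ ∷ permute k t₂ ∷ permute k t₄ ∷ permute k t₃ ∷ []
    frame-3 = trans (frame-∷ʳ k 2F) (cong (map (permute k)) (perm-tetrahedron 2F))
    P₂ : 𝒫 (fwd p (rotate k (act (3F ∷ 4F ∷ []) (corner 4F))))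
    P₂ = subst (𝒫 ∘ fwd p) (rotate-++ k (2F ∷ 3F ∷ []) (corner 4F))
      (Fb (k ++ 2F ∷ 3F ∷ []) (in-frame {k ++ 2F ∷ 3F ∷ []} frame-34
        (there (there (here (sym (Listₚ.∷-injectiveˡ (Listₚ.∷-injectiveʳ (Listₚ.∷-injectiveʳ frame-3)))))) ∷
            here (sym (Listₚ.∷-injectiveˡ frame-3))
          ∷ there (here (sym (Listₚ.∷-injectiveˡ (Listₚ.∷-injectiveʳ frame-3)))) ∷ [])))
    five : All (λ u → 𝒫 (fwd p (rotate k (act u (corner 4F)))))
        ([] ∷ (4F ∷ []) ∷ (3F ∷ 4F ∷ []) ∷ (4F ∷ 3F ∷ 4F ∷ []) ∷ (3F ∷ 4F ∷ 3F ∷ 4F ∷ []) ∷ [])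
    five = Fa k (there (there (here refl)) ∷ here refl ∷ there (here refl) ∷ []) ∷ P₁ ∷ P₂ ∷ proj₁
        (pentagon {p} {k} P₁ P₂) ∷ proj₂ (pentagon {p} {k} P₁ P₂) ∷ []
    go : ∀ zs → frame (reverse k ++ h) ↭ t₁ ∷ t₂ ∷ zs → 4 ≡ suc (suc (length zs)) → 𝒫 (hypercube p h)
    go (c ∷ d ∷ []) e _ with clique-↭ e (frame-clique (reverse k ++ h))
    ... | (_ ∷ 1c ∷ 1d ∷ []) ∷ (2c ∷ 2d ∷ []) ∷ (cd ∷ []) ∷ _ =
      subst (𝒫 ∘ fwd p) (sym (trans (rotate-relative h k (corner 4F))
          (cong (rotate k) (trans (rotate-cube (reverse k ++ h)) (cube-↭ e)))))
        (case All.lookupAny five (square-cubes c (1c , 2c) d (cd , 1d , 2d)) of λ (P , eq) → subst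
            (λ y → 𝒫 (fwd p (rotate k y))) (sym eq) P)

  -- A walk through the tetrahedra around s. When one vertex is replaced, `spread₂` derives the
  -- property of the new vertex from the two that are kept; every neighbour of s is reached since
  -- the stabiliser of s is transitive on them.
  spread₁ : ∀ {p s a b} → Clique (s ∷ a ∷ b ∷ []) → Full p (a ∷ s ∷ []) → Full p (b ∷ s ∷ []) → Full p (s ∷ [])
  spread₁ {p} {s} {a} {b} c Fa Fb h (s∈ ∷ []) with complete-frame (s ∷ a ∷ b ∷ []) c
  ... | k , refl = go (other-vertex h s∈)
    where
    P : Γ → Set
    P g = Full p (g ∷ s ∷ [])
    common : ∀ {x y z} → Clique (s ∷ x ∷ y ∷ z ∷ []) → P x → P y → P z
    common ((sx ∷ sy ∷ sz ∷ []) ∷ (xy ∷ xz ∷ []) ∷ (yz ∷ []) ∷ _) Px Py =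
      spread₂ {p} ((Adj-sym sz ∷ Adj-sym xz ∷ Adj-sym yz ∷ []) ∷ (sx ∷ sy ∷ []) ∷ (xy ∷ []) ∷ [] ∷ [])
        (λ { h (x∈ ∷ z∈ ∷ s∈ ∷ []) → Px h (x∈ ∷ s∈ ∷ []) }) (λ { h (y∈ ∷ z∈ ∷ s∈ ∷ []) → Py h (y∈ ∷ s∈ ∷ []) })
    Invariant : List Γ → Set
    Invariant []      = ⊥
    Invariant (x ∷ L) = x ≡ s × All P L
    start : Invariant (frame k)
    start = refl , Fa ∷ Fb ∷ common (frame-clique k) Fa Fb ∷ []
    step : ∀ r i → perm i t₁ ≡ t₁ → Invariant (frame r) → Invariant (frame (r ∷ʳ i))
    step r i fix (e , Px ∷ Py ∷ Pz ∷ []) = subst Invariant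
        (sym (trans (frame-∷ʳ r i) (cong (map (permute r)) (perm-tetrahedron i)))) (next i fix)
      where
      next : ∀ i → perm i t₁ ≡ t₁ → Invariant (map (permute r) (adjacent-flag i))
      next 0F fix = contradiction (trans (sym fix) (Listₚ.∷-injectiveˡ (perm-tetrahedron 0F))) λ ()
      next 1F _ = e , Py ∷ Px ∷ Pz ∷ []
      next 2F _ = e , Px ∷ Pz ∷ Py ∷ []
      next 3F _ = e , Px ∷ Py ∷ common (subst (λ s → Clique
          (s ∷ permute r t₂ ∷ permute r t₃ ∷ permute r t₄′ ∷ [])) e
          (subst Clique (frame-last r) (frame-clique (r ∷ʳ 3F)))) Px Py ∷ []
    steps : ∀ u r → Fixing (t₁ ∷ []) u → Invariant (frame r) → Invariant (frame (r ++ u))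
    steps []      r _ inv = subst (Invariant ∘ frame) (sym (Listₚ.++-identityʳ r)) inv
    steps (i ∷ u) r ((f ∷ []) ∷ fs) inv = subst (Invariant ∘ frame) (Listₚ.++-assoc r (i ∷ []) u)
        (steps u (r ∷ʳ i) fs (step r i f inv))
    go : ∃[ g ] g ∈ frame h × Adj s g → 𝒫 (hypercube p h)
    go (g , g∈ , sg) with link-transitive (permute (reverse k) g)
        (subst (λ t → Adj t (permute (reverse k) g)) (permute-undo k t₁) (Adj-permute (reverse k) sg) ∷ [])
    ... | u , fix , eq with steps u k fix start
    ... | _ , Px ∷ _ = subst P (trans (permute-++ k u t₂) (trans (cong (permute k) eq) (permute-undo′ k g)))
        Px h (g∈ ∷ s∈ ∷ [])

  -- The same walk through all tetrahedra of the 600-cell, with `spread₁` at each replacement.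
  spread₀ : ∀ {p a b} → Clique (a ∷ b ∷ []) → Full p (a ∷ []) → Full p (b ∷ []) → Full p []
  spread₀ {p} {a} {b} c Fa Fb h [] with complete-frame (a ∷ b ∷ []) c
  ... | k , refl = go (transitive₁ (permute (reverse k) (permute h t₁)))
    where
    P : Γ → Set
    P g = Full p (g ∷ [])
    common : ∀ {x y z} → Adj x y → Adj x z → Adj y z → P x → P y → P z
    common xy xz yz Px Py = spread₁ {p} ((Adj-sym xz ∷ Adj-sym yz ∷ []) ∷ (xy ∷ []) ∷ [] ∷ [])
      (λ { h (x∈ ∷ z∈ ∷ []) → Px h (x∈ ∷ []) }) (λ { h (y∈ ∷ z∈ ∷ []) → Py h (y∈ ∷ []) })
    start : All P (frame k)
    start = case frame-clique k of λ where
      ((ab ∷ ac ∷ ad ∷ []) ∷ (bc ∷ bd ∷ []) ∷ _) → Fa ∷ Fb ∷ common ab ac bc Fa Fb ∷ common ab ad bd Fa Fb ∷ []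
    step : ∀ r i → All P (frame r) → All P (frame (r ∷ʳ i))
    step r i (Px ∷ Py ∷ Pz ∷ Pw ∷ []) = subst (All P)
        (sym (trans (frame-∷ʳ r i) (cong (map (permute r)) (perm-tetrahedron i)))) (next i)
      where
      next : ∀ i → All P (map (permute r) (adjacent-flag i))
      next 0F = Py ∷ Px ∷ Pz ∷ Pw ∷ []
      next 1F = Px ∷ Pz ∷ Py ∷ Pw ∷ []
      next 2F = Px ∷ Py ∷ Pw ∷ Pz ∷ []
      next 3F = case subst Clique (frame-last r) (frame-clique (r ∷ʳ 3F)) of λ where
        ((xy ∷ xz ∷ xw ∷ []) ∷ (yz ∷ yw ∷ []) ∷ _) → Px ∷ Py ∷ Pz ∷ common xy xw yw Px Py ∷ []
    steps : ∀ u r → All P (frame r) → All P (frame (r ++ u))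
    steps []      r all = subst (All P ∘ frame) (sym (Listₚ.++-identityʳ r)) all
    steps (i ∷ u) r all = subst (All P ∘ frame) (Listₚ.++-assoc r (i ∷ []) u) (steps u (r ∷ʳ i) (step r i all))
    go : ∃[ u ] permute u t₁ ≡ permute (reverse k) (permute h t₁) → 𝒫 (hypercube p h)
    go (u , eq) = subst P (trans (permute-++ k u t₁)
        (trans (cong (permute k) eq) (permute-undo′ k (permute h t₁)))) (All.head (steps u k start)) h
        (here refl ∷ [])

  Desc-clique : ∀ {k n} → All (λ g → g ≡ k ⊎ Adj g k) n → k ∈ n → Desc k n
  Desc-clique (_ ∷ all)         (here eq)  = here eq
  Desc-clique (inj₁ refl ∷ all) (there k∈) = here refl
  Desc-clique (inj₂ a ∷ all)    (there k∈) = there a (Desc-clique all k∈)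

  -- Otherwise the two vertices differ by a nonempty reduced word in the walls of the hypercube. Its
  -- last letter g reverses the sign of the wall of g, but this sign is negative for both.
  same-top : ∀ {q r h k} → Geo q → Geo r → hypercube q h ≡ hypercube r k →
    All (λ g → Desc g q) (frame h) → All (λ g → Desc g r) (frame h) → fwd q V₀ ≡ fwd r V₀
  same-top {q} {r} {h} {k} gq gr eq dq dr with same-point q r (rotate-Inside h 4F) (rotate-Inside k 4F) eq
  ... | [] , _ , _ , _ , op = sym (op V₀)
  ... | g ∷ n , (¬d ∷ geo) , _ , zero-walls , op = ⊥-elim
      (Pos-absurd (Desc⇒Neg gr (All.lookup dr g∈)) (Pos-weaken
      (subst (λ z → Pos 1 (⊝ z)) flip (Desc⇒Neg gq (All.lookup dq g∈)))))
    where
    letters : All (_∈ frame h) (g ∷ n)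
    letters = All.map (rotate-zero h 4F _) zero-walls
    g∈ : g ∈ frame h
    g∈ = All.head letters
    or-adj : All (λ x → x ≡ g ⊎ Adj x g) n
    or-adj = All.map (λ x∈ → clique-∈ (frame-clique h) x∈ g∈) (All.tail letters)
    adj : All (λ x → Adj x g) n
    adj = All.tabulate λ x∈ → case All.lookup or-adj x∈ of λ where
      (inj₁ refl) → contradiction (Desc-clique or-adj x∈) ¬d
      (inj₂ a)    → a
    back-q : back q V₀ ≡ back (g ∷ n) (back r V₀)
    back-q = trans (cong (back q) (sym (trans (sym (op (back r V₀))) (fwd-back r V₀))))
        (back-fwd q (back (g ∷ n) (back r V₀)))
    flip : wall g (back q V₀) ≡ ⊝ wall g (back r V₀)
    flip = trans (cong (wall g) back-q) (trans (wall-mirror-self g (back n (back r V₀)))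
        (cong ⊝_ (letters-wall adj (back r V₀))))

  -- Appending the edges that are not yet descents leads to the top of the hypercube without
  -- lowering the value, so the top can be compared with every vertex.
  climb : ∀ {M p} → Clique M → Geo p → ∀ L → (∀ {k} → k ∈ L → k ∈ M) →
    ∃[ n ] Geo (n ++ p) × All (λ k → k ∈ M × ¬ Desc k p) n × value p ≤ value (n ++ p)
      × All (λ k → Desc k (n ++ p)) L × (∀ {k} → k ∈ M → Desc k p → Desc k (n ++ p))
  climb c geo [] sub = [] , geo , [] , ℕₚ.≤-refl , [] , λ _ d → d
  climb {M} {p} c geo (k ∷ L) sub with Desc? k p
  ... | yes d with climb c geo L (sub ∘ there)
  ... | n , geo′ , new , le , top , keep = n , geo′ , new , le , keep (sub (here refl)) d ∷ top , keep
  climb {M} {p} c geo (k ∷ L) sub | no ¬d with climb c (¬d ∷ geo) L (sub ∘ there)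
  ... | n , geo′ , new , le , top , keep = n ∷ʳ k
    , subst Geo assoc geo′
    , Allₚ.++⁺ (All.map (λ (g∈ , ¬dg) → g∈ , λ dg → ¬dg (lift g∈ dg)) new) ((sub (here refl) , ¬d) ∷ [])
    , ℕₚ.≤-trans (value-≤ geo ¬d) (subst (λ q → value (k ∷ p) ≤ value q) assoc le)
    , subst (Desc k) assoc (keep (sub (here refl)) (here refl)) ∷ subst (λ q → All (λ g → Desc g q) L) assoc top
    , λ g∈ dg → subst (Desc _) assoc (keep g∈ (lift g∈ dg))
    where
    assoc : n ++ k ∷ p ≡ (n ∷ʳ k) ++ p
    assoc = sym (Listₚ.++-assoc n (k ∷ []) p)
    lift : ∀ {g} → g ∈ M → Desc g p → Desc g (k ∷ p)
    lift g∈ dg with clique-∈ c (sub (here refl)) g∈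
    ... | inj₁ refl = here refl
    ... | inj₂ a    = there a dg

  fwd-++ : ∀ n p y → fwd (n ++ p) y ≡ fwd p (fwd n y)
  fwd-++ []      p y = refl
  fwd-++ (g ∷ n) p y = fwd-++ n p (mirror g y)

  fwd-fixed : ∀ {n} h → All (_∈ frame h) n → hypercube n h ≡ rotate h (corner 4F)
  fwd-fixed h [] = refl
  fwd-fixed {g ∷ n} h (g∈ ∷ all) = trans (cong (fwd n) (mirror-fix g _ (rotate-flag h 4F g∈))) (fwd-fixed h all)

  vertex-of : ∀ q h {c} → hypercube q h ≡ c → fwd q V₀ IsVertexOf c
  vertex-of q h eq = subst₂ _IsVertexOf_ (cong (fwd q) (rotate-V₀ h)) eq (incident q h 0F 4F)

  -- The converse of `largest-frame`: every vertex climbs to a top, and `same-top` makes the top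
  -- unique.
  top-largest : ∀ {q h c} → Geo q → hypercube q h ≡ c → All (λ g → Desc g q) (frame h) → LargestVertex c (fwd q V₀)
  top-largest {q} {h} {c} geo eqc top = vertex-of q h eqc , value q , value-count geo , largest
    where
    largest : ∀ y m → y IsVertexOf c → Value y m → m ≤ value q
    largest y m y-c vm with incident⁻ 0F 4F y-c
    ... | r , k , geo-r , eqy , eqc′ with climb (frame-clique k) geo-r (frame k) id
    ... | n , geo′ , new , le , top′ , _ = subst₂ _≤_
        (count-unique (value-count geo-r) (subst (λ y → Value y m) (trans eqy (cong (fwd r) (rotate-V₀ k))) vm))
        (count-unique (value-count geo′) (subst (λ y → Value y (value q)) same (value-count geo))) le
      where
      eq′ : hypercube q h ≡ hypercube (n ++ r) k
      eq′ = trans eqc (trans eqc′ (sym (trans (fwd-++ n r _) (cong (fwd r) (fwd-fixed k (All.map proj₁ new))))))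
      rot : rotate h (corner 4F) ≡ rotate k (corner 4F)
      rot = proj₁ (proj₂ (proj₂ (same-point q (n ++ r) (rotate-Inside h 4F) (rotate-Inside k 4F) eq′)))
      same : fwd q V₀ ≡ fwd (n ++ r) V₀
      same = same-top {q} {n ++ r} {h} {k} geo geo′ eq′ top
          (All.tabulate λ g∈ → All.lookup top′ (frame-⊆ {h} {k} rot g∈))

opaque
  unfolding wall perm Adj?

  tetrahedron-extend : ∀ (m : Fin 4) → Clique (List.lookup tetrahedron m ∷ take (toℕ m) tetrahedron)
  tetrahedron-extend = toWitness {a? = Finₚ.all? λ m → AllPairs.allPairs? Adj?
      (List.lookup tetrahedron m ∷ take (toℕ m) tetrahedron)} tt

opaque
  extend : ∀ L → Clique L → length L < 4 → ∃[ a ] Clique (a ∷ L)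
  extend L c lt with complete-frame L c
  ... | h , eq = permute h (List.lookup tetrahedron m) , subst
      (λ L → Clique (permute h (List.lookup tetrahedron m) ∷ L))
      (trans (cong (λ n → map (permute h) (take n tetrahedron)) (Finₚ.toℕ-fromℕ< lt)) (sym eq))
          (Clique-permute h (tetrahedron-extend m))
    where
    m : Fin 4
    m = Fin.fromℕ< lt

  Full-⊆ : ∀ {p L M} → All (_∈ M) L → Full p L → Full p M
  Full-⊆ sub full h all = full h (All.map (λ x∈ → All.lookup all x∈) sub)

  -- As d is a descent already, the climb to the top of the hypercube spanned by d, a, b, c uses
  -- only a, b, c. The top is therefore a vertex of both hypercubes on the cube a b c, and `around`
  -- puts them into 𝒫.
  fill₃ : ∀ {p d a b c} → Geo p → Desc d p → Clique (d ∷ a ∷ b ∷ c ∷ []) → Full p (d ∷ a ∷ b ∷ c ∷ []) →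
      Full p (a ∷ b ∷ c ∷ [])
  fill₃ {p} {d} {a} {b} {c} geo dd cl full h sub with frame-of (d ∷ a ∷ b ∷ c ∷ []) cl refl
  ... | k , eq with climb (frame-clique k) geo (frame k) id
  ... | n , geo′ , new , _ , top , _ = around {c = hypercube p k}
      (full k (All.tabulate λ {x} x∈ → subst (x ∈_) (sym eq) x∈))
      (top-largest {n ++ p} {k} geo′ (trans (fwd-++ n p _) (cong (fwd p) (fwd-fixed k (All.map proj₁ new)))) top)
      (vertex-of (n ++ p) h (trans (fwd-++ n p _) (cong (fwd p) (fwd-fixed h (All.map keep new)))))
    where
    keep : ∀ {x} → x ∈ frame k × ¬ Desc x p → x ∈ frame h
    keep {x} (x∈ , ¬dx) = case subst (x ∈_) eq x∈ of λ where
      (here refl) → contradiction dd ¬dx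
      (there x∈′) → All.lookup sub x∈′

  -- For a further edge x, `fill₃` surrounds the cube x a b. Together with the cube d a b this is
  -- what `spread₂` needs; the two lemmas below repeat this for smaller faces.
  fill₂ : ∀ {p d a b} → Geo p → Desc d p → Clique (d ∷ a ∷ b ∷ []) → Full p (d ∷ a ∷ b ∷ []) → Full p (a ∷ b ∷ [])
  fill₂ {p} {d} {a} {b} geo dd cl full = case extend (d ∷ a ∷ b ∷ []) cl (s≤s (s≤s (s≤s (s≤s z≤n)))) of λ where
    (x , (xd ∷ xa ∷ xb ∷ []) ∷ (da ∷ db ∷ []) ∷ (ab ∷ []) ∷ _) → spread₂ {p} {a} {b} {x} {d}
      ((ab ∷ Adj-sym xa ∷ Adj-sym da ∷ []) ∷ (Adj-sym xb ∷ Adj-sym db ∷ []) ∷ (xd ∷ []) ∷ [] ∷ [])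
      (fill₃ {p} {d} geo dd ((Adj-sym xd ∷ da ∷ db ∷ []) ∷ (xa ∷ xb ∷ []) ∷ (ab ∷ []) ∷ [] ∷ [])
        (Full-⊆ {p} (here refl ∷ there (there (here refl)) ∷ there (there (there (here refl))) ∷ []) full))
      full

  fill₁ : ∀ {p d a} → Geo p → Desc d p → Clique (d ∷ a ∷ []) → Full p (d ∷ a ∷ []) → Full p (a ∷ [])
  fill₁ {p} {d} {a} geo dd cl full = case extend (d ∷ a ∷ []) cl (s≤s (s≤s (s≤s z≤n))) of λ where
    (x , (xd ∷ xa ∷ []) ∷ (da ∷ []) ∷ _) → spread₁ {p} {a} {x} {d}
      ((Adj-sym xa ∷ Adj-sym da ∷ []) ∷ (xd ∷ []) ∷ [] ∷ [])
      (fill₂ {p} {d} geo dd ((Adj-sym xd ∷ da ∷ []) ∷ (xa ∷ []) ∷ [] ∷ [])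
        (Full-⊆ {p} (here refl ∷ there (there (here refl)) ∷ []) full))
      full

  fill₀ : ∀ {p d} → Geo p → Desc d p → Full p (d ∷ []) → Full p []
  fill₀ {p} {d} geo dd full = case extend (d ∷ []) ([] ∷ []) (s≤s (s≤s z≤n)) of λ where
    (x , (xd ∷ []) ∷ _) → spread₀ {p} {x} {d} ((xd ∷ []) ∷ [] ∷ [])
      (fill₁ {p} {d} geo dd ((Adj-sym xd ∷ []) ∷ [] ∷ []) (Full-⊆ {p} (here refl ∷ []) full))
      full

  fill : ∀ {p d L} → Geo p → Desc d p → Clique (d ∷ L) → Full p (d ∷ L) → Full p L
  fill {p} {L = []}                geo dd cl full = fill₀ {p} geo dd full
  fill {p} {L = _ ∷ []}            geo dd cl full = fill₁ {p} geo dd cl full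
  fill {p} {L = _ ∷ _ ∷ []}        geo dd cl full = fill₂ {p} geo dd cl full
  fill {p} {L = _ ∷ _ ∷ _ ∷ []}    geo dd cl full = fill₃ {p} geo dd cl full
  fill {p} {L = _ ∷ _ ∷ _ ∷ _ ∷ _} geo dd cl full = contradiction (clique-length cl) λ { (s≤s (s≤s (s≤s (s≤s ())))) }

  axes-clique : ∀ p → Clique (axes p)
  axes-clique []      = tetrahedron-clique
  axes-clique (g ∷ p) = AllPairsₚ.filter⁺ (Adj? g) (axes-clique p)

  head-axes-clique : ∀ g p → Clique (g ∷ axes (g ∷ p))
  head-axes-clique g p = All.tabulate (λ t∈ → proj₂ (∈ₚ.∈-filter⁻ (Adj? g) {xs = axes p} t∈)) ∷ axes-clique (g ∷ p)

  -- A hypercube containing the last edge g is also a hypercube at the previous vertex, where the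
  -- induction hypothesis applies. Then `fill` drops g, which is a descent.
  complete : ∀ {p} → Geo p → Allowed p → Full p (axes p)
  complete [] [] h sub = subst 𝒫 (trans cube-tetrahedron (sym (frame-cube h tetrahedron-clique sub refl))) base
  complete {g ∷ p} (¬d ∷ geo) (s ∷ al) = fill {g ∷ p} {g} {axes (g ∷ p)} (¬d ∷ geo) (here refl)
      (head-axes-clique g p) known
    where
    known : Full (g ∷ p) (g ∷ axes (g ∷ p))
    known h (g∈ ∷ sub) = subst 𝒫 (cong (fwd p) (sym (mirror-fix g _ (rotate-flag h 4F g∈))))
      (complete geo al h (All.tabulate λ t∈ → case All.lookup s t∈ of λ where
        (inj₁ refl) → g∈
        (inj₂ a)    → All.lookup sub (∈ₚ.∈-filter⁺ (Adj? g) t∈ a)))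

  cube-in-𝒫 : ∀ {p h} → Good p h → 𝒫 (hypercube p h)
  cube-in-𝒫 {p} {h} (geo , al , ax) = complete geo al h ax

-- Edges, levels and degrees in 𝒫

opaque
  take-⊆ : ∀ {g : Γ} n {L} → g ∈ take n L → g ∈ L
  take-⊆ n {L} g∈ = subst (_ ∈_) (Listₚ.take++drop≡id n L) (∈ₚ.∈-++⁺ˡ g∈)

  ~𝒫-~ : ∀ {x y} → x ~𝒫 y → x ~ y
  ~𝒫-~ (x≢y , e , x-e , y-e , _) = x≢y , e , x-e , y-e

  ~𝒫-sym : ∀ {x y} → x ~𝒫 y → y ~𝒫 x
  ~𝒫-sym (x≢y , e , x-e , y-e , c) = x≢y ∘ sym , e , y-e , x-e , c

  star-frame : ∀ {g p} → Star g (axes p) → ∃[ h ] permute h t₁ ≡ g × All (_∈ frame h) (axes p)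
  star-frame {g} {p} s with complete-frame (g ∷ axes (g ∷ p)) (head-axes-clique g p)
  ... | h , eq = h , sym (Listₚ.∷-injectiveˡ eq) , All.map
      (λ { (inj₁ refl) → here (Listₚ.∷-injectiveˡ eq) ; (inj₂ a) → a })
      (All.tabulate λ {t} t∈ → case All.lookup s t∈ of λ where
        (inj₁ e) → inj₁ e
        (inj₂ a) → inj₂ (in-take (subst (t ∈_) eq (there (∈ₚ.∈-filter⁺ (Adj? g) t∈ a)))))
    where
    in-take : ∀ {t n} → t ∈ map (permute h) (take n tetrahedron) → t ∈ frame h
    in-take {t} {n} t∈ with ∈ₚ.∈-map⁻ (permute h) t∈
    ... | s , s∈ , refl = ∈ₚ.∈-map⁺ (permute h) (take-⊆ n s∈)

  ~𝒫⁺ : ∀ {g p} → Geo p → Allowed p → Star g (axes p) → fwd p V₀ ~𝒫 fwd (g ∷ p) V₀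
  ~𝒫⁺ {g} {p} geo al s with star-frame {g} {p} s
  ... | h , refl , ax = step-≢ p _ , fwd p (rotate h (corner 1F)) , endpoint p h , endpoint′ p h ,
    hypercube p h , cube-in-𝒫 {p} {h} (geo , al , ax) , incident p h 1F 4F

  face-cubes : ∀ k {p c} h → Geo p → 𝒫 c → Incident k (fwd p (rotate h (corner k))) 4F c →
    ∃[ h′ ] Good p h′ × rotate h (corner k) ≡ rotate h′ (corner k) × c ≡ hypercube p h′
  face-cubes k {p} {c} h geo Pc inc with faces k 4F p h inc refl | sound Pc
  ... | n , h′ , _ , letters , eqc , eq | q , i , good , eqq = h′ , good-any {q} {i} {p} {h′} good geo
      (trans (sym eqq) c≡) , eqc , c≡
    where
    in-frame′ : ∀ {g} → g ∈ map (permute h) (flag k) → g ∈ frame h′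
    in-frame′ {g} g∈ with ∈ₚ.∈-map⁻ (permute h′) (rotate-zero h′ k g
        (trans (cong (wall g) (sym eqc)) (rotate-flag h k g∈)))
    ... | s , s∈ , refl = ∈ₚ.∈-map⁺ (permute h′) (take-⊆ (toℕ k) s∈)
    back-fixed : ∀ {n} → All (_∈ frame h′) n → back n (rotate h′ (corner 4F)) ≡ rotate h′ (corner 4F)
    back-fixed [] = refl
    back-fixed {g ∷ n} (g∈ ∷ all) = trans (cong (mirror g) (back-fixed all)) (mirror-fix g _ (rotate-flag h′ 4F g∈))
    c≡ : c ≡ hypercube p h′
    c≡ = trans eq (cong (fwd p) (back-fixed (All.map in-frame′ letters)))

  flag-∈ : ∀ {h h′ k g} → rotate h (corner k) ≡ rotate h′ (corner k) → g ∈ map (permute h) (flag k) → g ∈ frame h′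
  flag-∈ {h} {h′} {k} {g} eqc g∈ with ∈ₚ.∈-map⁻ (permute h′)
      (rotate-zero h′ k g (trans (cong (wall g) (sym eqc)) (rotate-flag h k g∈)))
  ... | s , s∈ , refl = ∈ₚ.∈-map⁺ (permute h′) (take-⊆ (toℕ k) s∈)

  ~𝒫⁻ : ∀ {p y} → Geo p → fwd p V₀ ~𝒫 y → ∃[ g ] Allowed p × Star g (axes p) × y ≡ fwd (g ∷ p) V₀
  ~𝒫⁻ {p} geo (x≢y , e , x-e , y-e , c , Pc , e-c) with vertex-faces 1F p x-e
  ... | h , refl with face-cubes 1F h geo Pc e-c
  ... | h′ , (_ , al , ax) , eqc , _ = permute h t₁ , al
      , All.map (clique-∈ (frame-clique h′) (flag-∈ {h} {h′} {1F} eqc (here refl))) ax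
      , opposite p h y-e (x≢y ∘ sym)

  Allowed-step : ∀ {g p} → Geo p → Allowed p → Star g (axes p) → ∃[ q ] Geo q × Allowed q × fwd q V₀ ≡ fwd (g ∷ p) V₀
  Allowed-step {g} {p} geo al s with Desc? g p
  ... | no ¬d = g ∷ p , ¬d ∷ geo , s ∷ al , refl
  ... | yes d with exchange geo d
  ... | q , e , (_ ∷ geo′) with Allowed-≈ e al
  ... | _ ∷ al′ = q , geo′ , al′ , trans (cong (fwd q) (sym (mirror-involutive g V₀))) (sym (fwd-≈ e (mirror g V₀)))

module 𝒫-Graph = Graph _~𝒫_

opaque
  𝒫-path⁺ : ∀ {p} → Geo p → Allowed p → 𝒫-Graph.Path V₀ (trail p) (fwd p V₀)
  𝒫-path⁺ [] [] = Graph.[]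
  𝒫-path⁺ (_ ∷ geo) (s ∷ al) = path-∷ʳ (𝒫-path⁺ geo al) (~𝒫⁺ geo al s)

  𝒫-path⁻ : ∀ {p ps y} → Geo p → Allowed p → 𝒫-Graph.Path (fwd p V₀) ps y → ∃[ q ] Geo q × Allowed q × fwd q V₀ ≡ y
  𝒫-path⁻ {p} geo al Graph.[] = p , geo , al , refl
  𝒫-path⁻ {p} geo al (r Graph.∷ pa) with ~𝒫⁻ geo r
  ... | g , _ , s , refl with Allowed-step geo al s
  ... | q , geo′ , al′ , eq = 𝒫-path⁻ geo′ al′ (subst (λ x → 𝒫-Graph.Path x _ _) (sym eq) pa)

  forget : ∀ {x ps y} → 𝒫-Graph.Path x ps y → Graph.Path _~_ x ps y
  forget Graph.[]       = Graph.[]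
  forget (r Graph.∷ pa) = ~𝒫-~ r Graph.∷ forget pa

  -- A reduced allowed word is a path inside 𝒫, so no distance from V₀ grows when paths are
  -- restricted to 𝒫.
  level⁺ : ∀ {p} → Geo p → Allowed p → Level (length p) (fwd p V₀)
  level⁺ {p} geo al = trail p , (𝒫-path⁺ geo al , λ qs pa → proj₂ (shortest⁺ geo) qs (forget pa)) , trail-length p

  level⁻ : ∀ {n x} → Level n x → ∃[ p ] Geo p × Allowed p × fwd p V₀ ≡ x × length p ≡ n
  level⁻ (ps , (pa , min) , refl) with 𝒫-path⁻ [] [] pa
  ... | p , geo , al , refl = p , geo , al , refl , trans (sym (trail-length p))
    (ℕₚ.≤-antisym (proj₂ (shortest⁺ geo) ps (forget pa)) (min (trail p) (𝒫-path⁺ geo al)))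

  level-unique : ∀ {n p} → Geo p → Level n (fwd p V₀) → n ≡ length p
  level-unique geo lv with level⁻ lv
  ... | q , geo′ , _ , eq , refl = length-≈ (same-≈ geo′ geo eq)

  filter-enumerates : ∀ {P : Γ → Set} (P? : ∀ g → Dec (P g)) → Enumerates P (filter P? generators)
  filter-enumerates P? = Uniqueₚ.filter⁺ P? generators-unique , λ g → mk⇔
    (λ g∈ → proj₂ (∈ₚ.∈-filter⁻ P? {xs = generators} g∈)) (∈ₚ.∈-filter⁺ P? (∈-generators g))

  enumerates-count : {X Y : Set} {P : X → Set} {Q : Y → Set} {xs : List X} (f : X → Y) →
    (∀ {x x′} → f x ≡ f x′ → x ≡ x′) → (∀ {x} → P x → Q (f x)) → (∀ {y} → Q y → ∃[ x ] P x × f x ≡ y) →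
    Enumerates P xs → Count Q (length xs)
  enumerates-count {xs = xs} f inj PQ QP e = map f xs , enumerates-map f inj PQ QP e , Listₚ.length-map f xs

  neighbour-injective : ∀ p {g k} → fwd (g ∷ p) V₀ ≡ fwd (k ∷ p) V₀ → g ≡ k
  neighbour-injective p eq = mirror-V₀-injective (fwd-injective p eq)

  degree : ∀ {p} → Geo p → Allowed p → Degree (fwd p V₀) (length (filter (λ g → Star? g (axes p)) generators))
  degree {p} geo al = enumerates-count (λ g → fwd (g ∷ p) V₀) (neighbour-injective p)
    (~𝒫⁺ geo al) (λ r → case ~𝒫⁻ geo r of λ { (g , _ , s , eq) → g , s , sym eq })
        (filter-enumerates (λ g → Star? g (axes p)))

descents : List Γ → List Γ
descents []      = []
descents (g ∷ p) = g ∷ filter (Adj? g) (descents p)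

opaque
  descents-clique : ∀ p → Clique (descents p)
  descents-clique []      = []
  descents-clique (g ∷ p) = Allₚ.all-filter (Adj? g) (descents p) ∷ AllPairsₚ.filter⁺ (Adj? g) (descents-clique p)

  Desc-descents : ∀ {k p} → Desc k p → k ∈ descents p
  Desc-descents (here eq)   = here eq
  Desc-descents {p = g ∷ p} (there a d) = there (∈ₚ.∈-filter⁺ (Adj? g) (Desc-descents d) a)

  descents-Desc : ∀ {k} p → k ∈ descents p → Desc k p
  descents-Desc (g ∷ p) (here eq)  = here eq
  descents-Desc (g ∷ p) (there k∈) with ∈ₚ.∈-filter⁻ (Adj? g) {xs = descents p} k∈
  ... | k∈′ , a = there a (descents-Desc p k∈′)

  descents-enumerates : ∀ p → Enumerates (λ k → Desc k p) (descents p)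
  descents-enumerates p = clique-unique (descents-clique p) , λ k → mk⇔ (descents-Desc p) Desc-descents

  incoming : ∀ {p} → Geo p → Allowed p → Incoming (fwd p V₀) (length (descents p))
  incoming {p} geo al = enumerates-count (λ g → fwd (g ∷ p) V₀) (neighbour-injective p) from-desc to-desc
      (descents-enumerates p)
    where
    from-desc : ∀ {d} → Desc d p → (fwd (d ∷ p) V₀ ~𝒫 fwd p V₀) ×
        (∃[ n ] Level n (fwd (d ∷ p) V₀) × Level (suc n) (fwd p V₀))
    from-desc {d} dd with exchange geo dd
    ... | q , e , (_ ∷ geo′) with Allowed-≈ e al
    ... | s ∷ al′ = subst₂ _~𝒫_ y≡ (sym (fwd-≈ e V₀)) (~𝒫⁺ geo′ al′ s) , length q , subst (Level (length q))
        y≡ (level⁺ geo′ al′)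
        , subst (λ n → Level n (fwd p V₀)) (length-≈ e) (level⁺ geo al)
      where
      y≡ : fwd q V₀ ≡ fwd (d ∷ p) V₀
      y≡ = trans (cong (fwd q) (sym (mirror-involutive d V₀))) (sym (fwd-≈ e (mirror d V₀)))
    to-desc : ∀ {y} → (y ~𝒫 fwd p V₀) × (∃[ n ] Level n y × Level (suc n) (fwd p V₀)) → ∃[ d ] Desc d p ×
        fwd (d ∷ p) V₀ ≡ y
    to-desc (r , n , lv , lv′) with ~𝒫⁻ geo (~𝒫-sym r)
    ... | g , _ , s , refl with Desc? g p
    ... | yes d = g , d , refl
    ... | no ¬d = contradiction (trans (sym (level-unique geo lv′)) (cong suc (level-unique (¬d ∷ geo) lv)))
        (ℕₚ.<⇒≢ (ℕₚ.m≤n⇒m≤1+n ℕₚ.≤-refl))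

-- Boundary faces of 𝒫

opaque
  unfolding perm

  corner-centre : All (λ k → corner k ≡ centre (flag k)) (1F ∷ 2F ∷ 3F ∷ [])
  corner-centre = refl ∷ refl ∷ refl ∷ []

opaque
  scaled-centre : ∀ k → ∃[ u ] corner (suc k) ≡ scale u (centre (flag (suc k)))
  scaled-centre 0F = 1# , trans (All.lookup corner-centre (here refl)) (sym (scale-1 _))
  scaled-centre 1F = 1# , trans (All.lookup corner-centre (there (here refl))) (sym (scale-1 _))
  scaled-centre 2F = 1# , trans (All.lookup corner-centre (there (there (here refl)))) (sym (scale-1 _))
  scaled-centre 3F = φ⁻¹ , cube-tetrahedron

  same-flag : ∀ k h h′ → map (permute h) (flag k) ≡ map (permute h′) (flag k) → rotate h (corner k) ≡ rotate
      h′ (corner k)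
  same-flag zero    h h′ eq = trans (rotate-V₀ h) (sym (rotate-V₀ h′))
  same-flag (suc k) h h′ eq with scaled-centre k
  ... | u , e = trans (centred h) (trans (cong (scale u ∘ centre) eq) (sym (centred h′)))
    where
    centred : ∀ h → rotate h (corner (suc k)) ≡ scale u (centre (map (permute h) (flag (suc k))))
    centred h = trans (cong (rotate h) e) (trans (rotate-scale h u _) (cong (scale u) (rotate-centre h (flag (suc k)))))

  -- Every hypercube of 𝒫 at the vertex contains the axes. If the k edges of a face and the axes
  -- together make up a frame, they determine the hypercube.
  onFace⁺ : ∀ k {p} → Geo p → Allowed p → 4 ≤ toℕ k + length (axes p) → OnFace k (fwd p V₀)
  onFace⁺ k {p} geo al big with complete-frame (axes p) (axes-clique p)
  -- The frame is reordered with the axes last, so that its first k elements include everything that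
  -- is not an axis.
  ... | i , eqi with frame-of (drop j (frame i) ++ take j (frame i)) swapped-clique swapped-length
    where
    j : ℕ
    j = length (axes p)
    swapped : frame i ↭ drop j (frame i) ++ take j (frame i)
    swapped = subst (_↭ drop j (frame i) ++ take j (frame i)) (Listₚ.take++drop≡id j (frame i))
        (↭ₚ.++-comm (take j (frame i)) (drop j (frame i)))
    swapped-clique : Clique (drop j (frame i) ++ take j (frame i))
    swapped-clique = clique-↭ swapped (frame-clique i)
    swapped-length : length (drop j (frame i) ++ take j (frame i)) ≡ 4
    swapped-length = sym (↭ₚ.↭-length swapped)
  ... | h , eq = fwd p (rotate h (corner k)) , subst (λ x → Incident 0F x k (fwd p (rotate h (corner k))))
      (cong (fwd p) (rotate-V₀ h)) (incident p h 0F k)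
      , hypercube p h , (cube-in-𝒫 {p} {h} (geo , al , ax) , incident p h k 4F) , unique
    where
    j : ℕ
    j = length (axes p)
    axes≡ : axes p ≡ take j (frame i)
    axes≡ = trans eqi (sym (Listₚ.take-map j tetrahedron))
    ax : All (_∈ frame h) (axes p)
    ax = All.tabulate λ {t} t∈ → subst (t ∈_) (sym eq) (∈ₚ.∈-++⁺ʳ (drop j (frame i)) (subst (t ∈_) axes≡ t∈))
    short : length (drop j (frame i)) ≤ toℕ k
    short = subst (_≤ toℕ k) (sym (Listₚ.length-drop j (frame i)))
        (ℕₚ.m≤n+o⇒m∸n≤o 4 j (subst (4 ≤_) (ℕₚ.+-comm (toℕ k) j) big))
    rest-∈ : ∀ {g} → g ∈ drop j (frame i) → g ∈ map (permute h) (flag k)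
    rest-∈ {g} g∈ = subst (g ∈_) (trans (cong (take (toℕ k)) (sym eq)) (Listₚ.take-map (toℕ k) tetrahedron))
        (in-prefix (toℕ k) (drop j (frame i)) short g∈)
      where
      in-prefix : ∀ n L → length L ≤ n → g ∈ L → g ∈ take n (L ++ take j (frame i))
      in-prefix (suc n) (x ∷ L) (s≤s le) (here e)   = here e
      in-prefix (suc n) (x ∷ L) (s≤s le) (there g∈) = there (in-prefix n L le g∈)
    unique : ∀ {c} → 𝒫 c × Incident k (fwd p (rotate h (corner k))) 4F c → hypercube p h ≡ c
    unique (Pc , inc) with face-cubes k h geo Pc inc
    ... | h′ , (_ , _ , ax′) , eqc , refl = cong (fwd p)
        (trans (rotate-cube h) (sym (frame-cube h′ (frame-clique h) all refl)))
      where
      all : All (_∈ frame h′) (frame h)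
      all = All.tabulate λ {g} g∈ → case ∈ₚ.∈-++⁻ (drop j (frame i)) (subst (g ∈_) eq g∈) of λ where
        (inj₁ g∈₁) → flag-∈ {h} {h′} {k} eqc (rest-∈ g∈₁)
        (inj₂ g∈₂) → All.lookup ax′ (subst (g ∈_) (sym axes≡) g∈₂)

  -- Otherwise the edges of the face and the axes form a clique of fewer than four elements. It
  -- extends to two frames, both of whose hypercubes belong to 𝒫 and contain the face.
  onFace⁻ : ∀ k {p} → Geo p → OnFace k (fwd p V₀) → 4 ≤ toℕ k + length (axes p)
  onFace⁻ k {p} geo (f , x-f , c , (Pc , inc) , unique) with vertex-faces k p x-f
  ... | h , refl with face-cubes k h geo Pc inc
  ... | h′ , (_ , al , ax) , eqc , _ = ℕₚ.≮⇒≥ λ small → go (ℕₚ.≤-trans (s≤s length-M) small)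
    where
    L : List Γ
    L = map (permute h′) (flag k)
    outside : ∀ t → Dec (t ∉ L)
    outside t = ¬? (t ∈? L)
    M : List Γ
    M = L ++ filter outside (axes p)
    L⊆ : All (_∈ frame h′) L
    L⊆ = All.tabulate λ g∈ → flag-∈ {h′} {h′} {k} refl g∈
    M-clique : Clique M
    M-clique = AllPairsₚ.++⁺ (Clique-permute h′ (AllPairsₚ.take⁺ (toℕ k) tetrahedron-clique))
        (AllPairsₚ.filter⁺ outside (axes-clique p))
      (All.tabulate λ {x} x∈ → All.tabulate λ {t} t∈ → case clique-∈ (frame-clique h′) (All.lookup L⊆ x∈)
          (All.lookup (Allₚ.filter⁺ outside ax) t∈) of λ where
        (inj₁ refl) → contradiction x∈ (proj₂ (∈ₚ.∈-filter⁻ outside {xs = axes p} t∈))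
        (inj₂ a)    → a)
    length-M : length M ≤ toℕ k + length (axes p)
    length-M = subst (_≤ toℕ k + length (axes p)) (sym (Listₚ.length-++ L))
      (ℕₚ.+-mono-≤ (subst (_≤ toℕ k) (sym (trans (Listₚ.length-map (permute h′) (flag k))
          (Listₚ.length-take (toℕ k) tetrahedron))) (ℕₚ.m⊓n≤m (toℕ k) 4))
        (Listₚ.length-filter outside (axes p)))
    go : length M < 4 → ⊥
    go lt with complete-frame M M-clique
    ... | i , eqM = clash
      where
      three : ∀ n → n < 4 → ∀ {g} → g ∈ map (permute i) (take n tetrahedron) → g ∈ permute i t₁ ∷ permute i
          t₂ ∷ permute i t₃ ∷ []
      three 1 _ (here e) = here e
      three 2 _ (here e) = here e
      three 2 _ (there (here e)) = there (here e)
      three 3 _ g∈ = g∈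
      three (suc (suc (suc (suc _)))) (s≤s (s≤s (s≤s (s≤s ())))) _
      i′ : Rot
      i′ = i ∷ʳ 3F
      low : ∀ {g} → g ∈ M → g ∈ permute i t₁ ∷ permute i t₂ ∷ permute i t₃ ∷ []
      low {g} g∈ = three (length M) lt (subst (g ∈_) eqM g∈)
      in-i : ∀ {g} → g ∈ permute i t₁ ∷ permute i t₂ ∷ permute i t₃ ∷ [] → g ∈ frame i
      in-i g∈ = ∈ₚ.∈-++⁺ˡ g∈
      in-i′ : ∀ {g} → g ∈ permute i t₁ ∷ permute i t₂ ∷ permute i t₃ ∷ [] → g ∈ frame i′
      in-i′ {g} g∈ = subst (g ∈_) (sym (frame-last i)) (∈ₚ.∈-++⁺ˡ g∈)
      axes-M : ∀ {t} → t ∈ axes p → t ∈ M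
      axes-M {t} t∈ with t ∈? L
      ... | yes t∈L = ∈ₚ.∈-++⁺ˡ t∈L
      ... | no t∉   = ∈ₚ.∈-++⁺ʳ L (∈ₚ.∈-filter⁺ outside t∈ t∉)
      k≤ : toℕ k ≤ length M
      k≤ = subst₂ _≤_ length-L (sym (Listₚ.length-++ L)) (ℕₚ.m≤m+n (length L) _)
        where
        length-L : length L ≡ toℕ k
        length-L = trans (Listₚ.length-map (permute h′) (flag k))
            (trans (Listₚ.length-take (toℕ k) tetrahedron) (ℕₚ.m≤n⇒m⊓n≡m (ℕₚ.≤-pred (Finₚ.toℕ<n k))))
      take-L : take (toℕ k) M ≡ L
      take-L = prefix (toℕ k) tetrahedron (ℕₚ.≤-pred (Finₚ.toℕ<n k))
        where
        prefix : ∀ n X → n ≤ length X → take n (map (permute h′) (take n X) ++ filter outside (axes p)) ≡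
            map (permute h′) (take n X)
        prefix zero    X       _        = refl
        prefix (suc n) (x ∷ X) (s≤s le) = cong (permute h′ x ∷_) (prefix n X le)
      flag-i : map (permute i) (flag k) ≡ L
      flag-i = begin
        map (permute i) (take (toℕ k) tetrahedron)                    ≡⟨ cong
            (λ n → map (permute i) (take n tetrahedron)) (sym (ℕₚ.m≤n⇒m⊓n≡m k≤)) ⟩
        map (permute i) (take (toℕ k ℕ.⊓ length M) tetrahedron)       ≡⟨ cong (map (permute i))
            (sym (Listₚ.take-take (toℕ k) (length M) tetrahedron)) ⟩
        map (permute i) (take (toℕ k) (take (length M) tetrahedron))  ≡⟨ sym
            (Listₚ.take-map (toℕ k) (take (length M) tetrahedron)) ⟩
        take (toℕ k) (map (permute i) (take (length M) tetrahedron))  ≡⟨ cong (take (toℕ k)) (sym eqM) ⟩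
        take (toℕ k) M                                                ≡⟨ take-L ⟩
        L ∎
        where open ≡-Reasoning
      flag-i′ : map (permute i′) (flag k) ≡ L
      flag-i′ = trans (sym (Listₚ.take-map (toℕ k) tetrahedron)) (trans (cong (take (toℕ k)) (frame-last i))
        (trans (cut (toℕ k) (ℕₚ.≤-trans (s≤s k≤) lt)) (trans (Listₚ.take-map (toℕ k) tetrahedron) flag-i)))
        where
        cut : ∀ n → n < 4 → take n (permute i t₁ ∷ permute i t₂ ∷ permute i t₃ ∷ permute i t₄′ ∷ []) ≡ take n (frame i)
        cut 0 _ = refl
        cut 1 _ = refl
        cut 2 _ = refl
        cut 3 _ = refl
        cut (suc (suc (suc (suc _)))) (s≤s (s≤s (s≤s (s≤s ()))))
      is-c : ∀ r → (∀ {g} → g ∈ permute i t₁ ∷ permute i t₂ ∷ permute i t₃ ∷ [] → g ∈ frame r) → map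
          (permute r) (flag k) ≡ L →
        hypercube p r ≡ c
      is-c r sub same = sym (unique (cube-in-𝒫 {p} {r} (geo , al , All.tabulate λ t∈ → sub (low (axes-M t∈))) ,
        subst (λ z → Incident k (fwd p z) 4F (hypercube p r)) (trans (same-flag k r h′ same) (sym eqc))
            (incident p r k 4F)))
      clash : ⊥
      clash with ∈ₚ.∈-map⁻ (permute i) (frame-⊆ {i′} {i}
          (fwd-injective p (trans (is-c i′ in-i′ flag-i′) (sym (is-c i in-i flag-i))))
        (subst (permute i t₄′ ∈_) (sym (frame-last i)) (there (there (there (here refl))))))
      ... | t , t∈ , eq = t₄′∉ (subst (_∈ tetrahedron) (sym (permute-injective i eq)) t∈)
        where
        t₄′∉ : t₄′ ∉ tetrahedron
        t₄′∉ (there (there (there (there ()))))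

-- Counting outgoing edges by type

data Relation : Set where
  away near same : Relation

_≟R_ : DecidableEquality Relation
away ≟R away = yes refl
away ≟R near = no λ ()
away ≟R same = no λ ()
near ≟R away = no λ ()
near ≟R near = yes refl
near ≟R same = no λ ()
same ≟R away = no λ ()
same ≟R near = no λ ()
same ≟R same = yes refl

classify : ∀ {g t} → Dec (g ≡ t) → Dec (Adj g t) → Relation
classify (yes _) _       = same
classify (no _)  (yes _) = near
classify (no _)  (no _)  = away

opaque
  relation : Γ → Γ → Relation
  relation g t = classify (g Finₚ.≟ t) (Adj? g t)

  relation-same : ∀ g → relation g g ≡ same
  relation-same g with g Finₚ.≟ g
  ... | yes _ = refl
  ... | no ne  = contradiction refl ne

  relation-near : ∀ {g t} → Adj g t → relation g t ≡ near
  relation-near {g} {t} a with g Finₚ.≟ t | Adj? g t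
  ... | yes refl | _     = contradiction a Adj-irrefl
  ... | no _     | yes _ = refl
  ... | no _     | no ¬a = contradiction a ¬a

  relation-away : ∀ {g t} → g ≢ t → ¬ Adj g t → relation g t ≡ away
  relation-away {g} {t} ne ¬a with g Finₚ.≟ t | Adj? g t
  ... | yes eq | _     = contradiction eq ne
  ... | no _   | yes a = contradiction a ¬a
  ... | no _   | no _  = refl

  relation-permute : ∀ h g t → relation (permute h g) (permute h t) ≡ relation g t
  relation-permute h g t = go (g Finₚ.≟ t) (Adj? g t)
    where
    go : Dec (g ≡ t) → Dec (Adj g t) → relation (permute h g) (permute h t) ≡ relation g t
    go (yes refl) _       = trans (relation-same (permute h g)) (sym (relation-same g))
    go (no _)     (yes a) = trans (relation-near (Adj-permute h a)) (sym (relation-near a))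
    go (no ne)     (no ¬a) = trans (relation-away (ne ∘ permute-injective h) (¬a ∘ Adj-permute⁻ h))
        (sym (relation-away ne ¬a))

-- All that matters about a new letter: its relations to the descents and the axes decide whether it
-- may be appended and which type results.
relations : List Γ → Γ → List Relation
relations L g = map (relation g) L

nears : List Relation → ℕ
nears []         = 0
nears (near ∷ r) = suc (nears r)
nears (away ∷ r) = nears r
nears (same ∷ r) = nears r

-- The arguments are the numbers of axes and of descents; j axes place the vertex inside a boundary
-- face of dimension 4 - j. The last clause covers V₀ too, with its four axes.
kind : ℕ → ℕ → VertexType
kind 0 1 = K
kind 0 2 = H
kind 0 3 = G
kind 0 _ = F
kind 1 1 = E
kind 1 2 = D
kind 1 _ = C
kind 2 1 = B
kind 2 _ = A
kind _ _ = 𝟏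

_≟T_ : DecidableEquality VertexType
s ≟T t = map′ (λ eq → trans (sym (inverse s)) (trans (cong decode eq) (inverse t))) (cong code) (code s ℕₚ.≟ code t)
  where
  code : VertexType → ℕ
  code = λ where 𝟏 → 0 ; A → 1 ; B → 2 ; C → 3 ; D → 4 ; E → 5 ; F → 6 ; G → 7 ; H → 8 ; K → 9
  decode : ℕ → VertexType
  decode = λ where 0 → 𝟏 ; 1 → A ; 2 → B ; 3 → C ; 4 → D ; 5 → E ; 6 → F ; 7 → G ; 8 → H ; _ → K
  inverse : ∀ t → decode (code t) ≡ t
  inverse = λ where 𝟏 → refl ; A → refl ; B → refl ; C → refl ; D → refl ; E → refl ; F → refl ; G → refl ; H → refl ; K → refl

-- rd and rj are the relations of a generator to the descents and to the axes of a vertex.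
Leads : VertexType → List Relation → List Relation → Set
Leads t rd rj = All (_≢ same) rd × All (_≢ away) rj × kind (nears rj) (suc (nears rd)) ≡ t

Leads? : ∀ t rd rj → Dec (Leads t rd rj)
Leads? t rd rj = All.all? (λ r → ¬? (r ≟R same)) rd ×-dec All.all? (λ r → ¬? (r ≟R away)) rj ×-dec
    (kind (nears rj) (suc (nears rd)) ≟T t)

-- The relations of all generators to t₁, …, t₄, as ternary numbers
patterns : List (List Relation)
patterns = map (λ n → digit n ∷ digit (n / 3) ∷ digit (n / 9) ∷ digit (n / 27) ∷ []) (
  41 ∷ 43 ∷ 49 ∷ 67 ∷ 13 ∷ 31 ∷ 37 ∷ 4 ∷ 39 ∷ 10 ∷ 12 ∷ 28 ∷ 30 ∷ 1 ∷ 36 ∷ 3 ∷ 1 ∷ 9 ∷ 3 ∷ 1 ∷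
  27 ∷ 9 ∷ 3 ∷ 27 ∷ 0 ∷ 9 ∷ 27 ∷ List.replicate 93 0)
  where
  digit : ℕ → Relation
  digit n with n % 3
  ... | 0 = away
  ... | 1 = near
  ... | _ = same

-- Descents and axes together form a clique, so they may be taken to be the first d and the next j
-- vertices of the base tetrahedron.
tally : VertexType → ℕ → ℕ → ℕ
tally t d j = length (filter (λ r → Leads? t (take d r) (take j (drop d r))) patterns)

-- The degree of a vertex with j axes: 120, 13, 7, 5, 4 for j = 0, ..., 4.
star-tally : ℕ → ℕ
star-tally j = length (filter (λ r → All.all? (λ r → ¬? (r ≟R away)) (take j r)) patterns)

opaque
  unfolding wall perm Adj? relation generators

  patterns-correct : map (relations tetrahedron) generators ≡ patterns
  patterns-correct = refl

opaque
  length-filter-map : {X Y : Set} {P : Y → Set} (P? : ∀ y → Dec (P y)) (f : X → Y) (xs : List X) →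
    length (filter (λ x → P? (f x)) xs) ≡ length (filter P? (map f xs))
  length-filter-map P? f [] = refl
  length-filter-map P? f (x ∷ xs) with does (P? (f x))
  ... | true  = cong suc (length-filter-map P? f xs)
  ... | false = length-filter-map P? f xs

  tabulated : {P : List Relation → Set} (P? : ∀ r → Dec (P r)) →
    length (filter (λ g → P? (relations tetrahedron g)) generators) ≡ length (filter P? patterns)
  tabulated P? = trans (length-filter-map P? (relations tetrahedron) generators)
      (cong (length ∘ filter P?) patterns-correct)

  transport-count : ∀ h {P Q : Γ → Set} {xs ys} → (∀ {g} → P g → Q (permute h g)) → (∀ {g} → Q (permute h g) → P g) →
    Enumerates P xs → Enumerates Q ys → length xs ≡ length ys
  transport-count h {P} {Q} PQ QP ex ey = ℕₚ.≤-antisym (enumerates-≤ (permute h) (permute-injective h) PQ ex ey)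
    (enumerates-≤ (permute (reverse h)) (permute-injective (reverse h))
        (λ {g} q → QP (subst Q (sym (permute-undo′ h g)) q)) ey ex)

  relations-permute : ∀ h L g → relations (map (permute h) L) (permute h g) ≡ relations L g
  relations-permute h L g = trans (sym (Listₚ.map-∘ L)) (Listₚ.map-cong (relation-permute h g) L)

  relations-take : ∀ h d g → relations (map (permute h) (take d tetrahedron)) (permute h g) ≡ take d
      (relations tetrahedron g)
  relations-take h d g = trans (relations-permute h (take d tetrahedron) g) (sym (Listₚ.take-map d tetrahedron))

  relations-take-drop : ∀ h d j g → relations (map (permute h) (take j (drop d tetrahedron))) (permute h g)
      ≡ take j (drop d (relations tetrahedron g))
  relations-take-drop h d j g = trans (relations-permute h (take j (drop d tetrahedron)) g)
    (trans (sym (Listₚ.take-map j (drop d tetrahedron))) (cong (take j) (sym (Listₚ.drop-map d tetrahedron))))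

  nears-relations : ∀ g L → length (filter (Adj? g) L) ≡ nears (relations L g)
  nears-relations g [] = refl
  nears-relations g (t ∷ L) = go (g Finₚ.≟ t) (Adj? g t)
    where
    step : ∀ {r} → relation g t ≡ r → nears (relations (t ∷ L) g) ≡ nears (r ∷ relations L g)
    step = cong (λ r → nears (r ∷ relations L g))
    go : Dec (g ≡ t) → Dec (Adj g t) → length (filter (Adj? g) (t ∷ L)) ≡ nears (relations (t ∷ L) g)
    go (yes refl) _ = trans (cong length (Listₚ.filter-reject (Adj? g) Adj-irrefl))
        (trans (nears-relations g L) (sym (step (relation-same g))))
    go (no _) (yes a) = trans (cong length (Listₚ.filter-accept (Adj? g) a))
        (trans (cong suc (nears-relations g L)) (sym (step (relation-near a))))
    go (no ne) (no ¬a) = trans (cong length (Listₚ.filter-reject (Adj? g) ¬a))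
        (trans (nears-relations g L) (sym (step (relation-away ne ¬a))))

  star⁺ : ∀ {g L} → Star g L → All (_≢ away) (relations L g)
  star⁺ s = Allₚ.map⁺ (All.map (λ { (inj₁ refl) e → case trans (sym e) (relation-same _) of λ () ; (inj₂ a)
      e → case trans (sym e) (relation-near a) of λ () }) s)

  star⁻ : ∀ {g L} → All (_≢ away) (relations L g) → Star g L
  star⁻ {g} all = All.map (λ {t} away≢ → case g Finₚ.≟ t of λ where
    (yes eq) → inj₁ eq
    (no ne)   → case Adj? g t of λ where
      (yes a) → inj₂ a
      (no ¬a) → contradiction (relation-away ne ¬a) away≢) (Allₚ.map⁻ all)

  fresh⁺ : ∀ {g} p → ¬ Desc g p → All (_≢ same) (relations (descents p) g)
  fresh⁺ {g} p ¬d = Allₚ.map⁺ (All.tabulate λ {t} t∈ e → case g Finₚ.≟ t of λ where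
    (yes refl) → ¬d (descents-Desc p t∈)
    (no ne)     → case Adj? g t of λ where
      (yes a) → case trans (sym e) (relation-near a) of λ ()
      (no ¬a) → case trans (sym e) (relation-away ne ¬a) of λ ())

  fresh⁻ : ∀ {g} p → All (_≢ same) (relations (descents p) g) → ¬ Desc g p
  fresh⁻ {g} p all d = All.lookup (Allₚ.map⁻ all) (Desc-descents d) (relation-same g)

  split-prefix : ∀ (f : Γ → Γ) L M X → L ++ M ≡ map f (take (length (L ++ M)) X) →
    L ≡ map f (take (length L) X) × M ≡ map f (take (length M) (drop (length L) X))
  split-prefix f []      M X       eq = refl , eq
  split-prefix f (x ∷ L) M (y ∷ X) eq = let a , b = split-prefix f L M X (Listₚ.∷-injectiveʳ eq) in cong₂ _∷_ (Listₚ.∷-injectiveˡ eq) a , b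

typeOf : List Γ → VertexType
typeOf p = kind (length (axes p)) (length (descents p))

opaque
  outgoing : List Γ → List Γ
  outgoing p = filter (λ g → Star? g (axes p) ×-dec ¬? (Desc? g p)) generators

  outgoing-enumerates : ∀ p → Enumerates (λ g → Star g (axes p) × ¬ Desc g p) (outgoing p)
  outgoing-enumerates p = filter-enumerates (λ g → Star? g (axes p) ×-dec ¬? (Desc? g p))

opaque
  state-clique : ∀ p → Clique (descents p ++ axes p)
  state-clique p = AllPairsₚ.++⁺ (descents-clique p) (axes-clique p)
    (All.tabulate λ d∈ → All.tabulate λ t∈ → Desc-All (axes-Adj p t∈) (descents-Desc p d∈))

  -- A rotation that moves the base tetrahedron onto the descents and axes preserves all relations,
  -- hence the count.
  outgoing-tally : ∀ t p → length (filter (λ g → typeOf (g ∷ p) ≟T t) (outgoing p)) ≡ tally t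
      (length (descents p)) (length (axes p))
  outgoing-tally t p with complete-frame (descents p ++ axes p) (state-clique p)
  ... | h , eq = trans (sym (transport-count h to from (filter-enumerates Pattern?) enumerates))
      (tabulated (λ r → Leads? t (take d r) (take j (drop d r))))
    where
    d j : ℕ
    d = length (descents p)
    j = length (axes p)
    Pattern? : ∀ g → Dec (Leads t (take d (relations tetrahedron g)) (take j (drop d (relations tetrahedron g))))
    Pattern? g = Leads? t (take d (relations tetrahedron g)) (take j (drop d (relations tetrahedron g)))
    Step : Γ → Set
    Step g = (Star g (axes p) × ¬ Desc g p) × typeOf (g ∷ p) ≡ t
    D≡ : ∀ g → relations (descents p) (permute h g) ≡ take d (relations tetrahedron g)
    D≡ g = trans (cong (λ L → relations L (permute h g))
        (proj₁ (split-prefix (permute h) (descents p) (axes p) tetrahedron eq))) (relations-take h d g)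
    J≡ : ∀ g → relations (axes p) (permute h g) ≡ take j (drop d (relations tetrahedron g))
    J≡ g = trans (cong (λ L → relations L (permute h g))
        (proj₂ (split-prefix (permute h) (descents p) (axes p) tetrahedron eq))) (relations-take-drop h d j g)
    type≡ : ∀ g → typeOf (g ∷ p) ≡ kind (nears (relations (axes p) g)) (suc (nears (relations (descents p) g)))
    type≡ g = cong₂ kind (nears-relations g (axes p)) (cong suc (nears-relations g (descents p)))
    to : ∀ {g} → Leads t (take d (relations tetrahedron g)) (take j (drop d (relations tetrahedron g))) →
        Step (permute h g)
    to {g} leads with subst₂ (Leads t) (sym (D≡ g)) (sym (J≡ g)) leads
    ... | f , s , k = (star⁻ s , fresh⁻ p f) , trans (type≡ (permute h g)) k
    from : ∀ {g} → Step (permute h g) → Leads t (take d (relations tetrahedron g))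
        (take j (drop d (relations tetrahedron g)))
    from {g} ((s , f) , k) = subst₂ (Leads t) (D≡ g) (J≡ g) (fresh⁺ p f , star⁺ s , trans (sym (type≡ (permute h g))) k)
    enumerates : Enumerates Step (filter (λ g → typeOf (g ∷ p) ≟T t) (outgoing p))
    enumerates = Uniqueₚ.filter⁺ (λ g → typeOf (g ∷ p) ≟T t) (proj₁ (outgoing-enumerates p)) , λ g → mk⇔
      (λ g∈ → let g∈′ , k = ∈ₚ.∈-filter⁻ (λ g → typeOf (g ∷ p) ≟T t) {xs = outgoing p} g∈ in Equivalence.to (proj₂ (outgoing-enumerates p) g) g∈′ , k)
      (λ (o , k) → ∈ₚ.∈-filter⁺ (λ g → typeOf (g ∷ p) ≟T t) (Equivalence.from (proj₂ (outgoing-enumerates p) g) o) k)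

  star-count : ∀ p → length (filter (λ g → Star? g (axes p)) generators) ≡ star-tally (length (axes p))
  star-count p with complete-frame (axes p) (axes-clique p)
  ... | h , eq = trans (sym (transport-count h to from (filter-enumerates Pattern?)
      (filter-enumerates (λ g → Star? g (axes p)))))
      (tabulated (λ r → All.all? (λ r → ¬? (r ≟R away)) (take j r)))
    where
    j : ℕ
    j = length (axes p)
    Pattern? : ∀ g → Dec (All (_≢ away) (take j (relations tetrahedron g)))
    Pattern? g = All.all? (λ r → ¬? (r ≟R away)) (take j (relations tetrahedron g))
    J≡ : ∀ g → relations (axes p) (permute h g) ≡ take j (relations tetrahedron g)
    J≡ g = trans (cong (λ L → relations L (permute h g)) eq) (relations-take h j g)
    to : ∀ {g} → All (_≢ away) (take j (relations tetrahedron g)) → Star (permute h g) (axes p)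
    to {g} all = star⁻ (subst (All (_≢ away)) (sym (J≡ g)) all)
    from : ∀ {g} → Star (permute h g) (axes p) → All (_≢ away) (take j (relations tetrahedron g))
    from {g} s = subst (All (_≢ away)) (J≡ g) (star⁺ s)

-- (j , i) stands for j axes and i + 1 descents.
states : List (ℕ × ℕ)
states = (0 , 0) ∷ (0 , 1) ∷ (0 , 2) ∷ (0 , 3) ∷ (1 , 0) ∷ (1 , 1) ∷ (1 , 2) ∷ (2 , 0) ∷ (2 , 1) ∷ (3 , 0) ∷ []

-- Vertex types from axes and descents

opaque
  star-tally-injective : ∀ (i j : Fin 5) → star-tally (toℕ i) ≡ star-tally (toℕ j) → i ≡ j
  star-tally-injective = toWitness {a? = Finₚ.all? λ i → Finₚ.all? λ j →
      (star-tally (toℕ i) ℕₚ.≟ star-tally (toℕ j)) →-dec (i Finₚ.≟ j)} tt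

  axes-length : ∀ p → length (axes p) ≤ 4
  axes-length p = clique-length (axes-clique p)

  degree′ : ∀ {p} → Geo p → Allowed p → Degree (fwd p V₀) (star-tally (length (axes p)))
  degree′ {p} geo al = subst (Degree (fwd p V₀)) (star-count p) (degree geo al)

  degree-axes : ∀ {p} (i : Fin 5) → Geo p → Allowed p → Degree (fwd p V₀) (star-tally (toℕ i)) → length (axes p) ≡ toℕ i
  degree-axes {p} i geo al deg = trans (sym (Finₚ.toℕ-fromℕ< lt)) (cong toℕ (star-tally-injective (Fin.fromℕ< lt) i
    (trans (cong star-tally (Finₚ.toℕ-fromℕ< lt)) (count-unique (degree′ geo al) deg))))
    where
    lt : length (axes p) < 5
    lt = s≤s (axes-length p)

  -- The degree gives the number of axes by `star-tally-injective`, and the incoming edges give the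
  -- number of descents.
  hasType⁻ : ∀ {t p} → Geo p → Allowed p → HasType t (fwd p V₀) → typeOf p ≡ t
  hasType⁻ {t} {p} geo al = go t
    where
    d : ℕ
    d = length (descents p)
    found : ∀ {j i} → length (axes p) ≡ j → i ≡ d → typeOf p ≡ kind j i
    found a b = cong₂ kind a (sym b)
    inc : ∀ {i} → Incoming (fwd p V₀) i → i ≡ d
    inc i = count-unique i (incoming geo al)
    go : ∀ t → HasType t (fwd p V₀) → typeOf p ≡ t
    go 𝟏 (_ , inj₁ deg)       = cong (λ j → kind j d) (degree-axes 3F geo al deg)
    go 𝟏 (_ , inj₂ (_ , deg)) = cong (λ j → kind j d) (degree-axes 4F geo al deg)
    go A ((_ , _ , deg) , i) = found (degree-axes 2F geo al deg) (inc i)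
    go B ((_ , _ , deg) , i) = found (degree-axes 2F geo al deg) (inc i)
    go C ((_ , _ , deg) , i) = found (degree-axes 1F geo al deg) (inc i)
    go D ((_ , _ , deg) , i) = found (degree-axes 1F geo al deg) (inc i)
    go E ((_ , _ , deg) , i) = found (degree-axes 1F geo al deg) (inc i)
    go F ((_ , _ , deg) , i) = found (degree-axes 0F geo al deg) (inc i)
    go G ((_ , _ , deg) , i) = found (degree-axes 0F geo al deg) (inc i)
    go H ((_ , _ , deg) , i) = found (degree-axes 0F geo al deg) (inc i)
    go K ((_ , _ , deg) , i) = found (degree-axes 0F geo al deg) (inc i)

  state-length : ∀ p → length (descents p) + length (axes p) ≤ 4
  state-length p = subst (_≤ 4) (Listₚ.length-++ (descents p)) (clique-length (state-clique p))

  ∈-states : ∀ j i → suc i + j ≤ 4 → (j , i) ∈ states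
  ∈-states 0 0 _ = here refl
  ∈-states 0 1 _ = there (here refl)
  ∈-states 0 2 _ = there (there (here refl))
  ∈-states 0 3 _ = there (there (there (here refl)))
  ∈-states 1 0 _ = there (there (there (there (here refl))))
  ∈-states 1 1 _ = there (there (there (there (there (here refl)))))
  ∈-states 1 2 _ = there (there (there (there (there (there (here refl))))))
  ∈-states 2 0 _ = there (there (there (there (there (there (there (here refl)))))))
  ∈-states 2 1 _ = there (there (there (there (there (there (there (there (here refl))))))))
  ∈-states 3 0 _ = there (there (there (there (there (there (there (there (there (here refl)))))))))
  ∈-states 0 (suc (suc (suc (suc i)))) (s≤s (s≤s (s≤s (s≤s ()))))
  ∈-states 1 (suc (suc (suc i))) (s≤s le) = contradiction (subst (_≤ 3) (ℕₚ.+-comm (3 + i) 1) le) λ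
      { (s≤s (s≤s (s≤s ()))) }
  ∈-states 2 (suc (suc i)) (s≤s le) = contradiction (subst (_≤ 3) (ℕₚ.+-comm (2 + i) 2) le) λ { (s≤s (s≤s (s≤s ()))) }
  ∈-states 3 (suc i) (s≤s le) = contradiction (subst (_≤ 3) (ℕₚ.+-comm (1 + i) 3) le) λ { (s≤s (s≤s (s≤s ()))) }
  ∈-states (suc (suc (suc (suc j)))) i (s≤s le) = contradiction (subst (_≤ 3) (ℕₚ.+-comm i (4 + j)) le) λ
      { (s≤s (s≤s (s≤s ()))) }

  hasType⁺ : ∀ {p} → Geo p → Allowed p → HasType (typeOf p) (fwd p V₀)
  hasType⁺ {[]} geo al = onFace⁺ 1F {[]} geo al (s≤s (s≤s (s≤s (s≤s z≤n)))) , inj₂ (refl , degree′ geo al)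
  hasType⁺ {p@(g ∷ p′)} geo al = go (length (axes p)) refl (length (filter (Adj? g) (descents p′))) refl
      (state-length p)
    where
    deg : ∀ {j} → length (axes p) ≡ j → Degree (fwd p V₀) (star-tally j)
    deg eq = subst (λ j → Degree (fwd p V₀) (star-tally j)) eq (degree′ geo al)
    inc : ∀ {i} → length (filter (Adj? g) (descents p′)) ≡ i → Incoming (fwd p V₀) (suc i)
    inc eq = subst (λ i → Incoming (fwd p V₀) (suc i)) eq (incoming geo al)
    on-face : ∀ k {j} → length (axes p) ≡ j → 4 ≤ toℕ k + j → OnFace k (fwd p V₀)
    on-face k eq le = onFace⁺ k geo al (subst (λ j → 4 ≤ toℕ k + j) (sym eq) le)
    off-face : ∀ k {j} → length (axes p) ≡ j → ¬ (4 ≤ toℕ k + j) → ¬ OnFace k (fwd p V₀)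
    off-face k eq ¬le face = ¬le (subst (λ j → 4 ≤ toℕ k + j) eq (onFace⁻ k geo face))
    four : ∀ {n} → 4 ≤ suc (suc (suc (suc n)))
    four = s≤s (s≤s (s≤s (s≤s z≤n)))
    ¬four : ¬ (4 ≤ 3)
    ¬four (s≤s (s≤s (s≤s ())))
    inside₂ : length (axes p) ≡ 2 → Inside2Face (fwd p V₀)
    inside₂ eq = on-face 2F eq four , off-face 1F eq ¬four , deg eq
    inside₃ : length (axes p) ≡ 1 → Inside3Face (fwd p V₀)
    inside₃ eq = on-face 3F eq four , off-face 2F eq ¬four , deg eq
    inside : length (axes p) ≡ 0 → Inside𝒫 (fwd p V₀)
    inside eq = (hypercube p [] , cube-in-𝒫 {p} {[]} (geo , al , none eq) , vertex-of p [] refl) , off-face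
        3F eq ¬four , deg eq
      where
      none : ∀ {L : List Γ} → length L ≡ 0 → All (_∈ frame []) L
      none {[]} _ = []
    go : ∀ j → length (axes p) ≡ j → ∀ i → length (filter (Adj? g) (descents p′)) ≡ i →
      suc (length (filter (Adj? g) (descents p′))) + length (axes p) ≤ 4 → HasType (typeOf p) (fwd p V₀)
    go j eqj i eqi le = subst (λ t → HasType t (fwd p V₀)) (cong₂ (λ j i → kind j (suc i)) (sym eqj) (sym eqi))
      (All.lookup realised (∈-states j i (subst₂ (λ i j → suc i + j ≤ 4) eqi eqj le)) eqj eqi)
      where
      Realised : ℕ × ℕ → Set
      Realised (j , i) = length (axes p) ≡ j → length (filter (Adj? g) (descents p′)) ≡ i → HasType
          (kind j (suc i)) (fwd p V₀)
      realised : All Realised states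
      realised =
        (λ ej ei → inside ej , inc ei) ∷ (λ ej ei → inside ej , inc ei) ∷ (λ ej ei → inside ej , inc ei) ∷
            (λ ej ei → inside ej , inc ei) ∷
        (λ ej ei → inside₃ ej , inc ei) ∷ (λ ej ei → inside₃ ej , inc ei) ∷ (λ ej ei → inside₃ ej , inc ei) ∷
        (λ ej ei → inside₂ ej , inc ei) ∷ (λ ej ei → inside₂ ej , inc ei) ∷
        (λ ej ei → on-face 1F ej four , inj₁ (deg ej)) ∷ []

-- Sums of values as numbers of words

walks : ℕ → List (List Γ)
walks zero    = [] ∷ []
walks (suc n) = concatMap (λ p → map (_∷ p) (outgoing p)) (walks n)

Walk : ℕ → List Γ → Set
Walk n p = Geo p × Allowed p × length p ≡ n

typed : VertexType → ℕ → List (List Γ)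
typed t n = filter (λ p → typeOf p ≟T t) (walks n)

-- A vertex of value m is the end of exactly m words, and equivalent words have the same type.
-- Counting words therefore sums the values.
total : VertexType → ℕ → ℕ
total t n = length (typed t n)

opaque
  ∈-outgoing : ∀ {g p} → g ∈ outgoing p → Star g (axes p) × ¬ Desc g p
  ∈-outgoing {g} {p} = Equivalence.to (proj₂ (outgoing-enumerates p) g)

  walks-enumerates : ∀ n → Enumerates (Walk n) (walks n)
  walks-enumerates zero = ([] ∷ []) , λ p → mk⇔ (λ { (here refl) → [] , [] , refl }) λ
      { ([] , [] , refl) → here refl ; (_ ∷ _ , _ , ()) }
  walks-enumerates (suc n) with walks-enumerates n
  ... | u , e = unique (walks n) u , λ p → mk⇔ to from
    where
    to : ∀ {p} → p ∈ walks (suc n) → Walk (suc n) p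
    to p∈ with ∈ₚ.∈-concatMap⁻ (λ p → map (_∷ p) (outgoing p)) {xs = walks n} p∈
    ... | any with find any
    ... | q , q∈ , p∈′ with ∈ₚ.∈-map⁻ (_∷ q) p∈′ | Equivalence.to (e q) q∈
    ... | g , g∈ , refl | geo , al , eq with ∈-outgoing {g} {q} g∈
    ... | s , ¬d = ¬d ∷ geo , s ∷ al , cong suc eq
    from : ∀ {p} → Walk (suc n) p → p ∈ walks (suc n)
    from {g ∷ p} (¬d ∷ geo , s ∷ al , eq) = ∈ₚ.∈-concatMap⁺ (λ p → map (_∷ p) (outgoing p)) {xs = walks n}
      (lose (Equivalence.from (e p) (geo , al , ℕₚ.suc-injective eq))
          (∈ₚ.∈-map⁺ (_∷ p) (Equivalence.from (proj₂ (outgoing-enumerates p) g) (s , ¬d))))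
    unique : ∀ ps → Unique ps → Unique (concatMap (λ p → map (_∷ p) (outgoing p)) ps)
    unique []       []        = []
    unique (p ∷ ps) (p∉ ∷ u) = Uniqueₚ.++⁺ (Uniqueₚ.map⁺ (λ { refl → refl })
        (proj₁ (outgoing-enumerates p))) (unique ps u) disjoint
      where
      disjoint : ∀ {q} → q ∈ map (_∷ p) (outgoing p) × q ∈ concatMap (λ p → map (_∷ p) (outgoing p)) ps → ⊥
      disjoint (q∈ , q∈′) with ∈ₚ.∈-map⁻ (_∷ p) q∈ | find
          (∈ₚ.∈-concatMap⁻ (λ p → map (_∷ p) (outgoing p)) {xs = ps} q∈′)
      ... | g , _ , refl | r , r∈ , q∈″ with ∈ₚ.∈-map⁻ (_∷ r) q∈″
      ... | _ , _ , refl = All.lookup p∉ r∈ refl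

  typed-enumerates : ∀ t n → Enumerates (λ p → Walk n p × typeOf p ≡ t) (typed t n)
  typed-enumerates t n with walks-enumerates n
  ... | u , e = Uniqueₚ.filter⁺ (λ p → typeOf p ≟T t) u , λ p → mk⇔
    (λ p∈ → let p∈′ , k = ∈ₚ.∈-filter⁻ (λ p → typeOf p ≟T t) {xs = walks n} p∈ in Equivalence.to (e p) p∈′ , k)
    (λ (w , k) → ∈ₚ.∈-filter⁺ (λ p → typeOf p ≟T t) (Equivalence.from (e p) w) k)

  descents-≈ : ∀ {p q} → p ≈ q → length (descents p) ≡ length (descents q)
  descents-≈ {p} {q} e = ℕₚ.≤-antisym
    (enumerates-≤ id id (Desc-≈ e) (descents-enumerates p) (descents-enumerates q))
    (enumerates-≤ id id (Desc-≈ (≈-sym e)) (descents-enumerates q) (descents-enumerates p))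

  typeOf-≈ : ∀ {p q} → p ≈ q → typeOf p ≡ typeOf q
  typeOf-≈ e = cong₂ kind (cong length (axes-≈ e)) (descents-≈ e)

end : List Γ → Point
end p = fwd p V₀

fibre : VertexType → ℕ → Point → List (List Γ)
fibre t n x = filter (λ p → end p ≟P x) (typed t n)

opaque
  fibre-value : ∀ t n {x} → x ∈ map end (typed t n) → Value x (length (fibre t n x))
  fibre-value t n {x} x∈ with ∈ₚ.∈-map⁻ end x∈
  ... | p , p∈ , refl with Equivalence.to (proj₂ (typed-enumerates t n) p) p∈
  ... | (geo , al , len) , ty = enumerates-count trail trail-injective
      (λ {q} (geo′ , eq) → subst (λ x → Graph.Shortest _~_ V₀ x (trail q)) eq (shortest⁺ geo′))
      (λ s → case shortest⁻ s of λ { (q , geo′ , eq , tr) → q , (geo′ , eq) , tr })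
      enumerates
    where
    enumerates : Enumerates (To (end p)) (fibre t n (end p))
    enumerates = Uniqueₚ.filter⁺ (λ q → end q ≟P end p) (proj₁ (typed-enumerates t n)) , λ q → mk⇔
      (λ q∈ → let q∈′ , eq = ∈ₚ.∈-filter⁻ (λ q → end q ≟P end p) {xs = typed t n} q∈
                  (geo′ , _) , _ = Equivalence.to (proj₂ (typed-enumerates t n) q) q∈′ in geo′ , eq)
      (λ (geo′ , eq) → let e = same-≈ geo geo′ (sym eq) in
        ∈ₚ.∈-filter⁺ (λ q → end q ≟P end p) (Equivalence.from (proj₂ (typed-enumerates t n) q)
          ((geo′ , Allowed-≈ e al , trans (sym (length-≈ e)) len) , trans (sym (typeOf-≈ e)) ty)) eq)

  ends : ∀ t n x → x ∈ map end (typed t n) ⇔ (Level n x × HasType t x)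
  ends t n x = mk⇔ to from
    where
    to : ∀ {x} → x ∈ map end (typed t n) → Level n x × HasType t x
    to x∈ with ∈ₚ.∈-map⁻ end x∈
    ... | p , p∈ , refl with Equivalence.to (proj₂ (typed-enumerates t n) p) p∈
    ... | (geo , al , refl) , refl = level⁺ geo al , hasType⁺ geo al
    from : ∀ {x} → Level n x × HasType t x → x ∈ map end (typed t n)
    from (lv , ty) with level⁻ lv
    ... | p , geo , al , refl , len = ∈ₚ.∈-map⁺ end
        (Equivalence.from (proj₂ (typed-enumerates t n) p) ((geo , al , len) , hasType⁻ geo al ty))

  sum-bump : {X : Set} {xs : List X} {e : X} (f f′ : X → ℕ) (k : ℕ) → Unique xs → e ∈ xs → f′ e ≡ k + f e →
      (∀ {y} → y ≢ e → f′ y ≡ f y) →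
    sum (map f′ xs) ≡ k + sum (map f xs)
  sum-bump {xs = x ∷ xs} f f′ k (x∉ ∷ u) (here refl) at off = trans (cong₂ _+_ at (cong sum
    (Listₚ.map-cong-local (All.map (λ ne → off (ne ∘ sym)) x∉)))) (ℕₚ.+-assoc k (f x) _)
  sum-bump {xs = x ∷ xs} f f′ k (x∉ ∷ u) (there e∈) at off = trans
      (cong₂ _+_ (off (All.lookup x∉ e∈)) (sum-bump f f′ k u e∈ at off)) (lem (f x) k _)
    where
    lem : ∀ a b c → a + (b + c) ≡ b + (a + c)
    lem = ℕ-Solver.solve-∀

  sum-fibres : ∀ {xs} (ps : List (List Γ)) → Unique xs → All (λ p → end p ∈ xs) ps →
    sum (map (λ x → length (filter (λ p → end p ≟P x) ps)) xs) ≡ length ps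
  sum-fibres {xs} [] u [] = zeros xs
    where
    zeros : ∀ (xs : List Point) → sum (map (λ _ → 0) xs) ≡ 0
    zeros []       = refl
    zeros (x ∷ xs) = zeros xs
  sum-fibres (p ∷ ps) u (p∈ ∷ all) = trans
    (sum-bump (λ x → length (filter (λ p → end p ≟P x) ps)) (λ x → length (filter (λ p → end p ≟P x) (p ∷ ps))) 1 u p∈
      (cong length (Listₚ.filter-accept (λ q → end q ≟P end p) {p} {ps} refl))
      (λ {y} ne → cong length (Listₚ.filter-reject (λ q → end q ≟P y) {p} {ps} (ne ∘ sym))))
    (cong suc (sum-fibres ps u all))

  valueSum : ∀ t n → ValueSum t n (total t n)
  valueSum t n = xs , (unique , λ x → mk⇔ (λ x∈ → Equivalence.to (ends t n x)
      (∈ₚ.∈-deduplicate⁻ _≟P_ (map end (typed t n)) x∈))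
      (λ P → member (Equivalence.from (ends t n x) P)))
    , map (λ x → length (fibre t n x)) xs , values xs (λ x∈ → ∈ₚ.∈-deduplicate⁻ _≟P_ (map end (typed t n)) x∈)
    , sum-fibres (typed t n) unique (All.tabulate λ p∈ → member (∈ₚ.∈-map⁺ end p∈))
    where
    xs : List Point
    xs = deduplicate _≟P_ (map end (typed t n))
    unique : Unique xs
    unique = DecUniqueₚ.deduplicate-! _≟P_ (map end (typed t n))
    member : ∀ {x} → x ∈ map end (typed t n) → x ∈ xs
    member = ∈ₚ.∈-deduplicate⁺ _≟P_
    values : ∀ ys → (∀ {y} → y ∈ ys → y ∈ map end (typed t n)) → Pointwise Value ys
        (map (λ x → length (fibre t n x)) ys)
    values []       _   = []
    values (y ∷ ys) sub = fibre-value t n (sub (here refl)) ∷ values ys (sub ∘ there)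

  valueSum-unique : ∀ {t n s} → ValueSum t n s → s ≡ total t n
  valueSum-unique {t} {n} (xs , (u , e) , ms , pw , refl) = trans
      (cong sum (values (λ {x} x∈ → Equivalence.from (ends t n x) (Equivalence.to (e x) x∈)) pw))
    (sum-fibres (typed t n) u (All.tabulate λ {p} p∈ → Equivalence.from (e (end p))
        (Equivalence.to (ends t n (end p)) (∈ₚ.∈-map⁺ end p∈))))
    where
    values : ∀ {ys ms} → (∀ {y} → y ∈ ys → y ∈ map end (typed t n)) → Pointwise Value ys ms → ms ≡ map
        (λ x → length (fibre t n x)) ys
    values sub []       = refl
    values sub (v ∷ vs) = cong₂ _∷_ (count-unique v (fibre-value t n (sub (here refl)))) (values (sub ∘ there) vs)

  count-concatMap : ∀ t ps → length (filter (λ p → typeOf p ≟T t) (concatMap (λ p → map (_∷ p) (outgoing p)) ps))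
    ≡ sum (map (λ p → tally t (length (descents p)) (length (axes p))) ps)
  count-concatMap t []       = refl
  count-concatMap t (p ∷ ps) = begin
    length (filter P? (map (_∷ p) (outgoing p) ++ rest))                           ≡⟨ cong length
        (Listₚ.filter-++ P? (map (_∷ p) (outgoing p)) rest) ⟩
    length (filter P? (map (_∷ p) (outgoing p)) ++ filter P? rest)                 ≡⟨ Listₚ.length-++
        (filter P? (map (_∷ p) (outgoing p))) ⟩
    length (filter P? (map (_∷ p) (outgoing p))) + length (filter P? rest)
      ≡⟨ cong₂ _+_ (trans (sym (length-filter-map P? (_∷ p) (outgoing p))) (outgoing-tally t p))
          (count-concatMap t ps) ⟩
    tally t (length (descents p)) (length (axes p)) + sum
        (map (λ p → tally t (length (descents p)) (length (axes p))) ps) ∎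
    where
    open ≡-Reasoning
    P? : ∀ p → Dec (typeOf p ≡ t)
    P? p = typeOf p ≟T t
    rest : List (List Γ)
    rest = concatMap (λ p → map (_∷ p) (outgoing p)) ps

-- The recurrences

types : List VertexType
types = A ∷ B ∷ C ∷ D ∷ E ∷ F ∷ G ∷ H ∷ K ∷ 𝟏 ∷ []

-- The vertex V₀ is excluded: it has type 𝟏 but four axes.
edges : VertexType → VertexType → ℕ
edges t 𝟏 = tally t 1 3
edges t A = tally t 2 2
edges t B = tally t 1 2
edges t C = tally t 3 1
edges t D = tally t 2 1
edges t E = tally t 1 1
edges t F = tally t 4 0
edges t G = tally t 3 0
edges t H = tally t 2 0
edges t K = tally t 1 0

edge-matrix : List (List ℕ)
edge-matrix =
  (2 ∷ 2 ∷ 0 ∷ 0 ∷ 0 ∷ 0  ∷ 0  ∷ 0   ∷ 0   ∷ 3 ∷ []) ∷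
  (1 ∷ 2 ∷ 0 ∷ 0 ∷ 0 ∷ 0  ∷ 0  ∷ 0   ∷ 0   ∷ 0 ∷ []) ∷
  (2 ∷ 0 ∷ 3 ∷ 2 ∷ 0 ∷ 0  ∷ 0  ∷ 0   ∷ 0   ∷ 0 ∷ []) ∷
  (0 ∷ 2 ∷ 3 ∷ 4 ∷ 5 ∷ 0  ∷ 0  ∷ 0   ∷ 0   ∷ 0 ∷ []) ∷
  (0 ∷ 0 ∷ 3 ∷ 4 ∷ 6 ∷ 0  ∷ 0  ∷ 0   ∷ 0   ∷ 0 ∷ []) ∷
  (0 ∷ 0 ∷ 1 ∷ 0 ∷ 0 ∷ 4  ∷ 2  ∷ 0   ∷ 0   ∷ 0 ∷ []) ∷
  (0 ∷ 0 ∷ 0 ∷ 1 ∷ 0 ∷ 6  ∷ 6  ∷ 5   ∷ 0   ∷ 0 ∷ []) ∷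
  (0 ∷ 0 ∷ 0 ∷ 0 ∷ 1 ∷ 12 ∷ 12 ∷ 12  ∷ 12  ∷ 0 ∷ []) ∷
  (0 ∷ 0 ∷ 0 ∷ 0 ∷ 0 ∷ 94 ∷ 97 ∷ 101 ∷ 107 ∷ 0 ∷ []) ∷
  (0 ∷ 0 ∷ 0 ∷ 0 ∷ 0 ∷ 0  ∷ 0  ∷ 0   ∷ 0   ∷ 1 ∷ []) ∷ []

opaque
  edges-tally : ∀ t g p → tally t (length (descents (g ∷ p))) (length (axes (g ∷ p))) ≡ edges t (typeOf (g ∷ p))
  edges-tally t g p = All.lookup table (∈-states (length (axes (g ∷ p)))
      (length (filter (Adj? g) (descents p))) (state-length (g ∷ p)))
    where
    table : All (λ (j , i) → tally t (suc i) j ≡ edges t (kind j (suc i))) states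
    table = refl ∷ refl ∷ refl ∷ refl ∷ refl ∷ refl ∷ refl ∷ refl ∷ refl ∷ refl ∷ []

  types-unique : Unique types
  types-unique = AllPairs.map (λ { ne refl → ne refl })
      (toWitness {a? = AllPairs.allPairs? (λ s t → ¬? (s ≟T t)) types} tt)

  ∈-types : ∀ t → t ∈ types
  ∈-types A = here refl
  ∈-types B = there (here refl)
  ∈-types C = there (there (here refl))
  ∈-types D = there (there (there (here refl)))
  ∈-types E = there (there (there (there (here refl))))
  ∈-types F = there (there (there (there (there (here refl)))))
  ∈-types G = there (there (there (there (there (there (here refl))))))
  ∈-types H = there (there (there (there (there (there (there (here refl)))))))
  ∈-types K = there (there (there (there (there (there (there (there (here refl))))))))
  ∈-types 𝟏 = there (there (there (there (there (there (there (there (there (here refl)))))))))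

  sum-by-type : ∀ (m : VertexType → ℕ) ps → sum (map (m ∘ typeOf) ps) ≡ sum
      (map (λ s → m s * length (filter (λ p → typeOf p ≟T s) ps)) types)
  sum-by-type m [] = sym (zeros types)
    where
    zeros : ∀ ts → sum (map (λ s → m s * 0) ts) ≡ 0
    zeros []       = refl
    zeros (t ∷ ts) = cong₂ _+_ (ℕₚ.*-zeroʳ (m t)) (zeros ts)
  sum-by-type m (p ∷ ps) = trans (cong (λ n → m (typeOf p) + n) (sum-by-type m ps)) (sym (sum-bump
    (λ s → m s * length (filter (λ p → typeOf p ≟T s) ps))
        (λ s → m s * length (filter (λ p → typeOf p ≟T s) (p ∷ ps))) (m (typeOf p))
    types-unique (∈-types (typeOf p))
    (trans (cong (λ n → m (typeOf p) * n) (cong length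
        (Listₚ.filter-accept (λ q → typeOf q ≟T typeOf p) {p} {ps} refl))) (ℕₚ.*-suc (m (typeOf p)) _))
    (λ {s} ne → cong (λ n → m s * n) (cong length (Listₚ.filter-reject (λ q → typeOf q ≟T s) {p} {ps} (ne ∘ sym))))))

  recurrence : ∀ t n → n ≥ 1 → total t (suc n) ≡ sum (map (λ s → edges t s * total s n) types)
  recurrence t n n≥1 = begin
    total t (suc n)                                                               ≡⟨ count-concatMap t (walks n) ⟩
    sum (map (λ p → tally t (length (descents p)) (length (axes p))) (walks n))
      ≡⟨ cong sum (Listₚ.map-cong-local (All.tabulate λ {p} p∈ → nonempty p
          (Equivalence.to (proj₂ (walks-enumerates n) p) p∈))) ⟩
    sum (map (edges t ∘ typeOf) (walks n))                                        ≡⟨ sum-by-type (edges t) (walks n) ⟩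
    sum (map (λ s → edges t s * total s n) types)                                 ∎
    where
    open ≡-Reasoning
    nonempty : ∀ p → Walk n p → tally t (length (descents p)) (length (axes p)) ≡ edges t (typeOf p)
    -- The empty word has four axes and no descents, whereas `edges` counts type 𝟏 with three axes
    -- and one descent.
    nonempty []      (_ , _ , refl) = contradiction n≥1 λ ()
    nonempty (g ∷ p) _              = edges-tally t g p

  -- Level 1 arises from the empty word alone, with no descents and four axes.
  initial : ∀ t → total t 1 ≡ tally t 0 4
  initial t = trans (count-concatMap t ([] ∷ [])) (ℕₚ.+-identityʳ (tally t 0 4))

  edge-table : map (λ t → map (edges t) types) types ≡ edge-matrix
  edge-table = refl

Weighted : List ℕ → List ℕ → ℕ
Weighted []       _        = 0
Weighted (_ ∷ _)  []       = 0
Weighted (c ∷ cs) (x ∷ xs) = c * x + Weighted cs xs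

opaque
  weighted : ∀ (c x : VertexType → ℕ) ts → sum (map (λ s → c s * x s) ts) ≡ Weighted (map c ts) (map x ts)
  weighted c x []       = refl
  weighted c x (t ∷ ts) = cong (λ n → c t * x t + n) (weighted c x ts)

theorem3 : (∀ t n → ∃[ s ] ValueSum t n s) ×
    (∀ (â b̂ ĉ d̂ ê f̂ ĝ ĥ k̂ v̂ : ℕ → ℕ) →
    (∀ n → ValueSum A n (â n)) →
    (∀ n → ValueSum B n (b̂ n)) →
    (∀ n → ValueSum C n (ĉ n)) →
    (∀ n → ValueSum D n (d̂ n)) →
    (∀ n → ValueSum E n (ê n)) →
    (∀ n → ValueSum F n (f̂ n)) →
    (∀ n → ValueSum G n (ĝ n)) →
    (∀ n → ValueSum H n (ĥ n)) →
    (∀ n → ValueSum K n (k̂ n)) →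
    (∀ n → ValueSum 𝟏 n (v̂ n)) →
    (∀ n → n ≥ 1 →
    â (suc n) ≡ 2 * â n + 2 * b̂ n + 3 * v̂ n ×
    b̂ (suc n) ≡ â n + 2 * b̂ n ×
    ĉ (suc n) ≡ 2 * â n + 3 * ĉ n + 2 * d̂ n ×
    d̂ (suc n) ≡ 2 * b̂ n + 3 * ĉ n + 4 * d̂ n + 5 * ê n ×
    ê (suc n) ≡ 3 * ĉ n + 4 * d̂ n + 6 * ê n ×
    f̂ (suc n) ≡ ĉ n + 4 * f̂ n + 2 * ĝ n ×
    ĝ (suc n) ≡ d̂ n + 6 * f̂ n + 6 * ĝ n + 5 * ĥ n ×
    ĥ (suc n) ≡ ê n + 12 * f̂ n + 12 * ĝ n + 12 * ĥ n + 12 * k̂ n ×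
    k̂ (suc n) ≡ 94 * f̂ n + 97 * ĝ n + 101 * ĥ n + 107 * k̂ n ×
    v̂ (suc n) ≡ v̂ n) ×
    (v̂ 1 ≡ 4 × â 1 ≡ 0 × b̂ 1 ≡ 0 × ĉ 1 ≡ 0 × d̂ 1 ≡ 0 × ê 1 ≡ 0 ×
    f̂ 1 ≡ 0 × ĝ 1 ≡ 0 × ĥ 1 ≡ 0 × k̂ 1 ≡ 0))
theorem3 = (λ t n → total t n , valueSum t n) , λ â b̂ ĉ d̂ ê f̂ ĝ ĥ k̂ v̂ as bs cs ds es fs gs hs ks vs →
  let x : VertexType → ℕ → ℕ
      x = λ where A → â ; B → b̂ ; C → ĉ ; D → d̂ ; E → ê ; F → f̂ ; G → ĝ ; H → ĥ ; K → k̂ ; 𝟏 → v̂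
      is : ∀ t n → x t n ≡ total t n
      is = λ where
        A n → valueSum-unique {A} {n} (as n)
        B n → valueSum-unique {B} {n} (bs n)
        C n → valueSum-unique {C} {n} (cs n)
        D n → valueSum-unique {D} {n} (ds n)
        E n → valueSum-unique {E} {n} (es n)
        F n → valueSum-unique {F} {n} (fs n)
        G n → valueSum-unique {G} {n} (gs n)
        H n → valueSum-unique {H} {n} (hs n)
        K n → valueSum-unique {K} {n} (ks n)
        𝟏 n → valueSum-unique {𝟏} {n} (vs n)
      start : ∀ t → x t 1 ≡ tally t 0 4
      start t = trans (is t 1) (initial t)
      -- The ten recurrences as one equation of lists, which `conclude` splits by matching it with
      -- `refl`.
      rows : ∀ n → n ≥ 1 → map (λ t → x t (suc n)) types ≡ map
          (λ cs → Weighted cs (map (λ s → x s n) types)) (map (λ t → map (edges t) types) types)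
      rows n n≥1 = trans (Listₚ.map-cong (λ t → trans (is t (suc n)) (trans (recurrence t n n≥1)
        (trans (cong sum (Listₚ.map-cong (λ s → cong (λ k → edges t s * k) (sym (is s n))) types))
            (weighted (edges t) (λ s → x s n) types)))) types)
        (Listₚ.map-∘ {g = λ cs → Weighted cs (map (λ s → x s n) types)} {f = λ t → map (edges t) types} types)
  in (λ n n≥1 → conclude {â n} {b̂ n} {ĉ n} {d̂ n} {ê n} {f̂ n} {ĝ n} {ĥ n} {k̂ n} {v̂ n}
      (trans (rows n n≥1) (cong (map (λ cs → Weighted cs (map (λ s → x s n) types))) edge-table)))
   , (start 𝟏 , start A , start B , start C , start D , start E , start F , start G , start H , start K)
  where
  conclude : ∀ {a b c d e f g h k v a′ b′ c′ d′ e′ f′ g′ h′ k′ v′} →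
    a′ ∷ b′ ∷ c′ ∷ d′ ∷ e′ ∷ f′ ∷ g′ ∷ h′ ∷ k′ ∷ v′ ∷ [] ≡ map
        (λ cs → Weighted cs (a ∷ b ∷ c ∷ d ∷ e ∷ f ∷ g ∷ h ∷ k ∷ v ∷ [])) edge-matrix →
    a′ ≡ 2 * a + 2 * b + 3 * v × b′ ≡ a + 2 * b × c′ ≡ 2 * a + 3 * c + 2 * d × d′ ≡ 2 * b + 3 * c + 4 * d + 5 * e ×
    e′ ≡ 3 * c + 4 * d + 6 * e × f′ ≡ c + 4 * f + 2 * g × g′ ≡ d + 6 * f + 6 * g + 5 * h ×
    h′ ≡ e + 12 * f + 12 * g + 12 * h + 12 * k × k′ ≡ 94 * f + 97 * g + 101 * h + 107 * k × v′ ≡ v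
  conclude {a} {b} {c} {d} {e} {f} {g} {h} {k} {v} refl =
    l₁ a b v , l₂ a b , l₃ a c d , l₄ b c d e , l₅ c d e , l₆ c f g , l₇ d f g h , l₈ e f g h k , l₉ f g h k , l₁₀ v
    where
    l₁ : ∀ a b v → 2 * a + (2 * b + (3 * v + 0)) ≡ 2 * a + 2 * b + 3 * v
    l₁ = ℕ-Solver.solve-∀
    l₂ : ∀ a b → 1 * a + (2 * b + 0) ≡ a + 2 * b
    l₂ = ℕ-Solver.solve-∀
    l₃ : ∀ a c d → 2 * a + (3 * c + (2 * d + 0)) ≡ 2 * a + 3 * c + 2 * d
    l₃ = ℕ-Solver.solve-∀
    l₄ : ∀ b c d e → 2 * b + (3 * c + (4 * d + (5 * e + 0))) ≡ 2 * b + 3 * c + 4 * d + 5 * e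
    l₄ = ℕ-Solver.solve-∀
    l₅ : ∀ c d e → 3 * c + (4 * d + (6 * e + 0)) ≡ 3 * c + 4 * d + 6 * e
    l₅ = ℕ-Solver.solve-∀
    l₆ : ∀ c f g → 1 * c + (4 * f + (2 * g + 0)) ≡ c + 4 * f + 2 * g
    l₆ = ℕ-Solver.solve-∀
    l₇ : ∀ d f g h → 1 * d + (6 * f + (6 * g + (5 * h + 0))) ≡ d + 6 * f + 6 * g + 5 * h
    l₇ = ℕ-Solver.solve-∀
    l₈ : ∀ e f g h k → 1 * e + (12 * f + (12 * g + (12 * h + (12 * k + 0)))) ≡ e + 12 * f + 12 * g + 12 * h + 12 * k
    l₈ = ℕ-Solver.solve-∀
    l₉ : ∀ f g h k → 94 * f + (97 * g + (101 * h + (107 * k + 0))) ≡ 94 * f + 97 * g + 101 * h + 107 * k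
    l₉ = ℕ-Solver.solve-∀
    l₁₀ : ∀ v → 1 * v + 0 ≡ v
    l₁₀ = ℕ-Solver.solve-∀
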